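{- There exists a constant $c$ such that every $n$-vertex plane triangulation with maximum degree at most $6$ has a dominating set of size at most $n/6+c$.
   Context: All graphs are finite and simple. A plane triangulation is a simple graph embedded in the plane (equivalently, the sphere) without crossings such that every face is bounded by a triangle. A dominating set of a graph $G$ is a set $D\subseteq V(G)$ such that every vertex of $G$ is in $D$ or adjacent to a vertex of $D$. -}

module Defs where

open import Data.Nat using (ℕ; zero; suc; _+_; _*_; _≤_; _<?_; s≤s)
open import Data.Fin using (Fin; zero; suc; toℕ; fromℕ<)
open import Data.List using (List; map; allFin; length)
open import Data.Nat.ListAction using (sum)
open import Data.List.Membership.Propositional using (_∈_)
open import Data.Product using (Σ; ∃; _×_; _,_)
open import Data.Sum using (_⊎_)
open import Relation.Nullary using (¬_; yes; no)
open import Relation.Binary.PropositionalEquality using (_≡_; _≢_)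
open import Function.Definitions using (Injective)

csuc : ∀ {d} → Fin d → Fin d
csuc {suc d} i with suc (toℕ i) <? suc d
... | yes p = fromℕ< p
... | no _  = zero

-- A rotation system on vertex set Fin n: every vertex v has deg v neighbours
-- listed in cyclic (clockwise) order  nbr v 0, nbr v 1, …, nbr v (deg v - 1).
record RotationSystem (n : ℕ) : Set where
  field
    deg : Fin n → ℕ
    nbr : (v : Fin n) → Fin (deg v) → Fin n

open RotationSystem public

Adj : ∀ {n} → RotationSystem n → Fin n → Fin n → Set
Adj R u w = ∃ λ t → nbr R u t ≡ w

Succ : ∀ {n} → RotationSystem n → Fin n → Fin n → Fin n → Set
Succ R v u w = ∃ λ s → (nbr R v s ≡ u) × (nbr R v (csuc s) ≡ w)

data Reach {n} (R : RotationSystem n) : Fin n → Fin n → Set where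
  here : ∀ {u} → Reach R u u
  step : ∀ {u v w} → Adj R u v → Reach R v w → Reach R u w

degSum : ∀ {n} → RotationSystem n → ℕ
degSum {n} R = sum (map (deg R) (allFin n))

-- A plane triangulation on n vertices, given combinatorially by a rotation
-- system (Heffter–Edmonds–Ringel) of a simple connected graph such that
--  * every face (orbit of (u,v) ↦ (v, succ_v u)) is a triangle, and
--  * the embedding is in the sphere: Euler's formula V - E + F = 2, which,
--    since every face is a triangle (E = degSum/2, F = degSum/3), reads
--    degSum + 12 = 6 n.
record IsPlaneTriangulation {n} (R : RotationSystem n) : Set where
  field
    noLoop    : ∀ v t → nbr R v t ≢ v
    noMulti   : ∀ v → Injective _≡_ _≡_ (nbr R v)
    symmetric : ∀ u w → Adj R u w → Adj R w u
    connected : ∀ u w → Reach R u w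
    triangular : ∀ u v w → Succ R v u w → Succ R w v u × Succ R u w v
    euler : degSum R + 12 ≡ 6 * n

Dominating : ∀ {n} → RotationSystem n → List (Fin n) → Set
Dominating {n} R D = ∀ (v : Fin n) → (v ∈ D) ⊎ (∃ λ u → (u ∈ D) × Adj R u v)

{-# OPTIONS --safe #-}
-- Let D be a minimum dominating set. By Euler's formula at most 12 vertices have degree less than 6, so away
-- from boundedly many vertices the triangulation looks like the triangular lattice Λ, which acts on the darts
-- (directed edges) by translations. Exchanging the part of D inside a flat patch for any set that dominates the
-- neighbourhood of the patch cannot make D smaller. If no short translation fixes a dart, then the dart sees a
-- large embedded parallelogram, which the perfect code of density 1/7 dominates at a cost below 1/6, and
-- averaging the exchange inequality over all such darts bounds the density of D among them by 1/6.
-- Otherwise the dart lies on a tube Λ / w: a rotation fixing it would create a cone point, and two independent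
-- translations would close up the surface to a torus with all degrees 6, against Euler's formula. A wide tube
-- is cut open and treated with the perfect code again. A narrow tube may need density exactly 1/6 (for instance
-- if w consists of three steps in one direction), so no bounded patch suffices. There the exchange is made along
-- a whole maximal tube, for a periodic pattern of density at most 1/6; as every maximal tube ends near a vertex
-- of degree less than 6, the boundary effects are bounded.
module Submission where

open import Defs
open import Data.Empty using (⊥; ⊥-elim)
open import Data.Fin as Fin using (Fin; zero; suc; toℕ; fromℕ; fromℕ<; inject₁)
open import Data.Fin.Patterns
import Data.Fin.Properties as Finₚ
open import Data.Integer as ℤ using (ℤ; +_; -[1+_]; ∣_∣; 0ℤ; 1ℤ; -1ℤ; +≤+; -≤+)
import Data.Integer.DivMod as DM
import Data.Integer.Properties as ℤₚ
open import Data.Integer.Tactic.RingSolver using () renaming (solve-∀ to ℤ-solve-∀)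
open import Data.List using (List; []; _∷_; _++_; map; concatMap; filter; length; allFin; upTo; cartesianProduct; cartesianProductWith)
open import Data.List.Membership.DecPropositional using () renaming (_∈?_ to member?)
open import Data.List.Membership.Propositional using (_∈_; _∉_; find)
open import Data.List.Membership.Propositional.Properties using (∈-++⁺ʳ; ∈-++⁺ˡ; ∈-++⁻; ∈-allFin; ∈-cartesianProductWith⁺; ∈-cartesianProductWith⁻; ∈-cartesianProduct⁻; ∈-concatMap⁺; ∈-concatMap⁻; ∈-filter⁺; ∈-filter⁻; ∈-map⁺; ∈-map⁻; ∈-upTo⁺; ∈-upTo⁻; ∈-∃++)
import Data.List.Properties as Listₚ
open import Data.List.Relation.Binary.Subset.Propositional using (_⊆_)
open import Data.List.Relation.Unary.All as All using (All; []; _∷_)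
import Data.List.Relation.Unary.All.Properties as Allₚ
open import Data.List.Relation.Unary.AllPairs using ([]; _∷_)
open import Data.List.Relation.Unary.Any as Any using (Any; here; there)
open import Data.List.Relation.Unary.Unique.Propositional using (Unique)
import Data.List.Relation.Unary.Unique.Propositional.Properties as Uniqueₚ
open import Data.Nat as ℕ using (ℕ; zero; suc; _+_; _*_; _∸_; _^_; _⊔_; _≤_; _<_; z≤n; s≤s; _<?_; _≤?_; _/_; _%_; NonZero)
open import Data.Nat.DivMod using (m/n*n≤m; m≡m%n+[m/n]*n; m%n<n)
open import Data.Nat.ListAction using (sum)
open import Data.Nat.Properties using (*-cancelʳ-≤; *-cancelˡ-≤; *-comm; *-distribˡ-+; *-identityʳ; *-identityˡ; *-monoʳ-≤; *-monoˡ-≤; *-suc; *-zeroʳ; +-assoc; +-cancelʳ-≤; +-cancelˡ-≡; +-comm; +-identityʳ; +-mono-≤; +-monoʳ-≤; +-monoˡ-≤; +-suc; <-cmp; <-irrefl; <-trans; <-≤-trans; <⇒≤; m+1+n≢m; m+[n∸m]≡n; m+n≤o⇒m≤o; m+n≤o⇒n≤o; m<n⇒0<n∸m; m∸n+n≡m; m≤m*n; m≤m+n; m≤m⊔n; m≤n*m; m≤n+m; m≤n⇒m<n∨m≡n; m≤n⇒m⊔n≡n; m≤n⊔m; m≥n⇒m⊔n≡m; n<1+n; n≤1+n; ≤-<-trans; ≤-antisym; ≤-pred; ≤-refl; ≤-reflexive; ≤-total; ≤-trans; ≤ᵇ⇒≤; ≤∧≢⇒<; ≮⇒≥; ⊔-assoc;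 ⊔-comm; ⊔-lub; +-commutativeSemigroup; *-commutativeSemigroup; module ≤-Reasoning)
open import Data.Nat.Tactic.RingSolver using (solve-∀)
open import Data.Product using (_×_; _,_; proj₁; proj₂; Σ; ∃; ∃₂)
import Data.Product.Properties as Productₚ
open import Data.Sum using (_⊎_; inj₁; inj₂)
open import Data.Vec using (Vec; []; _∷_; toList; fromList)
import Data.Vec.Properties as Vecₚ
open import Function using (_∘_; id)
open import Relation.Binary.Definitions using (tri<; tri≈; tri>)
open import Relation.Binary.PropositionalEquality hiding (J)
open import Relation.Nullary using (¬_; Dec; yes; no; ¬?)
open import Relation.Nullary.Decidable using (_×-dec_; _⊎-dec_; map′; toWitness)
open import Relation.Unary using (Decidable)
open import Algebra.Properties.CommutativeSemigroup +-commutativeSemigroup using (interchange; x∙yz≈y∙xz)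
open import Algebra.Properties.CommutativeSemigroup *-commutativeSemigroup using () renaming (x∙yz≈y∙xz to *-swap)

-- Sums over lists

-- A dart serves as a local coordinate frame. `T₁` and `T₂` are permutations of all darts of the
-- triangulation, and only the identities between them need degree 6, so no developing map or
-- covering space is constructed. Every identity asks instead for enough distance from the vertices
-- of smaller degree, measured in multiples of one radius `ρ`. Finitely many cases, each with its
-- own demand on `ρ`, have to be combined, so `Sparse` asks for a bound for every large `ρ`.
--
-- The cases are indexed by the least length `b`, measured by `hex`, of a vector that fixes the
-- dart. On a strip of width `b` cut open, the perfect code pays for two more rows, so it costs
-- about (b + 2) / 7 per column; this is below b / 6 exactly when b > 12. Widths 3 to 12 therefore
-- need explicit patterns, while widths 1 and 2 would force a loop or a double edge. The length of a
-- narrow tube is not bounded in terms of `ρ`. The exclusion of tori and of cone points, which works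
-- within reach of `ρ`, must therefore be repeated there along walks of arbitrary length.

private variable
  E E′ : Set

total : (E → ℕ) → List E → ℕ
total F []       = 0
total F (x ∷ xs) = F x + total F xs

total-++ : ∀ (F : E → ℕ) xs ys → total F (xs ++ ys) ≡ total F xs + total F ys
total-++ F []       ys = refl
total-++ F (x ∷ xs) ys = trans (cong (λ k → F x + k) (total-++ F xs ys)) (sym (+-assoc (F x) _ _))

total-map : ∀ (F : E′ → ℕ) (g : E → E′) xs → total F (map g xs) ≡ total (F ∘ g) xs
total-map F g []       = refl
total-map F g (x ∷ xs) = cong (λ k → F (g x) + k) (total-map F g xs)

total-concatMap : ∀ (F : E′ → ℕ) (g : E → List E′) xs → total F (concatMap g xs) ≡ total (total F ∘ g) xs
total-concatMap F g []       = refl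
total-concatMap F g (x ∷ xs) = trans (total-++ F (g x) (concatMap g xs)) (cong (λ k → total F (g x) + k) (total-concatMap F g xs))

total-mono : ∀ {F H : E → ℕ} xs → (∀ {x} → x ∈ xs → F x ≤ H x) → total F xs ≤ total H xs
total-mono []       F≤H = z≤n
total-mono (x ∷ xs) F≤H = +-mono-≤ (F≤H (here refl)) (total-mono xs (F≤H ∘ there))

total-const : ∀ c (xs : List E) → total (λ _ → c) xs ≡ length xs * c
total-const c []       = refl
total-const c (x ∷ xs) = cong (λ k → c + k) (total-const c xs)

total-+ : ∀ (F H : E → ℕ) xs → total (λ x → F x + H x) xs ≡ total F xs + total H xs
total-+ F H []       = refl
total-+ F H (x ∷ xs) = trans (cong (λ k → F x + H x + k) (total-+ F H xs)) (interchange (F x) (H x) _ _)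

total-swap : ∀ (F : E → E′ → ℕ) xs ys → total (λ x → total (F x) ys) xs ≡ total (λ y → total (λ x → F x y) xs) ys
total-swap F []       ys = sym (trans (total-const 0 ys) (*-zeroʳ (length ys)))
total-swap F (x ∷ xs) ys = trans (cong (λ k → total (F x) ys + k) (total-swap F xs ys)) (sym (total-+ (F x) _ ys))

member≤total : ∀ (F : E → ℕ) {x xs} → x ∈ xs → F x ≤ total F xs
member≤total F (here refl) = m≤m+n _ _
member≤total F (there x∈) = ≤-trans (member≤total F x∈) (m≤n+m _ _)

length≡total : ∀ (xs : List E) → length xs ≡ total (λ _ → 1) xs
length≡total xs = sym (trans (total-const 1 xs) (*-identityʳ (length xs)))

total-⊆ : ∀ (F : E → ℕ) {xs ys} → Unique xs → xs ⊆ ys → total F xs ≤ total F ys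
total-⊆ F {[]} _ _ = z≤n
total-⊆ F {x ∷ xs} (x∉ ∷ u) xs⊆ys with ∈-∃++ (xs⊆ys (here refl))
... | as , bs , refl = begin
  F x + total F xs ≤⟨ +-monoʳ-≤ (F x) (total-⊆ F u rest) ⟩
  F x + total F (as ++ bs) ≡⟨ cong (λ k → F x + k) (total-++ F as bs) ⟩
  F x + (total F as + total F bs) ≡⟨ x∙yz≈y∙xz (F x) (total F as) (total F bs) ⟩
  total F as + (F x + total F bs) ≡⟨ total-++ F as (x ∷ bs) ⟨
  total F (as ++ x ∷ bs) ∎
  where
  open ≤-Reasoning
  rest : xs ⊆ as ++ bs
  rest {y} y∈ with ∈-++⁻ as (xs⊆ys (there y∈))
  ... | inj₁ y∈as          = ∈-++⁺ˡ y∈as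
  ... | inj₂ (here refl)   = ⊥-elim (All.lookup x∉ y∈ refl)
  ... | inj₂ (there y∈bs)  = ∈-++⁺ʳ as y∈bs

length-⊆ : ∀ {xs ys : List E} → Unique xs → xs ⊆ ys → length xs ≤ length ys
length-⊆ {xs = xs} {ys} u xs⊆ys = subst₂ _≤_ (sym (length≡total xs)) (sym (length≡total ys)) (total-⊆ (λ _ → 1) u xs⊆ys)

total-filter : ∀ {P : E → Set} (P? : Decidable P) (F : E → ℕ) xs →
               total F xs ≡ total F (filter P? xs) + total F (filter (¬? ∘ P?) xs)
total-filter P? F [] = refl
total-filter P? F (x ∷ xs) with P? x
... | yes _ = trans (cong (λ k → F x + k) (total-filter P? F xs)) (sym (+-assoc (F x) _ _))
... | no  _ = trans (cong (λ k → F x + k) (total-filter P? F xs)) (x∙yz≈y∙xz (F x) (total F (filter P? xs)) (total F (filter (¬? ∘ P?) xs)))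

length-filter-split : ∀ {P : E → Set} (P? : Decidable P) xs →
                      length xs ≡ length (filter P? xs) + length (filter (¬? ∘ P?) xs)
length-filter-split P? xs = trans (length≡total xs) (trans (total-filter P? (λ _ → 1) xs)
  (sym (cong₂ _+_ (length≡total (filter P? xs)) (length≡total (filter (¬? ∘ P?) xs)))))

unique-map : ∀ (g : E → E′) {xs} → Unique xs → (∀ {x y} → x ∈ xs → y ∈ xs → g x ≡ g y → x ≡ y) → Unique (map g xs)
unique-map g [] inj = []
unique-map g (x∉ ∷ u) inj =
  Allₚ.map⁺ (All.tabulate (λ y∈ eq → All.lookup x∉ y∈ (inj (here refl) (there y∈) eq))) ∷
  unique-map g u (λ x∈ y∈ → inj (there x∈) (there y∈))

unique-concatMap : ∀ (g : E → List E′) {xs} → Unique xs → (∀ {x} → x ∈ xs → Unique (g x)) →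
  (∀ {x y z} → x ∈ xs → y ∈ xs → z ∈ g x → z ∈ g y → x ≡ y) → Unique (concatMap g xs)
unique-concatMap g [] _ _ = []
unique-concatMap g (x∉ ∷ u) u-g disj = Uniqueₚ.++⁺ (u-g (here refl))
  (unique-concatMap g u (u-g ∘ there) (λ x∈ y∈ → disj (there x∈) (there y∈)))
  λ (z∈gx , z∈) → let (y , y∈ , z∈gy) = find (∈-concatMap⁻ g z∈) in
    All.lookup x∉ y∈ (disj (here refl) (there y∈) z∈gx z∈gy)

length-concatMap : (g : E → List E′) (m : ℕ) → (∀ a → length (g a) ≤ m) → ∀ as → length (concatMap g as) ≤ length as * m
length-concatMap g m g≤ [] = z≤n
length-concatMap g m g≤ (a ∷ as) = ≤-trans (≤-reflexive (Listₚ.length-++ (g a))) (+-mono-≤ (g≤ a) (length-concatMap g m g≤ as))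

length-allFin : ∀ m → length (allFin m) ≡ m
length-allFin m = Listₚ.length-tabulate {n = m} id

-- The triangular lattice and permutations

Λ : Set
Λ = ℤ × ℤ

infixl 6 _⊕_
infix 8 ⊝_
infixl 7 _·_

_⊕_ : Λ → Λ → Λ
(i , j) ⊕ (k , l) = i ℤ.+ k , j ℤ.+ l

⊝_ : Λ → Λ
⊝ (i , j) = ℤ.- i , ℤ.- j

_·_ : ℤ → Λ → Λ
c · (i , j) = c ℤ.* i , c ℤ.* j

𝟘 : Λ
𝟘 = 0ℤ , 0ℤ

-- Multiplication by a primitive sixth root of unity on the Eisenstein integers `i + j ω`, where
-- `ω² = ω - 1`.
ω : Λ → Λ
ω (i , j) = ℤ.- j , i ℤ.+ j

∥_∥ : Λ → ℕ
∥ i , j ∥ = ∣ i ∣ + ∣ j ∣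

-- The graph distance from the origin in the lattice whose edges are the six units.
hex : Λ → ℕ
hex (i , j) = ∣ i ∣ ⊔ ∣ j ∣ ⊔ ∣ i ℤ.+ j ∣

det : Λ → Λ → ℤ
det (i , j) (k , l) = i ℤ.* l ℤ.- j ℤ.* k

_≟Λ_ : (p q : Λ) → Dec (p ≡ q)
_≟Λ_ = Productₚ.≡-dec ℤ._≟_ ℤ._≟_

∥⊕∥ : ∀ p q → ∥ p ⊕ q ∥ ≤ ∥ p ∥ + ∥ q ∥
∥⊕∥ (i , j) (k , l) = begin
  ∣ i ℤ.+ k ∣ + ∣ j ℤ.+ l ∣ ≤⟨ +-mono-≤ (ℤₚ.∣i+j∣≤∣i∣+∣j∣ i k) (ℤₚ.∣i+j∣≤∣i∣+∣j∣ j l) ⟩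
  (∣ i ∣ + ∣ k ∣) + (∣ j ∣ + ∣ l ∣) ≡⟨ interchange (∣ i ∣) (∣ k ∣) (∣ j ∣) (∣ l ∣) ⟩
  (∣ i ∣ + ∣ j ∣) + (∣ k ∣ + ∣ l ∣) ∎
  where
  open ≤-Reasoning

∥⊝∥ : ∀ p → ∥ ⊝ p ∥ ≡ ∥ p ∥
∥⊝∥ (i , j) = cong₂ _+_ (ℤₚ.∣-i∣≡∣i∣ i) (ℤₚ.∣-i∣≡∣i∣ j)

∥·∥ : ∀ c p → ∥ c · p ∥ ≡ ∣ c ∣ * ∥ p ∥
∥·∥ c (i , j) = trans (cong₂ _+_ (ℤₚ.abs-* c i) (ℤₚ.abs-* c j)) (sym (*-distribˡ-+ (∣ c ∣) (∣ i ∣) (∣ j ∣)))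

⊕-comm : ∀ p q → p ⊕ q ≡ q ⊕ p
⊕-comm (i , j) (k , l) = cong₂ _,_ (ℤₚ.+-comm i k) (ℤₚ.+-comm j l)

⊕-assoc : ∀ p q s → (p ⊕ q) ⊕ s ≡ p ⊕ (q ⊕ s)
⊕-assoc (i , j) (k , l) (m , n) = cong₂ _,_ (ℤₚ.+-assoc i k m) (ℤₚ.+-assoc j l n)

⊕-inverseʳ : ∀ p → p ⊕ ⊝ p ≡ 𝟘
⊕-inverseʳ (i , j) = cong₂ _,_ (ℤₚ.+-inverseʳ i) (ℤₚ.+-inverseʳ j)

⊕-inverseˡ : ∀ p → ⊝ p ⊕ p ≡ 𝟘
⊕-inverseˡ (i , j) = cong₂ _,_ (ℤₚ.+-inverseˡ i) (ℤₚ.+-inverseˡ j)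

⊕-identityʳ : ∀ p → p ⊕ 𝟘 ≡ p
⊕-identityʳ (i , j) = cong₂ _,_ (ℤₚ.+-identityʳ i) (ℤₚ.+-identityʳ j)

⊕-identityˡ : ∀ p → 𝟘 ⊕ p ≡ p
⊕-identityˡ (i , j) = cong₂ _,_ (ℤₚ.+-identityˡ i) (ℤₚ.+-identityˡ j)

ω³ : ∀ p → ω (ω (ω p)) ≡ ⊝ p
ω³ (i , j) = cong₂ _,_ (e₁ i j) (e₂ i j)
  where
  e₁ : ∀ i j → ℤ.- (ℤ.- j ℤ.+ (i ℤ.+ j)) ≡ ℤ.- i
  e₁ = ℤ-solve-∀
  e₂ : ∀ i j → ℤ.- (i ℤ.+ j) ℤ.+ (ℤ.- j ℤ.+ (i ℤ.+ j)) ≡ ℤ.- j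
  e₂ = ℤ-solve-∀

-- Integer powers of permutations

ℤ-ind : (P : ℤ → Set) → P 0ℤ → (∀ i → P i → P (ℤ.suc i)) → (∀ i → P i → P (ℤ.pred i)) → ∀ i → P i
ℤ-ind P z s p (+ zero) = z
ℤ-ind P z s p (+ suc n) = s (+ n) (ℤ-ind P z s p (+ n))
ℤ-ind P z s p -[1+ zero ] = p 0ℤ z
ℤ-ind P z s p -[1+ suc n ] = p -[1+ n ] (ℤ-ind P z s p -[1+ n ])

iter : {X : Set} → ℕ → (X → X) → X → X
iter zero    f x = x
iter (suc n) f x = f (iter n f x)

record Perm (X : Set) : Set where
  field
    to from : X → X
    to-from : ∀ x → to (from x) ≡ x
    from-to : ∀ x → from (to x) ≡ x

open Perm public

to-injective : {X : Set} (p : Perm X) → ∀ {x y} → to p x ≡ to p y → x ≡ y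
to-injective p {x} {y} eq = trans (sym (from-to p x)) (trans (cong (from p) eq) (from-to p y))

pow : {X : Set} → Perm X → ℤ → X → X
pow p (+ n)    = iter n (to p)
pow p -[1+ n ] = iter (suc n) (from p)

module _ {X : Set} (p : Perm X) where

  pow-suc : ∀ i x → pow p (ℤ.suc i) x ≡ to p (pow p i x)
  pow-suc (+ n) x = refl
  pow-suc -[1+ zero ] x = sym (to-from p x)
  pow-suc -[1+ suc n ] x = sym (to-from p _)

  pow-pred : ∀ i x → pow p (ℤ.pred i) x ≡ from p (pow p i x)
  pow-pred (+ zero) x = refl
  pow-pred (+ suc n) x = sym (from-to p _)
  pow-pred -[1+ n ] x = refl

  pow-+ : ∀ i j x → pow p (i ℤ.+ j) x ≡ pow p i (pow p j x)
  pow-+ i j x = ℤ-ind (λ i → pow p (i ℤ.+ j) x ≡ pow p i (pow p j x))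
    (cong (λ k → pow p k x) (ℤₚ.+-identityˡ j))
    (λ i ih → trans (cong (λ k → pow p k x) (ℤₚ.+-assoc 1ℤ i j))
      (trans (pow-suc (i ℤ.+ j) x) (trans (cong (to p) ih) (sym (pow-suc i (pow p j x))))))
    (λ i ih → trans (cong (λ k → pow p k x) (ℤₚ.+-assoc (ℤ.- 1ℤ) i j))
      (trans (pow-pred (i ℤ.+ j) x) (trans (cong (from p) ih) (sym (pow-pred i (pow p j x)))))) i

  pow-perm : ℤ → Perm X
  pow-perm i = record
    { to = pow p i ; from = pow p (ℤ.- i)
    ; to-from = λ x → trans (sym (pow-+ i (ℤ.- i) x)) (cong (λ k → pow p k x) (ℤₚ.+-inverseʳ i))
    ; from-to = λ x → trans (sym (pow-+ (ℤ.- i) i x)) (cong (λ k → pow p k x) (ℤₚ.+-inverseˡ i))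
    }

_∘ₚ_ : {X : Set} → Perm X → Perm X → Perm X
p ∘ₚ q = record
  { to = to p ∘ to q ; from = from q ∘ from p
  ; to-from = λ x → trans (cong (to p) (to-from q (from p x))) (to-from p x)
  ; from-to = λ x → trans (cong (from q) (from-to p (to q x))) (from-to q x)
  }

conj : {X : Set} → Perm X → Perm X → Perm X
conj s p = record
  { to = to s ∘ to p ∘ from s ; from = to s ∘ from p ∘ from s
  ; to-from = λ x → trans (cong (to s ∘ to p) (from-to s _)) (trans (cong (to s) (to-from p _)) (to-from s x))
  ; from-to = λ x → trans (cong (to s ∘ from p) (from-to s _)) (trans (cong (to s) (from-to p _)) (to-from s x))
  }

pow-conj : {X : Set} (s p : Perm X) → ∀ i x → to s (pow p i x) ≡ pow (conj s p) i (to s x)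
pow-conj s p i x = ℤ-ind (λ i → to s (pow p i x) ≡ pow (conj s p) i (to s x)) refl
  (λ i ih → trans (cong (to s) (pow-suc p i x))
     (trans (cong (to s ∘ to p) (sym (from-to s _)))
       (trans (cong (to s ∘ to p ∘ from s) ih) (sym (pow-suc (conj s p) i _)))))
  (λ i ih → trans (cong (to s) (pow-pred p i x))
     (trans (cong (to s ∘ from p) (sym (from-to s _)))
       (trans (cong (to s ∘ from p ∘ from s) ih) (sym (pow-pred (conj s p) i _))))) i

iter-out : ∀ {X : Set} m (g : X → X) x → g (iter m g x) ≡ iter m g (g x)
iter-out zero    g x = refl
iter-out (suc m) g x = cong g (iter-out m g x)

iter-+ : ∀ {X : Set} m k (g : X → X) x → iter (m + k) g x ≡ iter m g (iter k g x)
iter-+ zero    k g x = refl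
iter-+ (suc m) k g x = cong g (iter-+ m k g x)

iter-injective : ∀ {X : Set} (p : Perm X) m {x y} → iter m (to p) x ≡ iter m (to p) y → x ≡ y
iter-injective p zero    eq = eq
iter-injective p (suc m) eq = iter-injective p m (to-injective p eq)

iter-return : ∀ {X : Set} (p : Perm X) {i j} x → i < j → iter i (to p) x ≡ iter j (to p) x → ∃ λ d → 1 ≤ d × i + d ≡ j × iter d (to p) x ≡ x
iter-return p {i} {j} x i<j eq = j ∸ i , m<n⇒0<n∸m i<j , i+d≡j , sym (iter-injective p i (trans eq (trans (cong (λ k → iter k (to p) x) (sym i+d≡j)) (iter-+ i (j ∸ i) (to p) x))))
  where
  i+d≡j = m+[n∸m]≡n (<⇒≤ i<j)

-- Darts

cpred : ∀ {d} → Fin d → Fin d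
cpred {suc d} zero    = fromℕ d
cpred {suc d} (suc i) = inject₁ i

csuc-cpred : ∀ {d} (i : Fin d) → csuc (cpred i) ≡ i
csuc-cpred {suc d} zero with suc (toℕ (fromℕ d)) <? suc d
... | yes p = ⊥-elim (<-irrefl (Finₚ.toℕ-fromℕ d) (≤-pred p))
... | no _  = refl
csuc-cpred {suc d} (suc i) with suc (toℕ (inject₁ i)) <? suc d
... | yes p = Finₚ.toℕ-injective (trans (Finₚ.toℕ-fromℕ< p) (cong suc (Finₚ.toℕ-inject₁ i)))
... | no ¬p = ⊥-elim (¬p (s≤s (subst (_< d) (sym (Finₚ.toℕ-inject₁ i)) (Finₚ.toℕ<n i))))

cpred-csuc : ∀ {d} (i : Fin d) → cpred (csuc i) ≡ i
cpred-csuc {suc d} i with suc (toℕ i) <? suc d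
... | yes (s≤s p) = Finₚ.toℕ-injective (trans (Finₚ.toℕ-inject₁ (fromℕ< p)) (Finₚ.toℕ-fromℕ< p))
... | no ¬p = Finₚ.toℕ-injective (trans (Finₚ.toℕ-fromℕ d) (≤-antisym (≮⇒≥ (¬p ∘ s≤s)) (≤-pred (Finₚ.toℕ<n i))))

csuc⁶ : ∀ {d} → d ≡ 6 → (s : Fin d) → iter 6 csuc s ≡ s
csuc⁶ refl = toWitness {a? = Finₚ.all? λ s → iter 6 csuc s Fin.≟ s} _

csuc-orbit : ∀ {d} → d ≡ 6 → (s t : Fin d) → ∃ λ (m : Fin 6) → iter (toℕ m) csuc s ≡ t
csuc-orbit refl = toWitness {a? = Finₚ.all? λ s → Finₚ.all? λ t → Finₚ.any? λ m → iter (toℕ m) csuc s Fin.≟ t} _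

csuc-free : ∀ {d} → d ≡ 6 → (m : Fin 6) → m ≢ zero → (s : Fin d) → iter (toℕ m) csuc s ≢ s
csuc-free refl zero m≢0 = λ _ _ → m≢0 refl
csuc-free refl (suc m) _ = toWitness {a? = Finₚ.all? λ m → Finₚ.all? λ s → ¬? (iter (suc (toℕ m)) csuc s Fin.≟ s)} _ m

record Triangulation : Set where
  field
    {order}  : ℕ
    rotation : RotationSystem order
    planar   : IsPlaneTriangulation rotation
    Δ≤6      : ∀ v → deg rotation v ≤ 6

module Darts (G : Triangulation) where
  open Triangulation G renaming (order to n; rotation to R) public
  open IsPlaneTriangulation planar public

  V : Set
  V = Fin n

  Dart : Set
  Dart = Σ V λ v → Fin (deg R v)

  vert nb : Dart → V
  vert = proj₁
  nb (v , s) = nbr R v s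

  dart-ext : ∀ {x y} → vert x ≡ vert y → nb x ≡ nb y → x ≡ y
  dart-ext {v , _} refl eq = cong (v ,_) (noMulti v eq)

  _≟ᵈ_ : (x y : Dart) → Dec (x ≡ y)
  (u , s) ≟ᵈ (v , t) with u Fin.≟ v
  ... | no u≢v = no (u≢v ∘ cong proj₁)
  ... | yes refl with s Fin.≟ t
  ...   | yes refl = yes refl
  ...   | no s≢t   = no λ where refl → s≢t refl

  rot : Perm Dart
  rot = record
    { to = λ (v , s) → v , csuc s ; from = λ (v , s) → v , cpred s
    ; to-from = λ (v , s) → cong (v ,_) (csuc-cpred s)
    ; from-to = λ (v , s) → cong (v ,_) (cpred-csuc s)
    }

  r r⁻ f : Dart → Dart
  r  = to rot
  r⁻ = from rot
  f (v , s) = nbr R v s , proj₁ (symmetric v (nbr R v s) (s , refl))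

  nb-f : ∀ x → nb (f x) ≡ vert x
  nb-f (v , s) = proj₂ (symmetric v (nbr R v s) (s , refl))

  f-f : ∀ x → f (f x) ≡ x
  f-f x = dart-ext (nb-f x) (nb-f (f x))

  -- Equivalently, the cube of `f ∘ r` is the identity. Darts are compared by their two ends, which
  -- determine them because there are no multiple edges.
  triangle : ∀ x → r (f (r (f (r x)))) ≡ f x
  triangle x@(v , s) with triangular (nb x) v (nb (r x)) (s , refl , refl)
  ... | (t , t-v , t-u) , (t′ , t′-w , t′-v) = dart-ext third fourth
    where
    y = f (r x)
    y≡ : (nb (r x) , t) ≡ y
    y≡ = dart-ext refl (trans t-v (sym (nb-f (r x))))
    third : nb (r y) ≡ nb x
    third = trans (sym (cong (nb ∘ r) y≡)) t-u
    z≡ : (nb x , t′) ≡ f (r y)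
    z≡ = dart-ext (sym third) (trans t′-w (sym (nb-f (r y))))
    fourth : nb (r (f (r y))) ≡ nb (f x)
    fourth = trans (sym (cong (nb ∘ r) z≡)) (trans t′-v (sym (nb-f x)))

  -- The face relation solved for a turn between two flips. It holds at every dart, whatever the
  -- degrees.
  frf : ∀ x → f (r (f x)) ≡ r⁻ (f (r⁻ x))
  frf x = begin
    f (r (f x)) ≡⟨ from-to rot _ ⟨
    r⁻ (r (f (r (f x)))) ≡⟨ cong (λ z → r⁻ (r (f (r (f z))))) (to-from rot x) ⟨
    r⁻ (r (f (r (f (r (r⁻ x)))))) ≡⟨ cong r⁻ (triangle (r⁻ x)) ⟩
    r⁻ (f (r⁻ x)) ∎
    where open ≡-Reasoning

  iter-r : ∀ m v s → iter m r (v , s) ≡ (v , iter m csuc s)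
  iter-r zero    v s = refl
  iter-r (suc m) v s = cong r (iter-r m v s)

  vert-iter-r : ∀ m x → vert (iter m r x) ≡ vert x
  vert-iter-r m (v , s) = cong vert (iter-r m v s)

  r⁶ : ∀ x → deg R (vert x) ≡ 6 → iter 6 r x ≡ x
  r⁶ (v , s) d≡6 = cong (v ,_) (csuc⁶ d≡6 s)

  r-orbit : ∀ x y → vert x ≡ vert y → deg R (vert x) ≡ 6 → ∃ λ (m : Fin 6) → iter (toℕ m) r x ≡ y
  r-orbit (v , s) (_ , t) refl d≡6 with csuc-orbit d≡6 s t
  ... | m , eq = m , trans (iter-r (toℕ m) v s) (cong (v ,_) eq)

  r-free : ∀ m → m ≢ zero → ∀ x → deg R (vert x) ≡ 6 → iter (toℕ m) r x ≢ x
  r-free m m≢0 (v , s) d≡6 eq = csuc-free d≡6 m m≢0 s (lemma (trans (sym (iter-r (toℕ m) v s)) eq))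
    where
    lemma : ∀ {s t : Fin (deg R v)} → _≡_ {A = Dart} (v , s) (v , t) → s ≡ t
    lemma refl = refl

  no-loop : ∀ x → vert (f x) ≢ vert x
  no-loop (v , s) = noLoop v s

  no-multi : ∀ x y → vert x ≡ vert y → vert (f x) ≡ vert (f y) → x ≡ y
  no-multi x y = dart-ext

  bad? : ∀ v → Dec (deg R v ≢ 6)
  bad? v = ¬? (deg R v ℕ.≟ 6)

  bad : List V
  bad = filter bad? (allFin n)

  neighbours : V → List V
  neighbours v = map (nbr R v) (allFin (deg R v))

  nearBad : ℕ → List V
  nearBad zero    = bad
  nearBad (suc k) = nearBad k ++ concatMap neighbours (nearBad k)

  -- A record rather than a synonym for non-membership, so that `k` and `v` can be read off the type
  -- without unfolding `nearBad k`.
  record Away (k : ℕ) (v : V) : Set where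
    constructor away
    field avoid : v ∉ nearBad k

  open Away public

  Flat : ℕ → Dart → Set
  Flat k x = Away k (vert x)

  flat-pred : ∀ {k x} → Flat (suc k) x → Flat k x
  flat-pred fl = away λ x∈ → avoid fl (∈-++⁺ˡ x∈)

  flat-mono′ : ∀ j {k x} → Flat (j + k) x → Flat k x
  flat-mono′ zero    fl = fl
  flat-mono′ (suc j) {k} {x} fl = flat-mono′ j {k} {x} (flat-pred {j + k} {x} fl)

  flat-mono : ∀ {j k} x → j ≤ k → Flat k x → Flat j x
  flat-mono {j} {k} x j≤k fl = flat-mono′ (k ∸ j) {j} {x} (subst (λ m → Flat m x) (sym (m∸n+n≡m j≤k)) fl)

  flat-f : ∀ {k} x → Flat (suc k) x → Flat k (f x)
  flat-f {k} x fl = away λ fx∈ → avoid fl (∈-++⁺ʳ (nearBad k) (∈-concatMap⁺ neighbours (Any.map (λ where refl → vx∈) fx∈)))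
    where
    vx∈ : vert x ∈ neighbours (vert (f x))
    vx∈ = subst (_∈ neighbours (vert (f x))) (nb-f x) (∈-map⁺ (nbr R (vert (f x))) (∈-allFin (proj₂ (f x))))

  flat-deg : ∀ {k} x → Flat k x → deg R (vert x) ≡ 6
  flat-deg {k} x fl with deg R (vert x) ℕ.≟ 6
  ... | yes d≡6 = d≡6
  ... | no  d≢6 = ⊥-elim (avoid (flat-mono {0} {k} x z≤n fl) (∈-filter⁺ bad? (∈-allFin (vert x)) d≢6))

  -- Σ (6 - deg v) = 12, and every bad vertex contributes at least one
  bad≤12 : length bad ≤ 12
  bad≤12 = +-cancelʳ-≤ (degSum R) _ _ (≤-trans (lemma (allFin n))
             (≤-reflexive (trans (cong (6 *_) (length-allFin n)) (trans (sym euler) (+-comm (degSum R) 12)))))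
    where
    rearrange : ∀ vs d m → m + d ≤ 6 → m + length (filter bad? vs) + (d + sum (map (deg R) vs)) ≤ 6 * suc (length vs)
    lemma : ∀ vs → length (filter bad? vs) + sum (map (deg R) vs) ≤ 6 * length vs
    lemma [] = z≤n
    lemma (v ∷ vs) with bad? v
    ... | no ¬bad rewrite Listₚ.filter-reject bad? {xs = vs} ¬bad = rearrange vs (deg R v) 0 (Δ≤6 v)
    ... | yes d≢6 rewrite Listₚ.filter-accept bad? {xs = vs} d≢6 = rearrange vs (deg R v) 1 (≤∧≢⇒< (Δ≤6 v) d≢6)

    rearrange vs d m m+d≤6 = begin
      m + length (filter bad? vs) + (d + sum (map (deg R) vs)) ≡⟨ interchange m _ d _ ⟩
      m + d + (length (filter bad? vs) + sum (map (deg R) vs)) ≤⟨ +-mono-≤ m+d≤6 (lemma vs) ⟩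
      6 + 6 * length vs ≡⟨ *-suc 6 (length vs) ⟨
      6 * suc (length vs) ∎
      where
      open ≤-Reasoning

  nearBad≤ : ∀ k → length (nearBad k) ≤ 12 * 7 ^ k
  nearBad≤ zero = bad≤12
  nearBad≤ (suc k) = begin
    length (nearBad k ++ concatMap neighbours (nearBad k)) ≡⟨ Listₚ.length-++ (nearBad k) ⟩
    length (nearBad k) + length (concatMap neighbours (nearBad k)) ≤⟨ +-monoʳ-≤ _ (length-concatMap neighbours 6 neigh≤ (nearBad k)) ⟩
    length (nearBad k) + length (nearBad k) * 6 ≡⟨ cong (λ m → length (nearBad k) + m) (*-comm (length (nearBad k)) 6) ⟩
    7 * length (nearBad k) ≤⟨ *-monoʳ-≤ 7 (nearBad≤ k) ⟩
    7 * (12 * 7 ^ k) ≡⟨ *-swap 7 12 (7 ^ k) ⟩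
    12 * 7 ^ suc k ∎
    where
    open ≤-Reasoning
    neigh≤ : ∀ v → length (neighbours v) ≤ 6
    neigh≤ v = subst (_≤ 6) (sym (trans (Listₚ.length-map (nbr R v) (allFin (deg R v))) (length-allFin (deg R v)))) (Δ≤6 v)

-- Translations of darts

-- The displacement from a dart `x` to the head of `iter m r x`, in the frame of `x`. Each turn by
-- `r` applies the inverse of `ω`.
unit : Fin 6 → Λ
unit 0F = + 1 , + 0
unit 1F = + 1 , -[1+ 0 ]
unit 2F = + 0 , -[1+ 0 ]
unit 3F = -[1+ 0 ] , + 0
unit 4F = -[1+ 0 ] , + 1
unit 5F = + 0 , + 1

module Translations (G : Triangulation) where
  open Darts G public

  flip : Perm Dart
  flip = record { to = f ; from = f ; to-from = f-f ; from-to = f-f }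

  -- `T₁` moves a dart one edge ahead: the flip points back from the head, and three turns, half of
  -- a full turn at degree 6, make it point forward again. The conjugates move `x` along `r⁻ x` and
  -- `r⁻ (r⁻ x)`.
  T₁ T₂ T₃ : Perm Dart
  T₁ = rot ∘ₚ (rot ∘ₚ (rot ∘ₚ flip))
  T₂ = conj rot T₁
  T₃ = conj rot T₂

  Step : (Dart → Dart) → Set
  Step g = ∀ {k} x → Flat (suc k) x → Flat k (g x)

  flat-iter : ∀ {g} → Step g → ∀ i {k} x → Flat (i + k) x → Flat k (iter i g x)
  flat-iter st zero    x fl = fl
  flat-iter {g} st (suc i) {k} x fl = st (iter i g x) (flat-iter st i x (subst (λ m → Flat m x) (sym (+-suc i k)) fl))

  module _ {a b : Dart → Dart} (step-a : Step a) (step-b : Step b) {c : ℕ}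
           (comm : ∀ x → Flat c x → a (b x) ≡ b (a x)) where

    iter-commʳ : ∀ j x → Flat (j + c) x → a (iter j b x) ≡ iter j b (a x)
    iter-commʳ zero    x fl = refl
    iter-commʳ (suc j) x fl =
      trans (comm (iter j b x) (flat-iter step-b j x (flat-mono x (n≤1+n _) fl)))
            (cong b (iter-commʳ j x (flat-mono x (n≤1+n _) fl)))

    iter-comm : ∀ i j x → Flat (i + j + c) x → iter i a (iter j b x) ≡ iter j b (iter i a x)
    iter-comm zero    j x fl = refl
    iter-comm (suc i) j x fl =
      trans (cong a (iter-comm i j x (flat-mono x (n≤1+n _) fl)))
            (iter-commʳ j (iter i a x) (flat-iter step-a i x
              (subst (λ m → Flat m x) (+-assoc i j c) (flat-mono x (n≤1+n _) fl))))

  step-T₁ : Step (to T₁)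
  step-T₁ x = flat-f x

  step-T₁⁻ : Step (from T₁)
  step-T₁⁻ x = flat-f (r⁻ (r⁻ (r⁻ x)))

  step-T₂ : Step (to T₂)
  step-T₂ x = flat-f (r⁻ x)

  step-T₂⁻ : Step (from T₂)
  step-T₂⁻ x = flat-f (r⁻ (r⁻ (r⁻ (r⁻ x))))

  flat-pow₁ : ∀ i {k} x → Flat (∣ i ∣ + k) x → Flat k (pow T₁ i x)
  flat-pow₁ (+ i)    = flat-iter step-T₁ i
  flat-pow₁ -[1+ i ] = flat-iter step-T₁⁻ (suc i)

  flat-pow₂ : ∀ i {k} x → Flat (∣ i ∣ + k) x → Flat k (pow T₂ i x)
  flat-pow₂ (+ i)    = flat-iter step-T₂ i
  flat-pow₂ -[1+ i ] = flat-iter step-T₂⁻ (suc i)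

  flat-r⁶ : ∀ {k} x → Flat k x → iter 6 r x ≡ x
  flat-r⁶ x fl = r⁶ x (flat-deg x fl)

  iter-r⁻ : ∀ m x → iter m r⁻ (iter m r x) ≡ x
  iter-r⁻ zero    x = refl
  iter-r⁻ (suc m) x = trans (iter-out m r⁻ (r (iter m r x))) (trans (cong (iter m r⁻) (from-to rot _)) (iter-r⁻ m x))

  r⁵≡r⁻ : ∀ {k} x → Flat k x → iter 5 r x ≡ r⁻ x
  r⁵≡r⁻ x fl = trans (sym (from-to rot _)) (cong r⁻ (flat-r⁶ x fl))

  r⁴≡r⁻² : ∀ {k} x → Flat k x → iter 4 r x ≡ iter 2 r⁻ x
  r⁴≡r⁻² x fl = trans (sym (from-to rot _)) (cong r⁻ (r⁵≡r⁻ x fl))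

  r³≡r⁻³ : ∀ {k} x → Flat k x → iter 3 r x ≡ iter 3 r⁻ x
  r³≡r⁻³ x fl = trans (sym (from-to rot _)) (cong r⁻ (r⁴≡r⁻² x fl))

  r²≡r⁻⁴ : ∀ {k} x → Flat k x → iter 2 r x ≡ iter 4 r⁻ x
  r²≡r⁻⁴ x fl = trans (sym (from-to rot _)) (cong r⁻ (r³≡r⁻³ x fl))

  r≡r⁻⁵ : ∀ {k} x → Flat k x → r x ≡ iter 5 r⁻ x
  r≡r⁻⁵ x fl = trans (sym (from-to rot _)) (cong r⁻ (r²≡r⁻⁴ x fl))

  -- The small parallelogram closes up because the vertex that `T₂` reaches has degree 6. Everything
  -- else is the face relation `frf`, which needs no degree.
  comm₊₊ : ∀ x → Flat 1 x → to T₁ (to T₂ x) ≡ to T₂ (to T₁ x)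
  comm₊₊ x fl = begin
    iter 3 r (f (iter 4 r y)) ≡⟨ cong (λ z → iter 3 r (f z)) (r⁴≡r⁻² y (flat-f (r⁻ x) fl)) ⟩
    iter 3 r (f (r⁻ (r⁻ y))) ≡⟨ cong (iter 3 r) (to-from rot _) ⟨
    iter 4 r (r⁻ (f (r⁻ (r⁻ y)))) ≡⟨ cong (iter 4 r) (frf (r⁻ y)) ⟨
    iter 4 r (f (r (f (r⁻ y)))) ≡⟨ cong (λ z → iter 4 r (f (r (f z)))) (frf x) ⟨
    iter 4 r (f (r (f (f (r (f x)))))) ≡⟨ cong (λ z → iter 4 r (f (r z))) (f-f _) ⟩
    iter 4 r (f (r (r (f x)))) ≡⟨ cong (λ z → iter 4 r (f z)) (from-to rot _) ⟨
    to T₂ (to T₁ x) ∎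
    where
    open ≡-Reasoning
    y = f (r⁻ x)

  comm-inv : ∀ (p : Perm Dart) {b : Dart → Dart} → Step (from p) → ∀ {c} →
             (∀ x → Flat c x → to p (b x) ≡ b (to p x)) → ∀ x → Flat (suc c) x → from p (b x) ≡ b (from p x)
  comm-inv p {b} st comm x fl = begin
    from p (b x) ≡⟨ cong (from p ∘ b) (to-from p x) ⟨
    from p (b (to p (from p x))) ≡⟨ cong (from p) (comm (from p x) (st x fl)) ⟨
    from p (to p (b (from p x))) ≡⟨ from-to p _ ⟩
    b (from p x) ∎
    where open ≡-Reasoning

  comm₋₊ : ∀ x → Flat 2 x → from T₁ (to T₂ x) ≡ to T₂ (from T₁ x)
  comm₋₊ = comm-inv T₁ step-T₁⁻ comm₊₊

  comm₊₋ : ∀ x → Flat 2 x → to T₁ (from T₂ x) ≡ from T₂ (to T₁ x)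
  comm₊₋ x fl = sym (comm-inv T₂ step-T₂⁻ (λ y fl → sym (comm₊₊ y fl)) x fl)

  comm₋₋ : ∀ x → Flat 3 x → from T₁ (from T₂ x) ≡ from T₂ (from T₁ x)
  comm₋₋ = comm-inv T₁ step-T₁⁻ comm₊₋

  -- The `3` is the demand of `comm₋₋`: each passage to an inverse in `comm-inv` costs one more
  -- level of flatness.
  pow-comm : ∀ i j x → Flat (∣ i ∣ + ∣ j ∣ + 3) x → pow T₁ i (pow T₂ j x) ≡ pow T₂ j (pow T₁ i x)
  pow-comm (+ i)    (+ j)    x = iter-comm step-T₁ step-T₂ (λ x fl → comm₊₊ x (flat-mono x (s≤s z≤n) fl)) i j x
  pow-comm (+ i)    -[1+ j ] x = iter-comm step-T₁ step-T₂⁻ (λ x fl → comm₊₋ x (flat-mono x (s≤s (s≤s z≤n)) fl)) i (suc j) x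
  pow-comm -[1+ i ] (+ j)    x = iter-comm step-T₁⁻ step-T₂ (λ x fl → comm₋₊ x (flat-mono x (s≤s (s≤s z≤n)) fl)) (suc i) j x
  pow-comm -[1+ i ] -[1+ j ] x = iter-comm step-T₁⁻ step-T₂⁻ comm₋₋ (suc i) (suc j) x

  translation : Λ → Perm Dart
  translation (i , j) = pow-perm T₁ i ∘ₚ pow-perm T₂ j

  T : Λ → Dart → Dart
  T = to ∘ translation

  flat-T : ∀ p {k} x → Flat (∥ p ∥ + k) x → Flat k (T p x)
  flat-T (i , j) {k} x fl = flat-pow₁ i _ (flat-pow₂ j x (subst (λ m → Flat m x) (lemma (∣ i ∣) (∣ j ∣) k) fl))
    where
    lemma : ∀ i j k → i + j + k ≡ j + (i + k)
    lemma = solve-∀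

  T-⊕ : ∀ p q x → Flat (∥ p ∥ + ∥ q ∥ + 3) x → T p (T q x) ≡ T (p ⊕ q) x
  T-⊕ (i , j) (k , l) x fl = begin
    pow T₁ i (pow T₂ j (pow T₁ k (pow T₂ l x))) ≡⟨ cong (pow T₁ i) (pow-comm k j (pow T₂ l x) fl′) ⟨
    pow T₁ i (pow T₁ k (pow T₂ j (pow T₂ l x))) ≡⟨ pow-+ T₁ i k _ ⟨
    pow T₁ (i ℤ.+ k) (pow T₂ j (pow T₂ l x)) ≡⟨ cong (pow T₁ (i ℤ.+ k)) (pow-+ T₂ j l x) ⟨
    pow T₁ (i ℤ.+ k) (pow T₂ (j ℤ.+ l) x) ∎
    where
    open ≡-Reasoning
    lemma : ∀ i j k l → i + j + (k + l) + 3 ≡ i + (l + (k + j + 3))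
    lemma = solve-∀
    fl′ : Flat (∣ k ∣ + ∣ j ∣ + 3) (pow T₂ l x)
    fl′ = flat-pow₂ l x (flat-mono x (m≤n+m _ (∣ i ∣)) (subst (λ m → Flat m x) (lemma (∣ i ∣) (∣ j ∣) (∣ k ∣) (∣ l ∣)) fl))

  -- This is `ω² = ω - 1` on the level of darts, read off one triangle.
  T₃≡ : ∀ x → Flat 1 x → to T₃ x ≡ T (-1ℤ , 1ℤ) x
  T₃≡ x fl = begin
    iter 5 r (f (r⁻ (r⁻ x))) ≡⟨ r⁵≡r⁻ _ (flat-f (r⁻ (r⁻ x)) fl) ⟩
    r⁻ (f (r⁻ (r⁻ x))) ≡⟨ frf (r⁻ x) ⟨
    f (r (f (r⁻ x))) ≡⟨ cong f (iter-r⁻ 3 _) ⟨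
    from T₁ (to T₂ x) ∎
    where open ≡-Reasoning

  T₃⁻≡ : ∀ x → from T₃ x ≡ T (1ℤ , -1ℤ) x
  T₃⁻≡ x = begin
    r (r (f (iter 5 r⁻ x))) ≡⟨ cong (r ∘ r) (to-from rot _) ⟨
    r (r (r (r⁻ (f (iter 5 r⁻ x))))) ≡⟨ cong (iter 3 r) (frf (iter 4 r⁻ x)) ⟨
    to T₁ (from T₂ x) ∎
    where open ≡-Reasoning

  private
    diagonal : ∀ (g : Dart → Dart) (p : Λ) → ∥ p ∥ ≡ 2 → Step g → (∀ x → Flat 1 x → g x ≡ T p x) →
               ∀ m x → Flat (m + m + 3) x → iter m g x ≡ T (+ m · p) x
    diagonal g p ∥p∥ st g≡ zero x fl = refl
    diagonal g p ∥p∥ st g≡ (suc m) x fl = begin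
      g (iter m g x) ≡⟨ g≡ _ (flat-iter st m x (flat-mono x (le₁ m) fl)) ⟩
      T p (iter m g x) ≡⟨ cong (T p) (diagonal g p ∥p∥ st g≡ m x (flat-mono x (le₂ m) fl)) ⟩
      T p (T (+ m · p) x) ≡⟨ T-⊕ p (+ m · p) x (flat-mono x (≤-reflexive eq) fl) ⟩
      T (p ⊕ + m · p) x ≡⟨ cong (λ q → T q x) (cong₂ _,_ (sym (ℤₚ.suc-* (+ m) (proj₁ p))) (sym (ℤₚ.suc-* (+ m) (proj₂ p)))) ⟩
      T (+ suc m · p) x ∎
      where
      open ≡-Reasoning
      le₁ : ∀ m → m + 1 ≤ suc m + suc m + 3
      le₁ m = subst (m + 1 ≤_) (lemma m) (m≤m+n (m + 1) (m + 4))
        where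
        lemma : ∀ m → m + 1 + (m + 4) ≡ suc m + suc m + 3
        lemma = solve-∀
      le₂ : ∀ m → m + m + 3 ≤ suc m + suc m + 3
      le₂ m = +-monoˡ-≤ 3 (+-mono-≤ (n≤1+n m) (n≤1+n m))
      lemma : ∀ m → 2 + m * 2 + 3 ≡ suc m + suc m + 3
      lemma = solve-∀
      eq : ∥ p ∥ + ∥ + m · p ∥ + 3 ≡ suc m + suc m + 3
      eq = trans (cong (_+ 3) (trans (cong (λ k → ∥ p ∥ + k) (∥·∥ (+ m) p)) (cong (λ k → k + m * k) ∥p∥))) (lemma m)

  T₃-pow : ∀ j x → Flat (∣ j ∣ + ∣ j ∣ + 3) x → pow T₃ j x ≡ T (ℤ.- j , j) x
  T₃-pow (+ m) x fl = trans (diagonal (to T₃) (-1ℤ , 1ℤ) refl (λ x → flat-f (r⁻ (r⁻ x))) T₃≡ m x fl)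
    (cong (λ q → T q x) (cong₂ _,_ (trans (ℤₚ.*-comm (+ m) -1ℤ) (ℤₚ.-1*i≡-i (+ m))) (ℤₚ.*-identityʳ (+ m))))
  T₃-pow -[1+ m ] x fl = trans (diagonal (from T₃) (1ℤ , -1ℤ) refl (λ x → flat-f (iter 5 r⁻ x)) (λ x _ → T₃⁻≡ x) (suc m) x fl)
    (cong (λ q → T q x) (cong₂ _,_ (ℤₚ.*-identityʳ (+ suc m)) (trans (ℤₚ.*-comm (+ suc m) -1ℤ) (ℤₚ.-1*i≡-i (+ suc m)))))

  -- The displacement stays while the frame turns, so its coordinates turn the opposite way.
  -- Conjugation by `r` takes `T₁` and `T₂` to `T₂` and `T₃`, and `T₃-pow` expresses the latter by
  -- the two generators.
  r-T : ∀ p x → Flat (∥ p ∥ + ∥ p ∥ + 3) x → r (T p x) ≡ T (ω p) (r x)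
  r-T (i , j) x fl = begin
    r (pow T₁ i (pow T₂ j x)) ≡⟨ pow-conj rot T₁ i _ ⟩
    pow T₂ i (r (pow T₂ j x)) ≡⟨ cong (pow T₂ i) (pow-conj rot T₂ j x) ⟩
    pow T₂ i (pow T₃ j (r x)) ≡⟨ cong (pow T₂ i) (T₃-pow j (r x) (flat-mono x le₁ fl)) ⟩
    T (0ℤ , i) (T (ℤ.- j , j) (r x)) ≡⟨ T-⊕ (0ℤ , i) (ℤ.- j , j) (r x) (flat-mono x le₂ fl) ⟩
    T (0ℤ ℤ.+ ℤ.- j , i ℤ.+ j) (r x) ≡⟨ cong (λ k → T (k , i ℤ.+ j) (r x)) (ℤₚ.+-identityˡ (ℤ.- j)) ⟩
    T (ω (i , j)) (r x) ∎
    where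
    open ≡-Reasoning
    I = ∣ i ∣
    J = ∣ j ∣
    le₁ : J + J + 3 ≤ I + J + (I + J) + 3
    le₁ = +-monoˡ-≤ 3 (+-mono-≤ (m≤n+m J I) (m≤n+m J I))
    le₂ : I + (∣ ℤ.- j ∣ + J) + 3 ≤ I + J + (I + J) + 3
    le₂ = +-monoˡ-≤ 3 (≤-trans (≤-reflexive (trans (cong (λ k → I + (k + J)) (ℤₚ.∣-i∣≡∣i∣ j)) (sym (+-assoc I J J))))
             (+-monoʳ-≤ (I + J) (m≤n+m J I)))

  vert-unit : ∀ m {k} x → Flat k x → vert (T (unit m) x) ≡ vert (f (iter (toℕ m) r x))
  vert-unit 0F x fl = refl
  vert-unit 1F x fl = trans (sym (cong vert (T₃⁻≡ x))) (cong (vert ∘ f) (sym (r≡r⁻⁵ x fl)))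
  vert-unit 2F x fl = cong (vert ∘ f) (sym (r²≡r⁻⁴ x fl))
  vert-unit 3F x fl = cong (vert ∘ f) (sym (r³≡r⁻³ x fl))
  vert-unit 4F x fl = trans (cong (vert ∘ f) (iter-r⁻ 3 _)) (trans (cong vert (frf (r⁻ x))) (cong (vert ∘ f) (sym (r⁴≡r⁻² x fl))))
  vert-unit 5F x fl = cong (vert ∘ f) (sym (r⁵≡r⁻ x fl))

  adj→unit : ∀ {k} x → Flat k x → ∀ {v} → Adj R (vert x) v → ∃ λ m → v ≡ vert (T (unit m) x)
  adj→unit x fl (s , refl) with r-orbit x (vert x , s) refl (flat-deg x fl)
  ... | m , eq = m , sym (trans (vert-unit m x fl) (cong nb eq))

  unit→adj : ∀ m {k} x → Flat k x → Adj R (vert (T (unit m) x)) (vert x)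
  unit→adj m x fl = symmetric _ _ (subst (λ u → Adj R u (vert (T (unit m) x))) (vert-iter-r (toℕ m) x)
    (proj₂ (iter (toℕ m) r x) , sym (vert-unit m x fl)))

  unit-injective : ∀ {m m′} {k} x → Flat k x → vert (T (unit m) x) ≡ vert (T (unit m′) x) → iter (toℕ m) r x ≡ iter (toℕ m′) r x
  unit-injective {m} {m′} x fl eq = no-multi _ _ (trans (vert-iter-r (toℕ m) x) (sym (vert-iter-r (toℕ m′) x)))
    (trans (sym (vert-unit m x fl)) (trans eq (vert-unit m′ x fl)))

  unit-no-loop : ∀ m {k} x → Flat k x → vert (T (unit m) x) ≢ vert x
  unit-no-loop m x fl eq = no-loop (iter (toℕ m) r x) (trans (sym (vert-unit m x fl)) (trans eq (sym (vert-iter-r (toℕ m) x))))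

-- Rotations and tori

-- a norm that, unlike ∥_∥, is invariant under ω
size : Λ → ℕ
size p@(i , j) = ∥ p ∥ + ∣ i ℤ.+ j ∣

∥∥≤size : ∀ p → ∥ p ∥ ≤ size p
∥∥≤size p = m≤m+n ∥ p ∥ _

size-ω : ∀ p → size (ω p) ≡ size p
size-ω (i , j) = begin
  ∣ ℤ.- j ∣ + ∣ i ℤ.+ j ∣ + ∣ ℤ.- j ℤ.+ (i ℤ.+ j) ∣ ≡⟨ cong₂ (λ a b → a + ∣ i ℤ.+ j ∣ + ∣ b ∣) (ℤₚ.∣-i∣≡∣i∣ j) (lemma i j) ⟩
  ∣ j ∣ + ∣ i ℤ.+ j ∣ + ∣ i ∣ ≡⟨ lemma′ (∣ j ∣) (∣ i ℤ.+ j ∣) (∣ i ∣) ⟩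
  ∣ i ∣ + ∣ j ∣ + ∣ i ℤ.+ j ∣ ∎
  where
  open ≡-Reasoning
  lemma : ∀ i j → ℤ.- j ℤ.+ (i ℤ.+ j) ≡ i
  lemma = ℤ-solve-∀
  lemma′ : ∀ a b c → a + b + c ≡ c + a + b
  lemma′ = solve-∀

size-ωᵐ : ∀ m p → size (iter m ω p) ≡ size p
size-ωᵐ zero    p = refl
size-ωᵐ (suc m) p = trans (size-ω (iter m ω p)) (size-ωᵐ m p)

size-⊕ : ∀ p q → size (p ⊕ q) ≤ size p + size q
size-⊕ p@(i , j) q@(k , l) = begin
  ∥ p ⊕ q ∥ + ∣ i ℤ.+ k ℤ.+ (j ℤ.+ l) ∣ ≡⟨ cong (λ a → ∥ p ⊕ q ∥ + ∣ a ∣) (lemma i j k l) ⟩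
  ∥ p ⊕ q ∥ + ∣ i ℤ.+ j ℤ.+ (k ℤ.+ l) ∣ ≤⟨ +-mono-≤ (∥⊕∥ p q) (ℤₚ.∣i+j∣≤∣i∣+∣j∣ (i ℤ.+ j) (k ℤ.+ l)) ⟩
  ∥ p ∥ + ∥ q ∥ + (∣ i ℤ.+ j ∣ + ∣ k ℤ.+ l ∣) ≡⟨ lemma′ (∥ p ∥) (∥ q ∥) (∣ i ℤ.+ j ∣) (∣ k ℤ.+ l ∣) ⟩
  size p + size q ∎
  where
  open ≤-Reasoning
  lemma : ∀ i j k l → i ℤ.+ k ℤ.+ (j ℤ.+ l) ≡ i ℤ.+ j ℤ.+ (k ℤ.+ l)
  lemma = ℤ-solve-∀
  lemma′ : ∀ a b c d → a + b + (c + d) ≡ a + c + (b + d)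
  lemma′ = solve-∀

size-⊝ : ∀ p → size (⊝ p) ≡ size p
size-⊝ p@(i , j) = cong₂ _+_ (∥⊝∥ p) (trans (cong ∣_∣ (sym (ℤₚ.neg-distrib-+ i j))) (ℤₚ.∣-i∣≡∣i∣ (i ℤ.+ j)))

size-· : ∀ c p → size (c · p) ≡ ∣ c ∣ * size p
size-· c p@(i , j) = trans (cong₂ _+_ (∥·∥ c p) (trans (cong ∣_∣ (sym (ℤₚ.*-distribˡ-+ c i j))) (ℤₚ.abs-* c (i ℤ.+ j))))
  (sym (*-distribˡ-+ (∣ c ∣) ∥ p ∥ _))

size≤2∥∥ : ∀ p → size p ≤ ∥ p ∥ + ∥ p ∥
size≤2∥∥ p@(i , j) = +-monoʳ-≤ ∥ p ∥ (ℤₚ.∣i+j∣≤∣i∣+∣j∣ i j)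

size-unit : ∀ m → size (unit m) ≡ 2
size-unit 0F = refl
size-unit 1F = refl
size-unit 2F = refl
size-unit 3F = refl
size-unit 4F = refl
size-unit 5F = refl

module Closed (G : Triangulation) where
  open Darts G

  ¬all-6 : ¬ (∀ v → deg R v ≡ 6)
  ¬all-6 d≡6 = m+1+n≢m (6 * n) (trans (cong (_+ 12) (sym degSum≡)) euler)
    where
    lemma : ∀ vs → sum (map (deg R) vs) ≡ 6 * length vs
    lemma []       = refl
    lemma (v ∷ vs) = trans (cong₂ _+_ (d≡6 v) (lemma vs)) (sym (*-suc 6 (length vs)))
    degSum≡ : degSum R ≡ 6 * n
    degSum≡ = trans (lemma (allFin n)) (cong (6 *_) (length-allFin n))

  -- By connectedness `Z` contains every vertex, and then the degree sum is `6 n`, which leaves no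
  -- room for the `12` in Euler's formula.
  closed-6-absurd : (Z : V → Set) → (∀ v → Z v → deg R v ≡ 6) → (∀ {u v} → Adj R u v → Z u → Z v) → ∀ v → Z v → ⊥
  closed-6-absurd Z Z⇒6 closed v Zv = ¬all-6 λ u → Z⇒6 u (walk (connected v u) Zv)
    where
    walk : ∀ {u w} → Reach R u w → Z u → Z w
    walk here        Zu = Zu
    walk (step a ps) Zu = walk ps (closed a Zu)

-- Division by 3 with remainder -1, 0 or 1, so that the remainder can serve as a first coordinate of
-- a unit in `centre₂`.
third : ℤ → ℤ × ℤ
third i with i DM.%ℕ 3
... | 0 = i DM./ℕ 3 , 0ℤ
... | 1 = i DM./ℕ 3 , 1ℤ
... | _ = ℤ.suc (i DM./ℕ 3) , -1ℤ

third-eq : ∀ i → i ≡ + 3 ℤ.* proj₁ (third i) ℤ.+ proj₂ (third i)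
third-eq i with i DM.%ℕ 3 | DM.a≡a%ℕn+[a/ℕn]*n i 3 | DM.n%ℕd<d i 3
... | 0 | eq | _ = trans eq (lemma (i DM./ℕ 3))
  where
  lemma : ∀ q → 0ℤ ℤ.+ q ℤ.* + 3 ≡ + 3 ℤ.* q ℤ.+ 0ℤ
  lemma = ℤ-solve-∀
... | 1 | eq | _ = trans eq (lemma (i DM./ℕ 3))
  where
  lemma : ∀ q → 1ℤ ℤ.+ q ℤ.* + 3 ≡ + 3 ℤ.* q ℤ.+ 1ℤ
  lemma = ℤ-solve-∀
... | 2 | eq | _ = trans eq (lemma (i DM./ℕ 3))
  where
  lemma : ∀ q → + 2 ℤ.+ q ℤ.* + 3 ≡ + 3 ℤ.* (1ℤ ℤ.+ q) ℤ.+ -1ℤ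
  lemma = ℤ-solve-∀
... | suc (suc (suc _)) | _ | s≤s (s≤s (s≤s ()))

third-small : ∀ i → proj₂ (third i) ≡ 0ℤ ⊎ proj₂ (third i) ≡ 1ℤ ⊎ proj₂ (third i) ≡ -1ℤ
third-small i with i DM.%ℕ 3
... | 0 = inj₁ refl
... | 1 = inj₂ (inj₁ refl)
... | suc (suc _) = inj₂ (inj₂ refl)

Small : Λ → Set
Small u = u ≡ 𝟘 ⊎ ∃ λ m → u ≡ unit m

-- If T t y ≡ rᵐ y, the surface has a cone point at the fixed point of x ↦ ωᵐ x + t. This is a vertex, the midpoint
-- of an edge or the centre of a face; in the last two cases the rotation takes the vertex centre to a neighbour.
record Centre (m : ℕ) (t : Λ) : Set where
  field
    centre offset : Λ
    small : Small offset
    fixed : iter m ω centre ⊕ t ≡ offset ⊕ centre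

open Centre

-- `1 - ω` is invertible, with inverse `ω`, so the fixed point is always a lattice point: a vertex.
centre₁ : ∀ t → Centre 1 t
centre₁ t@(i , j) = record { centre = ω t ; offset = 𝟘 ; small = inj₁ refl ; fixed = cong₂ _,_ (e₁ i j) (e₂ i j) }
  where
  e₁ : ∀ i j → ℤ.- (i ℤ.+ j) ℤ.+ i ≡ 0ℤ ℤ.+ ℤ.- j
  e₁ = ℤ-solve-∀
  e₂ : ∀ i j → ℤ.- j ℤ.+ (i ℤ.+ j) ℤ.+ j ≡ 0ℤ ℤ.+ (i ℤ.+ j)
  e₂ = ℤ-solve-∀

-- `1 - ω²` has norm 3. The second coordinate of the centre is chosen to solve the second equation
-- exactly; the first equation then reads `i - j = 3 a + ε`.
centre₂ : ∀ t → Centre 2 t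
centre₂ (i , j) = record
  { centre = a , j ℤ.+ a ; offset = ε , 0ℤ ; small = sm (third-small (i ℤ.- j))
  ; fixed = cong₂ _,_ (trans (cong (λ k → ℤ.- (a ℤ.+ (j ℤ.+ a)) ℤ.+ k) i≡) (e₁ j a ε)) (e₂ j a) }
  where
  a = proj₁ (third (i ℤ.- j))
  ε = proj₂ (third (i ℤ.- j))
  sm : ε ≡ 0ℤ ⊎ ε ≡ 1ℤ ⊎ ε ≡ -1ℤ → Small (ε , 0ℤ)
  sm (inj₁ eq)        = inj₁ (cong (_, 0ℤ) eq)
  sm (inj₂ (inj₁ eq)) = inj₂ (0F , cong (_, 0ℤ) eq)
  sm (inj₂ (inj₂ eq)) = inj₂ (3F , cong (_, 0ℤ) eq)
  e₀ : ∀ i j → i ≡ (i ℤ.- j) ℤ.+ j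
  e₀ = ℤ-solve-∀
  i≡ : i ≡ + 3 ℤ.* a ℤ.+ ε ℤ.+ j
  i≡ = trans (e₀ i j) (cong (ℤ._+ j) (third-eq (i ℤ.- j)))
  e₁ : ∀ j a ε → ℤ.- (a ℤ.+ (j ℤ.+ a)) ℤ.+ (+ 3 ℤ.* a ℤ.+ ε ℤ.+ j) ≡ ε ℤ.+ a
  e₁ = ℤ-solve-∀
  e₂ : ∀ j a → ℤ.- (j ℤ.+ a) ℤ.+ (a ℤ.+ (j ℤ.+ a)) ℤ.+ j ≡ 0ℤ ℤ.+ (j ℤ.+ a)
  e₂ = ℤ-solve-∀

half : ∀ i → ∃ λ a → i ≡ + 2 ℤ.* a ⊎ i ≡ + 2 ℤ.* a ℤ.+ 1ℤ
half i with i DM.%ℕ 2 | DM.a≡a%ℕn+[a/ℕn]*n i 2 | DM.n%ℕd<d i 2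
... | 0 | eq | _ = i DM./ℕ 2 , inj₁ (trans eq (lemma (i DM./ℕ 2)))
  where
  lemma : ∀ q → 0ℤ ℤ.+ q ℤ.* + 2 ≡ + 2 ℤ.* q
  lemma = ℤ-solve-∀
... | 1 | eq | _ = i DM./ℕ 2 , inj₂ (trans eq (lemma (i DM./ℕ 2)))
  where
  lemma : ∀ q → 1ℤ ℤ.+ q ℤ.* + 2 ≡ + 2 ℤ.* q ℤ.+ 1ℤ
  lemma = ℤ-solve-∀
... | suc (suc _) | _ | s≤s (s≤s ())

-- `ω³` is the point reflection, so the centre is half of `t`, rounded; the parities of the
-- coordinates select the offset.
centre₃ : ∀ t → Centre 3 t
centre₃ (i , j) with half i | half j
... | a , i≡ | b , j≡ = solve i≡ j≡
  where
  even : ∀ a → ℤ.- a ℤ.+ + 2 ℤ.* a ≡ 0ℤ ℤ.+ a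
  even = ℤ-solve-∀
  odd : ∀ a → ℤ.- a ℤ.+ (+ 2 ℤ.* a ℤ.+ 1ℤ) ≡ 1ℤ ℤ.+ a
  odd = ℤ-solve-∀
  odd′ : ∀ a → ℤ.- (1ℤ ℤ.+ a) ℤ.+ (+ 2 ℤ.* a ℤ.+ 1ℤ) ≡ -1ℤ ℤ.+ (1ℤ ℤ.+ a)
  odd′ = ℤ-solve-∀
  solution : ∀ c u → Small u → ⊝ c ⊕ (i , j) ≡ u ⊕ c → Centre 3 (i , j)
  solution c u sm eq = record { centre = c ; offset = u ; small = sm ; fixed = trans (cong (_⊕ (i , j)) (ω³ c)) eq }
  solve : i ≡ + 2 ℤ.* a ⊎ i ≡ + 2 ℤ.* a ℤ.+ 1ℤ → j ≡ + 2 ℤ.* b ⊎ j ≡ + 2 ℤ.* b ℤ.+ 1ℤ → Centre 3 (i , j)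
  solve (inj₁ refl) (inj₁ refl) = solution (a , b) 𝟘 (inj₁ refl) (cong₂ _,_ (even a) (even b))
  solve (inj₁ refl) (inj₂ refl) = solution (a , b) (unit 5F) (inj₂ (5F , refl)) (cong₂ _,_ (even a) (odd b))
  solve (inj₂ refl) (inj₁ refl) = solution (a , b) (unit 0F) (inj₂ (0F , refl)) (cong₂ _,_ (odd a) (even b))
  -- One coordinate is rounded up and the other down: the offset `(1 , 1)` would not be a unit,
  -- while `(-1 , 1)` is.
  solve (inj₂ refl) (inj₂ refl) = solution (1ℤ ℤ.+ a , b) (unit 4F) (inj₂ (4F , refl)) (cong₂ _,_ (odd′ a) (odd b))

-- Centres are needed for one, two and three turns only. Five and four turns are the inverses of one
-- and two, with `⊝ t` in place of `t`.
rotationReach : Λ → ℕ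
rotationReach t = size t + (size (centre (centre₁ t)) + (size (centre (centre₂ t)) + (size (centre (centre₃ t)) +
                  (size (centre (centre₁ (⊝ t))) + (size (centre (centre₂ (⊝ t))) + 2)))))

-- Room for the multiples in Cramer's rule and for walking about a square box of side `∣ det s t ∣`.
torusReach : Λ → Λ → ℕ
torusReach s@(s₁ , s₂) t@(t₁ , t₂) =
  12 * ∣ det s t ∣ + 12 + ((size (t₂ · s) + size (ℤ.- s₂ · t)) + (size (ℤ.- t₁ · s) + size (s₁ · t)))

module Local (G : Triangulation) (ρ : ℕ) where
  open Translations G
  open Closed G

  -- F m leaves room for m successive translations of size at most ρ (T-add and r-T′ use up two).
  F : ℕ → Dart → Set
  F m x = Flat (m * ρ + 3) x

  F-pred : ∀ {m} x → F (suc m) x → F m x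
  F-pred {m} x = flat-mono x (+-monoˡ-≤ 3 (m≤n+m (m * ρ) ρ))

  F-mono : ∀ {m m′} x → m ≤ m′ → F m′ x → F m x
  F-mono x m≤m′ = flat-mono x (+-monoˡ-≤ 3 (*-monoˡ-≤ ρ m≤m′))

  F-T : ∀ {m p} x → size p ≤ ρ → F (suc m) x → F m (T p x)
  F-T {m} {p} x p≤ρ fl = flat-T p x (flat-mono x
    (≤-trans (+-monoˡ-≤ _ (≤-trans (∥∥≤size p) p≤ρ)) (≤-reflexive (sym (+-assoc ρ (m * ρ) 3)))) fl)

  private
    2ρ : ∀ {a b} → a ≤ ρ → b ≤ ρ → a + b + 3 ≤ 2 * ρ + 3
    2ρ a≤ρ b≤ρ = +-monoˡ-≤ 3 (≤-trans (+-mono-≤ a≤ρ b≤ρ) (≤-reflexive (cong (λ k → ρ + k) (sym (+-identityʳ ρ)))))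

  T-add : ∀ p q x → size p ≤ ρ → size q ≤ ρ → F 2 x → T p (T q x) ≡ T (p ⊕ q) x
  T-add p q x p≤ρ q≤ρ fl = T-⊕ p q x (flat-mono x (2ρ (≤-trans (∥∥≤size p) p≤ρ) (≤-trans (∥∥≤size q) q≤ρ)) fl)

  T-comm : ∀ p q x → size p ≤ ρ → size q ≤ ρ → F 2 x → T p (T q x) ≡ T q (T p x)
  T-comm p q x p≤ρ q≤ρ fl = trans (T-add p q x p≤ρ q≤ρ fl) (trans (cong (λ s → T s x) (⊕-comm p q)) (sym (T-add q p x q≤ρ p≤ρ fl)))

  r-T′ : ∀ p x → size p ≤ ρ → F 2 x → r (T p x) ≡ T (ω p) (r x)
  r-T′ p x p≤ρ fl = r-T p x (flat-mono x (2ρ (≤-trans (∥∥≤size p) p≤ρ) (≤-trans (∥∥≤size p) p≤ρ)) fl)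

  F-rᵐ : ∀ m {k} x → F k x → F k (iter m r x)
  F-rᵐ m {k} x = subst (Away (k * ρ + 3)) (sym (vert-iter-r m x))

  rᵐ-T : ∀ m p x → size p ≤ ρ → F 2 x → iter m r (T p x) ≡ T (iter m ω p) (iter m r x)
  rᵐ-T zero    p x p≤ρ fl = refl
  rᵐ-T (suc m) p x p≤ρ fl = trans (cong r (rᵐ-T m p x p≤ρ fl))
    (r-T′ (iter m ω p) (iter m r x) (subst (_≤ ρ) (sym (size-ωᵐ m p)) p≤ρ) (F-rᵐ m {2} x fl))

  T-inverse : ∀ p x → size p ≤ ρ → F 2 x → T (⊝ p) (T p x) ≡ x
  T-inverse p x p≤ρ fl = trans (T-add (⊝ p) p x (subst (_≤ ρ) (sym (size-⊝ p)) p≤ρ) p≤ρ fl) (cong (λ s → T s x) (⊕-inverseˡ p))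

  -- A nontrivial turn moves the dart but keeps its vertex, while a unit step changes the vertex
  -- because there are no loops.
  small-free : ∀ (m : Fin 6) → m ≢ zero → ∀ {u} → Small u → ∀ {k} x → Flat k x → iter (toℕ m) r x ≢ T u x
  small-free m m≢0 (inj₁ refl)       x fl eq = r-free m m≢0 x (flat-deg x fl) eq
  small-free m m≢0 (inj₂ (k , refl)) x fl eq = unit-no-loop k x fl (trans (sym (cong vert eq)) (vert-iter-r (toℕ m) x))

  -- The relation is transported from `x` to the centre. There the translation that imitates the
  -- turn has shrunk to the offset, which `small-free` excludes.
  centre-free : ∀ (m : Fin 6) → m ≢ zero → ∀ {t} (c : Centre (toℕ m) t) → size (centre c) ≤ ρ → size t ≤ ρ → 2 ≤ ρ →
                ∀ x → F 3 x → T t x ≢ iter (toℕ m) r x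
  centre-free m m≢0 {t} c c≤ρ t≤ρ 2≤ρ x fl eq = small-free m m≢0 (small c) (T s x) (F-T {2} {s} x c≤ρ fl) (begin
    iter k r (T s x) ≡⟨ rᵐ-T k s x c≤ρ (F-pred {2} x fl) ⟩
    T (iter k ω s) (iter k r x) ≡⟨ cong (T (iter k ω s)) eq ⟨
    T (iter k ω s) (T t x) ≡⟨ T-add (iter k ω s) t x (subst (_≤ ρ) (sym (size-ωᵐ k s)) c≤ρ) t≤ρ (F-pred {2} x fl) ⟩
    T (iter k ω s ⊕ t) x ≡⟨ cong (λ q → T q x) (fixed c) ⟩
    T (offset c ⊕ s) x ≡⟨ T-add (offset c) s x (offset≤ρ (small c)) c≤ρ (F-pred {2} x fl) ⟨
    T (offset c) (T s x) ∎)
    where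
    open ≡-Reasoning
    s = centre c
    k = toℕ m
    offset≤ρ : ∀ {u} → Small u → size u ≤ ρ
    offset≤ρ (inj₁ refl)       = z≤n
    offset≤ρ (inj₂ (k , refl)) = subst (_≤ ρ) (sym (size-unit k)) 2≤ρ

  rotation-free : ∀ (m : Fin 6) → m ≢ zero → ∀ t → rotationReach t ≤ ρ → ∀ x → F 4 x → T t x ≢ iter (toℕ m) r x
  rotation-free m m≢0 t reach≤ρ x fl = free m m≢0
    where
    b₀ = m+n≤o⇒m≤o (size t) reach≤ρ
    t₁ = m+n≤o⇒n≤o (size t) reach≤ρ
    b₁ = m+n≤o⇒m≤o (size (centre (centre₁ t))) t₁
    t₂ = m+n≤o⇒n≤o (size (centre (centre₁ t))) t₁
    b₂ = m+n≤o⇒m≤o (size (centre (centre₂ t))) t₂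
    t₃ = m+n≤o⇒n≤o (size (centre (centre₂ t))) t₂
    b₃ = m+n≤o⇒m≤o (size (centre (centre₃ t))) t₃
    t₄ = m+n≤o⇒n≤o (size (centre (centre₃ t))) t₃
    b₄ = m+n≤o⇒m≤o (size (centre (centre₁ (⊝ t)))) t₄
    t₅ = m+n≤o⇒n≤o (size (centre (centre₁ (⊝ t)))) t₄
    b₅ = m+n≤o⇒m≤o (size (centre (centre₂ (⊝ t)))) t₅
    2≤ρ = m+n≤o⇒n≤o (size (centre (centre₂ (⊝ t)))) t₅
    b₀⁻ = subst (_≤ ρ) (sym (size-⊝ t)) b₀
    fl′ = F-T {3} {t} x b₀ fl
    back : T (⊝ t) (T t x) ≡ iter 6 r x
    back = trans (T-inverse t x b₀ (F-pred {2} x (F-pred {3} x fl))) (sym (flat-r⁶ x fl))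
    free : ∀ (m : Fin 6) → m ≢ zero → T t x ≢ iter (toℕ m) r x
    free 0F m≢0 eq = m≢0 refl
    free 1F m≢0 eq = centre-free 1F m≢0 (centre₁ t) b₁ b₀ 2≤ρ x (F-pred {3} x fl) eq
    free 2F m≢0 eq = centre-free 2F m≢0 (centre₂ t) b₂ b₀ 2≤ρ x (F-pred {3} x fl) eq
    free 3F m≢0 eq = centre-free 3F m≢0 (centre₃ t) b₃ b₀ 2≤ρ x (F-pred {3} x fl) eq
    free 4F m≢0 eq = centre-free 2F (λ ()) (centre₂ (⊝ t)) b₅ b₀⁻ 2≤ρ (T t x) fl′ (trans back (cong (iter 2 r) (sym eq)))
    free 5F m≢0 eq = centre-free 1F (λ ()) (centre₁ (⊝ t)) b₄ b₀⁻ 2≤ρ (T t x) fl′ (trans back (cong r (sym eq)))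

  module _ (x : Dart) (fl : F 2 x) where

    -- Within the reach of `ρ`, the vectors that fix `x` are closed under the operations of a
    -- subgroup of `Λ`.
    stab-⊕ : ∀ p q → size p ≤ ρ → size q ≤ ρ → T p x ≡ x → T q x ≡ x → T (p ⊕ q) x ≡ x
    stab-⊕ p q p≤ρ q≤ρ Tp Tq = trans (sym (T-add p q x p≤ρ q≤ρ fl)) (trans (cong (T p) Tq) Tp)

    stab-⊝ : ∀ p → size p ≤ ρ → T p x ≡ x → T (⊝ p) x ≡ x
    stab-⊝ p p≤ρ Tp = trans (cong (T (⊝ p)) (sym Tp)) (T-inverse p x p≤ρ fl)

    private
      stab-ℕ· : ∀ m p → size (+ m · p) ≤ ρ → T p x ≡ x → T (+ m · p) x ≡ x
      stab-ℕ· zero    p m≤ρ Tp = refl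
      stab-ℕ· (suc m) p m≤ρ Tp = subst (λ q → T q x ≡ x)
        (sym (cong₂ _,_ (ℤₚ.suc-* (+ m) (proj₁ p)) (ℤₚ.suc-* (+ m) (proj₂ p))))
        (stab-⊕ p (+ m · p) (m+n≤o⇒m≤o (size p) split) mp≤ρ Tp (stab-ℕ· m p mp≤ρ Tp))
        where
        split : size p + m * size p ≤ ρ
        split = subst (_≤ ρ) (size-· (+ suc m) p) m≤ρ
        mp≤ρ : size (+ m · p) ≤ ρ
        mp≤ρ = subst (_≤ ρ) (sym (size-· (+ m) p)) (m+n≤o⇒n≤o (size p) split)

    stab-· : ∀ c p → size (c · p) ≤ ρ → T p x ≡ x → T (c · p) x ≡ x
    stab-· (+ m)    p c≤ρ Tp = stab-ℕ· m p c≤ρ Tp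
    stab-· -[1+ m ] p c≤ρ Tp = subst (λ q → T q x ≡ x) (sym neg) (stab-⊝ (+ suc m · p) m≤ρ (stab-ℕ· (suc m) p m≤ρ Tp))
      where
      neg : -[1+ m ] · p ≡ ⊝ (+ suc m · p)
      neg = cong₂ _,_ (sym (ℤₚ.neg-distribˡ-* (+ suc m) (proj₁ p))) (sym (ℤₚ.neg-distribˡ-* (+ suc m) (proj₂ p)))
      m≤ρ : size (+ suc m · p) ≤ ρ
      m≤ρ = subst (_≤ ρ) (trans (cong size neg) (size-⊝ (+ suc m · p))) c≤ρ

  module _ (N : ℕ) .{{_ : NonZero N}} (12N≤ρ : 12 * N + 12 ≤ ρ) (x : Dart) (fl : F 4 x)
           (stab₁ : T (+ N , 0ℤ) x ≡ x) (stab₂ : T (0ℤ , + N) x ≡ x) where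
    private
      -- The image of a fundamental domain of the torus. A step out of the box is brought back by
      -- the two periods, see `reduce`, so the image is closed under adjacency.
      Z : V → Set
      Z v = ∃₂ λ a b → a < N × b < N × v ≡ vert (T (+ a , + b) x)

      bound : ∀ m → m ≤ 12 → m * N + m ≤ ρ
      bound m m≤12 = ≤-trans (+-mono-≤ (*-monoˡ-≤ N m≤12) m≤12) 12N≤ρ

      box≤ρ : ∀ a b → a < N → b < N → size (+ a , + b) ≤ ρ
      box≤ρ a b a<N b<N = ≤-trans (size≤2∥∥ (+ a , + b)) (≤-trans
        (+-mono-≤ (+-mono-≤ (<⇒≤ a<N) (<⇒≤ b<N)) (+-mono-≤ (<⇒≤ a<N) (<⇒≤ b<N)))
        (≤-trans (≤-reflexive (lemma N)) (≤-trans (m≤m+n (4 * N) 4) (bound 4 (s≤s (s≤s (s≤s (s≤s z≤n))))))))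
        where
        lemma : ∀ N → N + N + (N + N) ≡ 4 * N
        lemma = solve-∀

      2≤ρ : 2 ≤ ρ
      2≤ρ = ≤-trans (m≤n+m 2 (2 * N)) (bound 2 (s≤s (s≤s z≤n)))

      quotient≤ : ∀ i → ∣ i ∣ ≤ suc N → ∣ (i DM./ℕ N) ℤ.* + N ∣ ≤ 2 * N + 2
      quotient≤ i i≤ = begin
        ∣ (i DM./ℕ N) ℤ.* + N ∣ ≡⟨ cong ∣_∣ (trans (lemma (+ (i DM.%ℕ N)) ((i DM./ℕ N) ℤ.* + N)) (cong (ℤ._- + (i DM.%ℕ N)) (sym (DM.a≡a%ℕn+[a/ℕn]*n i N)))) ⟩
        ∣ i ℤ.- + (i DM.%ℕ N) ∣ ≤⟨ ℤₚ.∣i-j∣≤∣i∣+∣j∣ i _ ⟩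
        ∣ i ∣ + i DM.%ℕ N ≤⟨ +-mono-≤ i≤ (<⇒≤ (DM.n%ℕd<d i N)) ⟩
        suc N + N ≤⟨ ≤-trans (n≤1+n _) (≤-reflexive (lemma′ N)) ⟩
        2 * N + 2 ∎
        where
        open ≤-Reasoning
        lemma : ∀ a b → b ≡ (a ℤ.+ b) ℤ.- a
        lemma = ℤ-solve-∀
        lemma′ : ∀ N → suc (suc N + N) ≡ 2 * N + 2
        lemma′ = solve-∀

      axis≤ρ : ∀ {i} → ∣ i ∣ ≤ 2 * N + 2 → size (i , 0ℤ) ≤ ρ × size (0ℤ , i) ≤ ρ
      axis≤ρ {i} i≤ = ≤-trans (size≤2∥∥ (i , 0ℤ)) (≤-trans (≤-reflexive (cong₂ _+_ (+-identityʳ (∣ i ∣)) (+-identityʳ (∣ i ∣)))) le) ,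
                      ≤-trans (size≤2∥∥ (0ℤ , i)) le
        where
        lemma : ∀ N → (2 * N + 2) + (2 * N + 2) ≡ 4 * N + 4
        lemma = solve-∀
        le : ∣ i ∣ + ∣ i ∣ ≤ ρ
        le = ≤-trans (+-mono-≤ i≤ i≤) (≤-trans (≤-reflexive (lemma N)) (bound 4 (s≤s (s≤s (s≤s (s≤s z≤n))))))

      reduce : ∀ i j → ∣ i ∣ ≤ suc N → ∣ j ∣ ≤ suc N → T (i , j) x ≡ T (+ (i DM.%ℕ N) , + (j DM.%ℕ N)) x
      reduce i j i≤ j≤ = begin
        T (i , j) x ≡⟨ cong (λ q → T q x) (cong₂ _,_ (eq₁ i) (eq₂ j)) ⟩
        T ((a , b) ⊕ (p₁ ⊕ p₂)) x ≡⟨ T-add (a , b) (p₁ ⊕ p₂) x (box≤ρ _ _ (DM.n%ℕd<d i N) (DM.n%ℕd<d j N)) p≤ρ fl₂ ⟨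
        T (a , b) (T (p₁ ⊕ p₂) x) ≡⟨ cong (T (a , b)) (stab-⊕ x fl₂ p₁ p₂ p₁≤ρ p₂≤ρ stab-p₁ stab-p₂) ⟩
        T (a , b) x ∎
        where
        open ≡-Reasoning
        fl₂ = F-pred {2} x (F-pred {3} x fl)
        a = + (i DM.%ℕ N)
        b = + (j DM.%ℕ N)
        k = i DM./ℕ N
        l = j DM./ℕ N
        p₁ = k ℤ.* + N , 0ℤ
        p₂ = 0ℤ , l ℤ.* + N
        eq₁ : ∀ i → i ≡ + (i DM.%ℕ N) ℤ.+ ((i DM./ℕ N) ℤ.* + N ℤ.+ 0ℤ)
        eq₁ i = trans (DM.a≡a%ℕn+[a/ℕn]*n i N) (cong (λ z → + (i DM.%ℕ N) ℤ.+ z) (sym (ℤₚ.+-identityʳ ((i DM./ℕ N) ℤ.* + N))))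
        eq₂ : ∀ i → i ≡ + (i DM.%ℕ N) ℤ.+ (0ℤ ℤ.+ (i DM./ℕ N) ℤ.* + N)
        eq₂ i = trans (DM.a≡a%ℕn+[a/ℕn]*n i N) (cong (λ z → + (i DM.%ℕ N) ℤ.+ z) (sym (ℤₚ.+-identityˡ ((i DM./ℕ N) ℤ.* + N))))
        p₁≤ρ = proj₁ (axis≤ρ {k ℤ.* + N} (quotient≤ i i≤))
        p₂≤ρ = proj₂ (axis≤ρ {l ℤ.* + N} (quotient≤ j j≤))
        p≤ρ : size (p₁ ⊕ p₂) ≤ ρ
        p≤ρ = ≤-trans (size≤2∥∥ (p₁ ⊕ p₂)) (≤-trans (+-mono-≤ both both)
                (≤-trans (≤-reflexive (lemma N)) (bound 8 (≤ᵇ⇒≤ 8 12 _))))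
          where
          lemma : ∀ N → (2 * N + 2) + (2 * N + 2) + ((2 * N + 2) + (2 * N + 2)) ≡ 8 * N + 8
          lemma = solve-∀
          both : ∥ p₁ ⊕ p₂ ∥ ≤ (2 * N + 2) + (2 * N + 2)
          both = +-mono-≤ (subst (λ z → ∣ z ∣ ≤ 2 * N + 2) (sym (ℤₚ.+-identityʳ (k ℤ.* + N))) (quotient≤ i i≤))
                             (subst (λ z → ∣ z ∣ ≤ 2 * N + 2) (sym (ℤₚ.+-identityˡ (l ℤ.* + N))) (quotient≤ j j≤))
        stab-p₁ : T p₁ x ≡ x
        stab-p₁ = subst (λ z → T (k ℤ.* + N , z) x ≡ x) (ℤₚ.*-zeroʳ k)
          (stab-· x fl₂ k (+ N , 0ℤ) (subst (λ z → size (k ℤ.* + N , z) ≤ ρ) (sym (ℤₚ.*-zeroʳ k)) p₁≤ρ) stab₁)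
        stab-p₂ : T p₂ x ≡ x
        stab-p₂ = subst (λ z → T (z , l ℤ.* + N) x ≡ x) (ℤₚ.*-zeroʳ l)
          (stab-· x fl₂ l (0ℤ , + N) (subst (λ z → size (z , l ℤ.* + N) ≤ ρ) (sym (ℤₚ.*-zeroʳ l)) p₂≤ρ) stab₂)

      unit-coord : ∀ m → ∣ proj₁ (unit m) ∣ ≤ 1 × ∣ proj₂ (unit m) ∣ ≤ 1
      unit-coord 0F = s≤s z≤n , z≤n
      unit-coord 1F = s≤s z≤n , s≤s z≤n
      unit-coord 2F = z≤n , s≤s z≤n
      unit-coord 3F = s≤s z≤n , z≤n
      unit-coord 4F = s≤s z≤n , s≤s z≤n
      unit-coord 5F = z≤n , s≤s z≤n

      sum≤ : ∀ e a → ∣ e ∣ ≤ 1 → a < N → ∣ e ℤ.+ + a ∣ ≤ suc N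
      sum≤ e a e≤1 a<N = ≤-trans (ℤₚ.∣i+j∣≤∣i∣+∣j∣ e (+ a)) (+-mono-≤ e≤1 (<⇒≤ a<N))

      step-Z : ∀ {u v} → Adj R u v → Z u → Z v
      step-Z adj (a , b , a<N , b<N , refl) with adj→unit (T (+ a , + b) x) (F-T {3} {+ a , + b} x (box≤ρ a b a<N b<N) fl) adj
      ... | m , v≡ = i DM.%ℕ N , j DM.%ℕ N , DM.n%ℕd<d i N , DM.n%ℕd<d j N ,
          trans v≡ (cong vert (trans (T-add (unit m) (+ a , + b) x (subst (_≤ ρ) (sym (size-unit m)) 2≤ρ) (box≤ρ a b a<N b<N) (F-pred {2} x (F-pred {3} x fl)))
                                     (reduce i j (sum≤ (proj₁ (unit m)) a (proj₁ (unit-coord m)) a<N) (sum≤ (proj₂ (unit m)) b (proj₂ (unit-coord m)) b<N))))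
        where
        i = proj₁ (unit m) ℤ.+ + a
        j = proj₂ (unit m) ℤ.+ + b

    square-torus-absurd : ⊥
    square-torus-absurd = closed-6-absurd Z deg6 step-Z (vert x) (0 , 0 , ℕ.>-nonZero⁻¹ N , ℕ.>-nonZero⁻¹ N , refl)
      where
      deg6 : ∀ v → Z v → deg R v ≡ 6
      deg6 v (a , b , a<N , b<N , refl) = flat-deg (T (+ a , + b) x) (F-T {3} {+ a , + b} x (box≤ρ a b a<N b<N) fl)

  -- By Cramer's rule `det s t` times each basis vector is an integer combination of `s` and `t`.
  -- This reduces every torus to a square one.
  torus-absurd : ∀ s t → torusReach s t ≤ ρ → det s t ≢ 0ℤ → ∀ x → F 4 x → T s x ≡ x → T t x ≡ x → ⊥
  torus-absurd s@(s₁ , s₂) t@(t₁ , t₂) reach≤ρ d≢0 x fl Ts Tt =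
    square-torus-absurd (∣ det s t ∣) {{ℕ.≢-nonZero (d≢0 ∘ ℤₚ.∣i∣≡0⇒i≡0)}} (m+n≤o⇒m≤o _ reach≤ρ) x fl
      (abs (λ z → T (z , 0ℤ) x ≡ x) (det s t) stab₁ (stab-⊝ x fl₂ (det s t , 0ℤ) (axis≤ρ (det s t , 0ℤ) (+-identityʳ _)) stab₁))
      (abs (λ z → T (0ℤ , z) x ≡ x) (det s t) stab₂ (stab-⊝ x fl₂ (0ℤ , det s t) (axis≤ρ (0ℤ , det s t) refl) stab₂))
    where
    fl₂ = F-pred {2} x (F-pred {3} x fl)
    rest = m+n≤o⇒n≤o (12 * ∣ det s t ∣ + 12) reach≤ρ
    rest₁ = m+n≤o⇒m≤o (size (t₂ · s) + size (ℤ.- s₂ · t)) rest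
    rest₂ = m+n≤o⇒n≤o (size (t₂ · s) + size (ℤ.- s₂ · t)) rest
    combine : ∀ c d → size (c · s) + size (d · t) ≤ ρ → T (c · s ⊕ d · t) x ≡ x
    combine c d cd≤ρ = stab-⊕ x fl₂ (c · s) (d · t) c≤ρ d≤ρ (stab-· x fl₂ c s c≤ρ Ts) (stab-· x fl₂ d t d≤ρ Tt)
      where
      c≤ρ = m+n≤o⇒m≤o (size (c · s)) cd≤ρ
      d≤ρ = m+n≤o⇒n≤o (size (c · s)) cd≤ρ
    e₁ : ∀ s₁ s₂ t₁ t₂ → t₂ ℤ.* s₁ ℤ.+ ℤ.- s₂ ℤ.* t₁ ≡ s₁ ℤ.* t₂ ℤ.- s₂ ℤ.* t₁
    e₁ = ℤ-solve-∀
    e₂ : ∀ s₂ t₂ → t₂ ℤ.* s₂ ℤ.+ ℤ.- s₂ ℤ.* t₂ ≡ 0ℤ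
    e₂ = ℤ-solve-∀
    e₃ : ∀ s₁ t₁ → ℤ.- t₁ ℤ.* s₁ ℤ.+ s₁ ℤ.* t₁ ≡ 0ℤ
    e₃ = ℤ-solve-∀
    e₄ : ∀ s₁ s₂ t₁ t₂ → ℤ.- t₁ ℤ.* s₂ ℤ.+ s₁ ℤ.* t₂ ≡ s₁ ℤ.* t₂ ℤ.- s₂ ℤ.* t₁
    e₄ = ℤ-solve-∀
    stab₁ : T (det s t , 0ℤ) x ≡ x
    stab₁ = subst (λ q → T q x ≡ x) (cong₂ _,_ (e₁ s₁ s₂ t₁ t₂) (e₂ s₂ t₂)) (combine t₂ (ℤ.- s₂) rest₁)
    stab₂ : T (0ℤ , det s t) x ≡ x
    stab₂ = subst (λ q → T q x ≡ x) (cong₂ _,_ (e₃ s₁ t₁) (e₄ s₁ s₂ t₁ t₂)) (combine (ℤ.- t₁) s₁ rest₂)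
    axis≤ρ : ∀ p → ∥ p ∥ ≡ ∣ det s t ∣ → size p ≤ ρ
    axis≤ρ p eq = ≤-trans (size≤2∥∥ p) (≤-trans (≤-reflexive (cong₂ _+_ eq eq))
      (≤-trans (≤-trans (≤-reflexive (lemma (∣ det s t ∣))) (≤-trans (*-monoˡ-≤ (∣ det s t ∣) {2} {12} (s≤s (s≤s z≤n))) (m≤m+n _ 12)))
        (m+n≤o⇒m≤o _ reach≤ρ)))
      where
      lemma : ∀ N → N + N ≡ 2 * N
      lemma = solve-∀
    abs : ∀ (P : ℤ → Set) d → P d → P (ℤ.- d) → P (+ ∣ d ∣)
    abs P (+ _)    pos neg = pos
    abs P -[1+ _ ] pos neg = neg

-- The exchange argument

Near : ∀ {n} → RotationSystem n → Fin n → Fin n → Set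
Near R u v = u ≡ v ⊎ Adj R u v

near-dominated : ∀ {n} (R : RotationSystem n) {D} → Dominating R D → ∀ v → ∃ λ u → u ∈ D × Near R u v
near-dominated R dom v with dom v
... | inj₁ v∈D             = v , v∈D , inj₁ refl
... | inj₂ (u , u∈D , adj) = u , u∈D , inj₂ adj

dominated-near : ∀ {n} (R : RotationSystem n) {D} → (∀ v → ∃ λ u → u ∈ D × Near R u v) → Dominating R D
dominated-near R near v with near v
... | u , u∈D , inj₁ refl = inj₁ u∈D
... | u , u∈D , inj₂ adj  = inj₂ (u , u∈D , adj)

record Minimum {n} (R : RotationSystem n) (D : List (Fin n)) : Set where
  field
    dominating : Dominating R D
    minimum    : ∀ D′ → Dominating R D′ → length D ≤ length D′

open Minimum public

module Indicator {n} (D : List (Fin n)) where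

  _∈ᵥ?_ : ∀ (v : Fin n) vs → Dec (v ∈ vs)
  _∈ᵥ?_ = member? Fin._≟_

  χᵥ : Fin n → ℕ
  χᵥ v with v ∈ᵥ? D
  ... | yes _ = 1
  ... | no  _ = 0

  χᵥ≤1 : ∀ v → χᵥ v ≤ 1
  χᵥ≤1 v with v ∈ᵥ? D
  ... | yes _ = s≤s z≤n
  ... | no  _ = z≤n

  total-χᵥ : ∀ vs → total χᵥ vs ≡ length (filter (_∈ᵥ? D) vs)
  total-χᵥ [] = refl
  total-χᵥ (v ∷ vs) with v ∈ᵥ? D
  ... | yes _ = cong suc (total-χᵥ vs)
  ... | no  _ = total-χᵥ vs

module Exchange {n} (R : RotationSystem n) (D : List (Fin n)) (min : Minimum R D) where
  open Indicator D

  -- `Q` together with the part of `D` outside `A` dominates again, so it is no shorter than `D`.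
  -- Only the length of `Q` counts; it may have repetitions or meet the part of `D` that is kept.
  exchange : ∀ A Q → Unique A → (∀ {a v} → a ∈ A → Near R a v → ∃ λ q → q ∈ Q × Near R q v) → total χᵥ A ≤ length Q
  exchange A Q uA cover = begin
    total χᵥ A ≡⟨ total-χᵥ A ⟩
    length (filter (_∈ᵥ? D) A) ≤⟨ length-⊆ (Uniqueₚ.filter⁺ (_∈ᵥ? D) uA) sub ⟩
    length (filter (_∈ᵥ? A) D) ≤⟨ +-cancelʳ-≤ _ _ _ compare ⟩
    length Q ∎
    where
    open ≤-Reasoning
    sub : filter (_∈ᵥ? D) A ⊆ filter (_∈ᵥ? A) D
    sub v∈ with ∈-filter⁻ (_∈ᵥ? D) {xs = A} v∈
    ... | v∈A , v∈D = ∈-filter⁺ (_∈ᵥ? A) v∈D v∈A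
    keep = filter (¬? ∘ (_∈ᵥ? A)) D
    D′ = keep ++ Q
    D′-near : ∀ v → ∃ λ u → u ∈ D′ × Near R u v
    D′-near v with near-dominated R (dominating min) v
    ... | u , u∈D , near with u ∈ᵥ? A
    ...   | no u∉A = u , ∈-++⁺ˡ (∈-filter⁺ (¬? ∘ (_∈ᵥ? A)) u∈D u∉A) , near
    ...   | yes u∈A with cover u∈A near
    ...     | q , q∈Q , near′ = q , ∈-++⁺ʳ keep q∈Q , near′
    compare : length (filter (_∈ᵥ? A) D) + length keep ≤ length Q + length keep
    compare = begin
      length (filter (_∈ᵥ? A) D) + length keep ≡⟨ length-filter-split (_∈ᵥ? A) D ⟨
      length D ≤⟨ minimum min D′ (dominated-near R D′-near) ⟩
      length (keep ++ Q) ≡⟨ Listₚ.length-++ keep ⟩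
      length keep + length Q ≡⟨ +-comm (length keep) (length Q) ⟩
      length Q + length keep ∎

-- Counting darts

nearBound : ℕ → ℕ
nearBound k = 12 * 7 ^ k * 6

module Counting (G : Triangulation) where
  open Translations G

  dart : (v : V) → Fin (deg R v) → Dart
  dart v s = v , s

  dartsAt : V → List Dart
  dartsAt v = map (dart v) (allFin (deg R v))

  darts : List Dart
  darts = concatMap dartsAt (allFin n)

  ∈-dartsAt : ∀ x → x ∈ dartsAt (vert x)
  ∈-dartsAt (v , s) = ∈-map⁺ (dart v) (∈-allFin s)

  dartsAt-vert : ∀ {v x} → x ∈ dartsAt v → vert x ≡ v
  dartsAt-vert x∈ with ∈-map⁻ (dart _) x∈
  ... | _ , _ , refl = refl

  length-dartsAt : ∀ v → length (dartsAt v) ≡ deg R v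
  length-dartsAt v = trans (Listₚ.length-map (dart v) (allFin (deg R v))) (length-allFin (deg R v))

  ∈-darts : ∀ x → x ∈ darts
  ∈-darts x = ∈-concatMap⁺ dartsAt (Any.map (λ where refl → ∈-dartsAt x) (∈-allFin (vert x)))

  darts-unique : Unique darts
  darts-unique = unique-concatMap dartsAt (Uniqueₚ.allFin⁺ n)
    (λ {v} _ → Uniqueₚ.map⁺ (λ where refl → refl) (Uniqueₚ.allFin⁺ (deg R v)))
    (λ _ _ z∈x z∈y → trans (sym (dartsAt-vert z∈x)) (dartsAt-vert z∈y))

  flat? : ∀ k x → Dec (Flat k x)
  flat? k x with member? Fin._≟_ (vert x) (nearBad k)
  ... | yes x∈ = no λ fl → avoid fl x∈
  ... | no x∉ = yes (away x∉)

  few-not-flat : ∀ k xs → Unique xs → (∀ {x} → x ∈ xs → ¬ Flat k x) → length xs ≤ nearBound k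
  few-not-flat k xs u ¬fl = begin
    length xs ≤⟨ length-⊆ u sub ⟩
    length (concatMap dartsAt (nearBad k)) ≤⟨ length-concatMap dartsAt 6 (λ v → subst (_≤ 6) (sym (length-dartsAt v)) (Δ≤6 v)) (nearBad k) ⟩
    length (nearBad k) * 6 ≤⟨ *-monoˡ-≤ 6 (nearBad≤ k) ⟩
    12 * 7 ^ k * 6 ∎
    where
    open ≤-Reasoning
    sub : xs ⊆ concatMap dartsAt (nearBad k)
    sub {x} x∈ with member? Fin._≟_ (vert x) (nearBad k)
    ... | yes vx∈ = ∈-concatMap⁺ dartsAt (Any.map (λ where refl → ∈-dartsAt x) vx∈)
    ... | no  vx∉ = ⊥-elim (¬fl x∈ (away vx∉))

-- A class of darts on which short translations act up to boundary effects. The properties that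
-- separate the cases, such as being fixed by a given vector, are preserved by translations, so they
-- cut regions into regions.
record Region (G : Triangulation) (ρ : ℕ) (Y : List (Darts.Dart G)) : Set where
  open Translations G
  open Local G ρ
  field
    unique : Unique Y
    -- no argument takes more than 10 successive steps from a dart of Y
    deep   : ∀ {x} → x ∈ Y → F 10 x
    invariant : ∀ {x} p → x ∈ Y → size p ≤ ρ → F 10 (T p x) → T p x ∈ Y

NoShort : (G : Triangulation) → ℕ → Darts.Dart G → Set
NoShort G b x = ∀ t → t ≢ 𝟘 → hex t < b → T t x ≢ x
  where open Translations G

Fix : (G : Triangulation) → Λ → Darts.Dart G → Set
Fix G w x = T w x ≡ x
  where open Translations G

-- The error C may depend on ρ, but not on the triangulation.
Sparse : ((G : Triangulation) → Darts.Dart G → Set) → Set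
Sparse P = Σ ℕ λ ρ₀ → ∀ ρ → ρ₀ ≤ ρ → Σ ℕ λ C →
  ∀ (G : Triangulation) D → Minimum (Triangulation.rotation G) D → ∀ Y → Region G ρ Y → (∀ {x} → x ∈ Y → P G x) →
  6 * total (Indicator.χᵥ D ∘ Darts.vert G) Y ≤ length Y + C

module InRegion (G : Triangulation) (ρ : ℕ) (D : List (Darts.V G)) (min : Minimum (Triangulation.rotation G) D) where
  open Translations G public
  open Local G ρ public
  open Counting G public
  open Exchange R D min public
  open Indicator D public

  χ : Dart → ℕ
  χ = χᵥ ∘ vert

  Deep? : ∀ x → Dec (F 10 x)
  Deep? x = flat? (10 * ρ + 3) x

  total-χ≤length : ∀ xs → total χ xs ≤ length xs
  total-χ≤length xs = subst (total χ xs ≤_) (sym (length≡total xs)) (total-mono xs (λ {x} _ → χᵥ≤1 (vert x)))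

  margin : ℕ
  margin = nearBound (11 * ρ + 3)

  few-shallow : ∀ xs → Unique xs → (∀ {x} → x ∈ xs → ∃ λ p → size p ≤ ρ × ¬ F 10 (T p x)) → length xs ≤ margin
  few-shallow xs u shallow = few-not-flat (11 * ρ + 3) xs u
    λ {x} x∈ fl → let (p , p≤ρ , ¬fl) = shallow x∈ in ¬fl (F-T {10} {p} x p≤ρ fl)

  module _ {Y : List Dart} (region : Region G ρ Y) where
    open Region region

    _∈Y? : ∀ x → Dec (x ∈ Y)
    x ∈Y? = member? _≟ᵈ_ x Y

    -- `T p` is injective and leaves the region only where flatness ends, so a translate of the
    -- region misses boundedly many of its darts.
    shift : ∀ p → size p ≤ ρ → total χ Y ≤ total (χ ∘ T p) Y + margin
    shift p p≤ρ = begin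
      total χ Y ≡⟨ total-filter back? χ Y ⟩
      total χ stay + total χ leave ≤⟨ +-mono-≤ (total-⊆ χ (Uniqueₚ.filter⁺ back? unique) stay⊆) leave≤ ⟩
      total χ (map (T p) Y) + margin ≡⟨ cong (_+ margin) (total-map χ (T p) Y) ⟩
      total (χ ∘ T p) Y + margin ∎
      where
      open ≤-Reasoning
      p⁻≤ρ : size (⊝ p) ≤ ρ
      p⁻≤ρ = subst (_≤ ρ) (sym (size-⊝ p)) p≤ρ
      back? = λ x → T (⊝ p) x ∈Y?
      stay = filter back? Y
      leave = filter (¬? ∘ back?) Y
      stay⊆ : stay ⊆ map (T p) Y
      stay⊆ {x} x∈ with ∈-filter⁻ back? {xs = Y} x∈
      ... | x∈Y , back∈Y = subst (_∈ map (T p) Y)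
        (trans (T-add p (⊝ p) x p≤ρ p⁻≤ρ (F-mono {2} {10} x (s≤s (s≤s z≤n)) (deep x∈Y))) (cong (λ q → T q x) (⊕-inverseʳ p)))
        (∈-map⁺ (T p) back∈Y)
      leave≤ : total χ leave ≤ margin
      leave≤ = ≤-trans (total-χ≤length leave) (few-shallow leave (Uniqueₚ.filter⁺ (¬? ∘ back?) unique) λ {x} x∈ →
        let (x∈Y , back∉Y) = ∈-filter⁻ (¬? ∘ back?) {xs = Y} x∈ in ⊝ p , p⁻≤ρ , λ fl → back∉Y (invariant (⊝ p) x∈Y p⁻≤ρ fl))

    -- The pairs of a dart `x` of `Y` and a vector `p` of `A` are counted twice: for fixed `p` by
    -- `shift`, for fixed `x` by the exchange inequality `local`.
    average : ∀ A Q → (∀ {p} → p ∈ A → size p ≤ ρ) → 1 ≤ length A → 6 * length {A = Λ} Q ≤ length A →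
              (∀ {x} → x ∈ Y → total (λ p → χ (T p x)) A ≤ length Q) → 6 * total χ Y ≤ length Y + 6 * margin
    average A Q A≤ρ A≢[] density local = *-cancelˡ-≤ a {{ℕ.>-nonZero A≢[]}} (begin
      a * (6 * d) ≡⟨ lemma₁ a d ⟩
      6 * (a * d) ≡⟨ cong (6 *_) (total-const d A) ⟨
      6 * total (λ _ → d) A ≤⟨ *-monoʳ-≤ 6 (total-mono A (λ {p} p∈ → shift p (A≤ρ p∈))) ⟩
      6 * total (λ p → total (χ ∘ T p) Y + margin) A ≡⟨ cong (6 *_) (trans (total-+ _ _ A) (cong₂ _+_ (sym (total-swap (λ x p → χ (T p x)) Y A)) (total-const margin A))) ⟩
      6 * (total (λ x → total (λ p → χ (T p x)) A) Y + a * margin) ≤⟨ *-monoʳ-≤ 6 (+-monoˡ-≤ (a * margin) (≤-trans (total-mono Y local) (≤-reflexive (total-const (length Q) Y)))) ⟩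
      6 * (length Y * length Q + a * margin) ≡⟨ lemma₂ (length Y) (length Q) a margin ⟩
      length Y * (6 * length Q) + a * (6 * margin) ≤⟨ +-monoˡ-≤ (a * (6 * margin)) (*-monoʳ-≤ (length Y) density) ⟩
      length Y * a + a * (6 * margin) ≡⟨ lemma₃ (length Y) a (6 * margin) ⟩
      a * (length Y + 6 * margin) ∎)
      where
      open ≤-Reasoning
      a = length A
      d = total χ Y
      lemma₁ : ∀ a d → a * (6 * d) ≡ 6 * (a * d)
      lemma₁ = solve-∀
      lemma₂ : ∀ y q a m → 6 * (y * q + a * m) ≡ y * (6 * q) + a * (6 * m)
      lemma₂ = solve-∀
      lemma₃ : ∀ y a m → y * a + a * m ≡ a * (y + m)
      lemma₃ = solve-∀

  near→small : ∀ {k} y → Flat k y → ∀ {v} → Near R (vert y) v → ∃ λ e → Small e × v ≡ vert (T e y)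
  near→small y fl (inj₁ refl) = 𝟘 , inj₁ refl , refl
  near→small y fl (inj₂ adj) with adj→unit y fl adj
  ... | m , v≡ = unit m , inj₂ (m , refl) , v≡

  small→near : ∀ {e k} y → Flat k y → Small e → Near R (vert (T e y)) (vert y)
  small→near y fl (inj₁ refl)       = inj₁ refl
  small→near y fl (inj₂ (m , refl)) = inj₂ (unit→adj m y fl)

  small≤ρ : 2 ≤ ρ → ∀ {e} → Small e → size e ≤ ρ
  small≤ρ 2≤ρ (inj₁ refl)       = z≤n
  small≤ρ 2≤ρ (inj₂ (m , refl)) = subst (_≤ ρ) (sym (size-unit m)) 2≤ρ

  -- The two darts at the common vertex differ by a turn. A nontrivial turn would be a translation
  -- as well, against `rotation-free`, so the darts agree.
  same-vertex : ∀ x p q → size p ≤ ρ → size q ≤ ρ → rotationReach (q ⊕ ⊝ p) ≤ ρ → F 5 x →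
                vert (T p x) ≡ vert (T q x) → T (q ⊕ ⊝ p) x ≡ x
  same-vertex x p q p≤ρ q≤ρ reach≤ρ fl same with r-orbit (T p x) (T q x) same (flat-deg (T p x) (F-T {4} {p} x p≤ρ fl))
  ... | m , eq = cases m eq
    where
    t = q ⊕ ⊝ p
    t≤ρ : size t ≤ ρ
    t≤ρ = m+n≤o⇒m≤o (size t) reach≤ρ
    fl₂ = F-mono {2} {5} x (s≤s (s≤s z≤n)) fl
    T-t : T t (T p x) ≡ T q x
    T-t = trans (T-add t p x t≤ρ p≤ρ fl₂) (cong (λ s → T s x) (trans (⊕-assoc q (⊝ p) p) (trans (cong (q ⊕_) (⊕-inverseˡ p)) (⊕-identityʳ q))))
    cases : ∀ (m : Fin 6) → iter (toℕ m) r (T p x) ≡ T q x → T t x ≡ x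
    cases zero eq = to-injective (translation p) (trans (T-comm p t x p≤ρ t≤ρ fl₂) (trans T-t (sym eq)))
    cases (suc m) eq = ⊥-elim (rotation-free (suc m) (λ ()) t reach≤ρ (T p x) (F-T {4} {p} x p≤ρ fl) (trans T-t (sym eq)))

-- A finite pattern for darts that `w` fixes; `w = 𝟘` is the plane. The cover may use the period `w`
-- once in either direction. The alternatives in `separated` are the two reasons why different
-- points of `A` give different vertices: a short period is excluded by `NoShort`, a period
-- independent of `w` by `torus-absurd`.
record Patch (w : Λ) (b : ℕ) : Set where
  field
    A Q       : List Λ
    unique    : Unique A
    nonempty  : 1 ≤ length A
    density   : 6 * length Q ≤ length A
    cover     : ∀ {p e} → p ∈ A → Small e → ∃ λ q → q ∈ Q × ∃₂ λ e′ s →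
                Small e′ × (s ≡ 𝟘 ⊎ s ≡ w ⊎ s ≡ ⊝ w) × e′ ⊕ (e ⊕ p) ≡ q ⊕ s
    separated : ∀ {p q} → p ∈ A → q ∈ A → p ≢ q → hex (q ⊕ ⊝ p) < b ⊎ det (q ⊕ ⊝ p) w ≢ 0ℤ

module _ {w : Λ} {b : ℕ} (patch : Patch w b) where
  open Patch patch

  private
    pairReach : Λ → Λ → ℕ
    pairReach p q = rotationReach (q ⊕ ⊝ p) + torusReach (q ⊕ ⊝ p) w

    reachA reachQ patchReach : ℕ
    reachA = total (λ p → size p + 2 + total (pairReach p) A) A
    reachQ = total size Q
    patchReach = size w + 2 + (reachA + reachQ)

  patch-sparse : Sparse (λ G x → NoShort G b x × Fix G w x)
  patch-sparse = patchReach , λ ρ reach≤ρ → 6 * nearBound (11 * ρ + 3) , λ G D min Y region P →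
    let open InRegion G ρ D min in average region A Q (λ {p} → proj₁ ∘ bounds ρ reach≤ρ p) nonempty density λ {x} x∈ →
      subst₂ _≤_ (total-map χᵥ (λ p → vert (T p x)) A) (Listₚ.length-map (λ q → vert (T q x)) Q)
        (exchange (map (λ p → vert (T p x)) A) (map (λ q → vert (T q x)) Q)
          (distinct ρ reach≤ρ G D min x (F-mono {5} {10} x (≤ᵇ⇒≤ 5 10 _) (Region.deep region x∈)) (P x∈))
          (covers ρ reach≤ρ G D min x (F-mono {5} {10} x (≤ᵇ⇒≤ 5 10 _) (Region.deep region x∈)) (P x∈)))
    where
    module _ (ρ : ℕ) (reach≤ρ : patchReach ≤ ρ) where
      tail≤ρ : reachA + reachQ ≤ ρ
      tail≤ρ = m+n≤o⇒n≤o (size w + 2) reach≤ρ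
      w≤ρ : size w ≤ ρ
      w≤ρ = m+n≤o⇒m≤o (size w) (m+n≤o⇒m≤o (size w + 2) reach≤ρ)
      2≤ρ : 2 ≤ ρ
      2≤ρ = m+n≤o⇒n≤o (size w) (m+n≤o⇒m≤o (size w + 2) reach≤ρ)
      bounds : ∀ p → p ∈ A → size p ≤ ρ × size p + 2 ≤ ρ × total (pairReach p) A ≤ ρ
      bounds p p∈ = m+n≤o⇒m≤o (size p) le , le , m+n≤o⇒n≤o (size p + 2) both
        where
        both : size p + 2 + total (pairReach p) A ≤ ρ
        both = ≤-trans (member≤total (λ p → size p + 2 + total (pairReach p) A) p∈) (m+n≤o⇒m≤o reachA tail≤ρ)
        le = m+n≤o⇒m≤o (size p + 2) both
      pair≤ρ : ∀ {p q} → p ∈ A → q ∈ A → pairReach p q ≤ ρ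
      pair≤ρ {p} p∈ q∈ = ≤-trans (member≤total (pairReach p) q∈) (proj₂ (proj₂ (bounds p p∈)))
      q≤ρ : ∀ {q} → q ∈ Q → size q ≤ ρ
      q≤ρ q∈ = ≤-trans (member≤total size q∈) (m+n≤o⇒n≤o reachA tail≤ρ)

      module _ (G : Triangulation) D (min : Minimum (Triangulation.rotation G) D) where
        open InRegion G ρ D min

        distinct : ∀ x → F 5 x → NoShort G b x × Fix G w x → Unique (map (λ p → vert (T p x)) A)
        distinct x fl (noShort , fix) = unique-map (λ p → vert (T p x)) unique inj
          where
          inj : ∀ {p q} → p ∈ A → q ∈ A → vert (T p x) ≡ vert (T q x) → p ≡ q
          inj {p} {q} p∈ q∈ same with p ≟Λ q
          ... | yes p≡q = p≡q
          ... | no  p≢q = ⊥-elim (absurd (separated p∈ q∈ p≢q))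
            where
            t = q ⊕ ⊝ p
            rot≤ρ = m+n≤o⇒m≤o (rotationReach t) (pair≤ρ p∈ q∈)
            tor≤ρ = m+n≤o⇒n≤o (rotationReach t) (pair≤ρ p∈ q∈)
            fix-t : T t x ≡ x
            fix-t = same-vertex x p q (proj₁ (bounds p p∈)) (proj₁ (bounds q q∈)) rot≤ρ fl same
            t≢𝟘 : t ≢ 𝟘
            t≢𝟘 t≡𝟘 = p≢q (sym (trans (sym (trans (⊕-assoc q (⊝ p) p) (trans (cong (q ⊕_) (⊕-inverseˡ p)) (⊕-identityʳ q))))
                            (trans (cong (_⊕ p) t≡𝟘) (⊕-identityˡ p))))
            absurd : hex t < b ⊎ det t w ≢ 0ℤ → ⊥
            absurd (inj₁ short) = noShort t t≢𝟘 short fix-t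
            absurd (inj₂ indep) = torus-absurd t w tor≤ρ indep x (F-pred {4} x fl) fix-t fix

        covers : ∀ x → F 5 x → NoShort G b x × Fix G w x → ∀ {a v} → a ∈ map (λ p → vert (T p x)) A → Near R a v →
                 ∃ λ u → u ∈ map (λ q → vert (T q x)) Q × Near R u v
        covers x fl (_ , fix) a∈ near with ∈-map⁻ (λ p → vert (T p x)) a∈
        ... | p , p∈ , refl with near→small (T p x) (F-T {4} {p} x (proj₁ (bounds p p∈)) fl) near
        ...   | e , small-e , refl with cover p∈ small-e
        ...     | q , q∈ , e′ , s , small-e′ , s∈ , eq = vert (T q x) , ∈-map⁺ (λ q → vert (T q x)) q∈ ,
          subst (λ u → Near R u (vert (T e (T p x)))) (cong vert move)
            (small→near (T e (T p x)) (F-T {3} {e} (T p x) (small≤ρ 2≤ρ small-e) (F-T {4} {p} x p≤ρ fl)) small-e′)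
          where
          p≤ρ = proj₁ (bounds p p∈)
          fl₂ = F-mono {2} {5} x (s≤s (s≤s z≤n)) fl
          e⊕p≤ρ : size (e ⊕ p) ≤ ρ
          e⊕p≤ρ = ≤-trans (size-⊕ e p) (≤-trans (≤-trans (+-monoˡ-≤ (size p) (e≤2 small-e)) (≤-reflexive (+-comm 2 (size p)))) (proj₁ (proj₂ (bounds p p∈))))
            where
            e≤2 : ∀ {e} → Small e → size e ≤ 2
            e≤2 (inj₁ refl)       = z≤n
            e≤2 (inj₂ (m , refl)) = ≤-reflexive (size-unit m)
          fix-s : T s x ≡ x × size s ≤ ρ
          fix-s = fixes s∈
            where
            fixes : ∀ {s} → s ≡ 𝟘 ⊎ s ≡ w ⊎ s ≡ ⊝ w → T s x ≡ x × size s ≤ ρ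
            fixes (inj₁ refl)        = refl , z≤n
            fixes (inj₂ (inj₁ refl)) = fix , w≤ρ
            fixes (inj₂ (inj₂ refl)) = stab-⊝ x fl₂ w w≤ρ fix , subst (_≤ ρ) (sym (size-⊝ w)) w≤ρ
          move : T e′ (T e (T p x)) ≡ T q x
          move = begin
            T e′ (T e (T p x)) ≡⟨ cong (T e′) (T-add e p x (small≤ρ 2≤ρ small-e) p≤ρ fl₂) ⟩
            T e′ (T (e ⊕ p) x) ≡⟨ T-add e′ (e ⊕ p) x (small≤ρ 2≤ρ small-e′) e⊕p≤ρ fl₂ ⟩
            T (e′ ⊕ (e ⊕ p)) x ≡⟨ cong (λ z → T z x) eq ⟩
            T (q ⊕ s) x ≡⟨ T-add q s x (q≤ρ q∈) (proj₂ fix-s) fl₂ ⟨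
            T q (T s x) ≡⟨ cong (T q) (proj₁ fix-s) ⟩
            T q x ∎
            where open ≡-Reasoning

-- Patches of the perfect code

-- The lower bound is stored with its sign reversed, so that both bounds are natural numbers and
-- errors simply add up on either side.
In : ℤ → ℕ → ℕ → Set
In i lo hi = ℤ.- + lo ℤ.≤ i × i ℤ.≤ + hi

in-mono : ∀ {i a b a′ b′} → a ≤ a′ → b ≤ b′ → In i a b → In i a′ b′
in-mono a≤ b≤ (lo , hi) = ℤₚ.≤-trans (ℤₚ.neg-mono-≤ (+≤+ a≤)) lo , ℤₚ.≤-trans hi (+≤+ b≤)

in-nat : ∀ {x b} → x ≤ b → In (+ x) 0 b
in-nat x≤b = +≤+ z≤n , +≤+ x≤b

in-+ : ∀ {i j a b c d} → In i a b → In j c d → In (i ℤ.+ j) (a + c) (b + d)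
in-+ {a = a} {c = c} (lo , hi) (lo′ , hi′) =
  ℤₚ.≤-trans (ℤₚ.≤-reflexive (ℤₚ.neg-distrib-+ (+ a) (+ c))) (ℤₚ.+-mono-≤ lo lo′) , ℤₚ.+-mono-≤ hi hi′

in-neg : ∀ {i a b} → In i a b → In (ℤ.- i) b a
in-neg {i} {a} (lo , hi) = ℤₚ.neg-mono-≤ hi , ℤₚ.≤-trans (ℤₚ.neg-mono-≤ lo) (ℤₚ.≤-reflexive (ℤₚ.neg-involutive (+ a)))

private
  *-shrink : ∀ N .{{_ : NonZero N}} j a → + N ℤ.* j ℤ.≤ + a → j ℤ.≤ + a
  *-shrink N (+ m)    a Nj≤a = +≤+ (≤-trans (m≤n*m m N) (ℤₚ.drop‿+≤+ (subst (ℤ._≤ + a) (sym (ℤₚ.pos-* N m)) Nj≤a)))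
  *-shrink N -[1+ m ] a Nj≤a = -≤+

-- Only the main term `N * l` is divided. The error terms are kept undivided, which is wasteful but
-- does not depend on `l`.
in-/ : ∀ N .{{_ : NonZero N}} {k a l c} → In (+ N ℤ.* k) a (N * l + c) → In k a (l + c)
in-/ N {k} {a} {l} {c} (lo , hi) = lower , upper
  where
  neg : ∀ N k → ℤ.- (N ℤ.* k) ≡ N ℤ.* ℤ.- k
  neg = ℤ-solve-∀
  lower : ℤ.- + a ℤ.≤ k
  lower = subst (ℤ.- + a ℤ.≤_) (ℤₚ.neg-involutive k) (ℤₚ.neg-mono-≤ (*-shrink N (ℤ.- k) a
    (subst₂ ℤ._≤_ (neg (+ N) k) (ℤₚ.neg-involutive (+ a)) (ℤₚ.neg-mono-≤ lo))))
  e₁ : ∀ N k l → N ℤ.* k ℤ.- N ℤ.* l ≡ N ℤ.* (k ℤ.- l)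
  e₁ = ℤ-solve-∀
  e₂ : ∀ l c → (l ℤ.+ c) ℤ.- l ≡ c
  e₂ = ℤ-solve-∀
  e₃ : ∀ k l → (k ℤ.- l) ℤ.+ l ≡ k
  e₃ = ℤ-solve-∀
  diff : k ℤ.- + l ℤ.≤ + c
  diff = *-shrink N (k ℤ.- + l) c (subst₂ ℤ._≤_ (trans (cong (λ z → + N ℤ.* k ℤ.- z) (ℤₚ.pos-* N l)) (e₁ (+ N) k (+ l))) (e₂ (+ (N * l)) (+ c))
    (ℤₚ.+-monoˡ-≤ (ℤ.- + (N * l)) hi))
  upper : k ℤ.≤ + (l + c)
  upper = subst₂ ℤ._≤_ (e₃ k (+ l)) (cong +_ (+-comm c l)) (ℤₚ.+-monoˡ-≤ (+ l) diff)

in-index : ∀ {i a b} → In i a b → ∃ λ t → t < suc (a + b) × i ≡ + t ℤ.- + a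
in-index {i} {a} {b} (lo , hi) with i ℤ.+ + a in eq | ℤₚ.≤-trans (ℤₚ.≤-reflexive (sym (ℤₚ.+-inverseˡ (+ a)))) (ℤₚ.+-monoˡ-≤ (+ a) lo) | ℤₚ.+-monoˡ-≤ (+ a) hi
... | + t | _ | t≤ = t , s≤s (subst (t ≤_) (+-comm b a) (ℤₚ.drop‿+≤+ t≤)) , trans (lemma i (+ a)) (cong (ℤ._- + a) eq)
  where
  lemma : ∀ i a → i ≡ (i ℤ.+ a) ℤ.- a
  lemma = ℤ-solve-∀

in-small : ∀ {e} → Small e → In (proj₁ e) 1 1 × In (proj₂ e) 1 1
in-small (inj₁ refl) = (-≤+ , +≤+ z≤n) , (-≤+ , +≤+ z≤n)
in-small (inj₂ (0F , refl)) = (-≤+ , +≤+ (s≤s z≤n)) , (-≤+ , +≤+ z≤n)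
in-small (inj₂ (1F , refl)) = (-≤+ , +≤+ (s≤s z≤n)) , (ℤ.-≤- z≤n , -≤+)
in-small (inj₂ (2F , refl)) = (-≤+ , +≤+ z≤n) , (ℤ.-≤- z≤n , -≤+)
in-small (inj₂ (3F , refl)) = (ℤ.-≤- z≤n , -≤+) , (-≤+ , +≤+ z≤n)
in-small (inj₂ (4F , refl)) = (ℤ.-≤- z≤n , -≤+) , (-≤+ , +≤+ (s≤s z≤n))
in-small (inj₂ (5F , refl)) = (-≤+ , +≤+ z≤n) , (-≤+ , +≤+ (s≤s z≤n))

-- The zero vector and the six units take each value modulo 7 exactly once under (x , y) ↦ x - 2 y.
perfect-code : ∀ p → ∃₂ λ e k → Small e × proj₁ (e ⊕ p) ≡ + 2 ℤ.* proj₂ (e ⊕ p) ℤ.+ + 7 ℤ.* k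
perfect-code p@(x , y) = residue (z DM.%ℕ 7) (DM.n%ℕd<d z 7) (trans (e₀ x y) (cong (ℤ._+ + 2 ℤ.* y) (DM.a≡a%ℕn+[a/ℕn]*n z 7)))
  where
  z = x ℤ.- + 2 ℤ.* y
  k = z DM./ℕ 7
  e₀ : ∀ x y → x ≡ (x ℤ.- + 2 ℤ.* y) ℤ.+ + 2 ℤ.* y
  e₀ = ℤ-solve-∀
  Word : Set
  Word = ∃₂ λ e k → Small e × proj₁ (e ⊕ p) ≡ + 2 ℤ.* proj₂ (e ⊕ p) ℤ.+ + 7 ℤ.* k
  word : ∀ ρ e l → Small e → proj₁ e ℤ.+ + ρ ≡ + 2 ℤ.* proj₂ e ℤ.+ + 7 ℤ.* l → x ≡ + ρ ℤ.+ k ℤ.* + 7 ℤ.+ + 2 ℤ.* y → Word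
  word ρ e l small-e eq x≡ = e , l ℤ.+ k , small-e ,
    trans (cong (λ z → proj₁ e ℤ.+ z) x≡) (trans (e₁ (proj₁ e) (+ ρ) k y) (trans (cong (ℤ._+ (k ℤ.* + 7 ℤ.+ + 2 ℤ.* y)) eq) (e₂ (proj₂ e) l k y)))
    where
    e₁ : ∀ e ρ k y → e ℤ.+ (ρ ℤ.+ k ℤ.* + 7 ℤ.+ + 2 ℤ.* y) ≡ (e ℤ.+ ρ) ℤ.+ (k ℤ.* + 7 ℤ.+ + 2 ℤ.* y)
    e₁ = ℤ-solve-∀
    e₂ : ∀ e l k y → (+ 2 ℤ.* e ℤ.+ + 7 ℤ.* l) ℤ.+ (k ℤ.* + 7 ℤ.+ + 2 ℤ.* y) ≡ + 2 ℤ.* (e ℤ.+ y) ℤ.+ + 7 ℤ.* (l ℤ.+ k)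
    e₂ = ℤ-solve-∀
  residue : ∀ ρ → ρ < 7 → x ≡ + ρ ℤ.+ k ℤ.* + 7 ℤ.+ + 2 ℤ.* y → Word
  residue 0 _ = word 0 𝟘 0ℤ (inj₁ refl) refl
  residue 1 _ = word 1 (unit 3F) 0ℤ (inj₂ (3F , refl)) refl
  residue 2 _ = word 2 (unit 5F) 0ℤ (inj₂ (5F , refl)) refl
  residue 3 _ = word 3 (unit 4F) 0ℤ (inj₂ (4F , refl)) refl
  residue 4 _ = word 4 (unit 1F) 1ℤ (inj₂ (1F , refl)) refl
  residue 5 _ = word 5 (unit 2F) 1ℤ (inj₂ (2F , refl)) refl
  residue 6 _ = word 6 (unit 0F) 1ℤ (inj₂ (0F , refl)) refl
  residue (suc (suc (suc (suc (suc (suc (suc _))))))) (s≤s (s≤s (s≤s (s≤s (s≤s (s≤s (s≤s ())))))))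

box : ℕ → ℕ → List Λ
box X Y = cartesianProduct (map +_ (upTo X)) (map +_ (upTo Y))

box-unique : ∀ X Y → Unique (box X Y)
box-unique X Y = Uniqueₚ.cartesianProduct⁺ (Uniqueₚ.map⁺ ℤₚ.+-injective (Uniqueₚ.upTo⁺ X)) (Uniqueₚ.map⁺ ℤₚ.+-injective (Uniqueₚ.upTo⁺ Y))

length-map-upTo : ∀ {B : Set} (g : ℕ → B) X → length (map g (upTo X)) ≡ X
length-map-upTo g X = trans (Listₚ.length-map g (upTo X)) (Listₚ.length-upTo X)

length-product : ∀ {A B C : Set} (g : A → B → C) xs ys → length (cartesianProductWith g xs ys) ≡ length xs * length ys
length-product g []       ys = refl
length-product g (x ∷ xs) ys = trans (Listₚ.length-++ (map (g x) ys)) (cong₂ _+_ (Listₚ.length-map (g x) ys) (length-product g xs ys))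

length-box : ∀ X Y → length (box X Y) ≡ X * Y
length-box X Y = trans (length-product _,_ (map +_ (upTo X)) (map +_ (upTo Y))) (cong₂ _*_ (length-map-upTo +_ X) (length-map-upTo +_ Y))

∈-box⁻ : ∀ X Y {p} → p ∈ box X Y → ∃₂ λ x y → x < X × y < Y × p ≡ (+ x , + y)
∈-box⁻ X Y p∈ with ∈-cartesianProduct⁻ (map +_ (upTo X)) (map +_ (upTo Y)) p∈
... | x∈ , y∈ with ∈-map⁻ +_ x∈ | ∈-map⁻ +_ y∈
... | x , x∈ , refl | y , y∈ , refl = x , y , ∈-upTo⁻ x∈ , ∈-upTo⁻ y∈ , refl

-- the code words (x , y) with - ext ≤ y ≤ top and - m ≤ x ≤ 7 l + m (and a few more)
module Code (l m ext top : ℕ) where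
  μ ν : ℕ
  -- Solving `x = 2 y + 7 k` for `k` over the given ranges of `x` and `y` leaves `k` between `- μ`
  -- and `l + μ`. The surplus `ν` over `l` is independent of `l`.
  μ = m + (2 * top + 2 * ext)
  ν = suc (μ + μ)

  point : ℕ → ℕ → Λ
  point t κ = let y = + t ℤ.- + ext in + 2 ℤ.* y ℤ.+ + 7 ℤ.* (+ κ ℤ.- + μ) , y

  code : List Λ
  code = cartesianProductWith point (upTo (suc (ext + top))) (upTo (l + ν))

  length-code : length code ≡ suc (ext + top) * (l + ν)
  length-code = trans (length-product point (upTo (suc (ext + top))) (upTo (l + ν)))
    (cong₂ _*_ (Listₚ.length-upTo (suc (ext + top))) (Listₚ.length-upTo (l + ν)))

  ∈-code : ∀ q k → In (proj₁ q) m (7 * l + m) → In (proj₂ q) ext top → proj₁ q ≡ + 2 ℤ.* proj₂ q ℤ.+ + 7 ℤ.* k → q ∈ code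
  ∈-code q@(x , y) k x∈ y∈ x≡ with in-index y∈ | in-index {a = μ} {b = l + μ} k∈
    where
    e : ∀ y k → (+ 2 ℤ.* y ℤ.+ + 7 ℤ.* k) ℤ.+ ℤ.- (y ℤ.+ y) ≡ + 7 ℤ.* k
    e = ℤ-solve-∀
    7k∈ : In (+ 7 ℤ.* k) (m + (top + top)) (7 * l + m + (ext + ext))
    7k∈ = subst (λ z → In z (m + (top + top)) (7 * l + m + (ext + ext))) (trans (cong (ℤ._+ ℤ.- (y ℤ.+ y)) x≡) (e y k)) (in-+ x∈ (in-neg (in-+ y∈ y∈)))
    le₁ : m + (top + top) ≤ μ
    le₁ = +-monoʳ-≤ m (≤-trans (≤-reflexive (cong (λ z → top + z) (sym (+-identityʳ top)))) (m≤m+n (2 * top) (2 * ext)))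
    le₂ : 7 * l + m + (ext + ext) ≤ 7 * l + μ
    le₂ = ≤-trans (≤-reflexive (+-assoc (7 * l) m (ext + ext))) (+-monoʳ-≤ (7 * l) (+-monoʳ-≤ m
      (≤-trans (≤-reflexive (cong (λ z → ext + z) (sym (+-identityʳ ext)))) (m≤n+m (2 * ext) (2 * top)))))
    k∈ : In k μ (l + μ)
    k∈ = in-/ 7 {k} {μ} {l} {μ} (in-mono le₁ le₂ 7k∈)
  ... | t , t< , y≡ | κ , κ< , k≡ = subst (_∈ code)
    (cong₂ _,_ (sym (trans x≡ (cong₂ (λ y k → + 2 ℤ.* y ℤ.+ + 7 ℤ.* k) y≡ k≡))) (sym y≡))
    (∈-cartesianProductWith⁺ point (∈-upTo⁺ t<) (∈-upTo⁺ (subst (κ <_) (lemma μ l) κ<)))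
    where
    lemma : ∀ μ l → suc (μ + (l + μ)) ≡ l + suc (μ + μ)
    lemma = solve-∀

in-abs : ∀ {i c} → In i c c → ∣ i ∣ ≤ c
in-abs {+ m}               (_ , hi) = ℤₚ.drop‿+≤+ hi
in-abs { -[1+ m ]} {suc c} (lo , _) = s≤s (ℤₚ.drop‿-≤- lo)

in-difference : ∀ {x x′ c} → x ≤ c → x′ ≤ c → In (+ x ℤ.- + x′) c c
in-difference {c = c} x≤ x′≤ = in-mono ≤-refl (≤-reflexive (+-identityʳ c)) (in-+ (in-nat x≤) (in-neg (in-nat x′≤)))

-- The patch has `7 l` columns and 25 rows; its code words need two further rows on either side. 25
-- is the least height that leaves a gain: 6 · 29 = 174 is less than 7 · 25 = 175. The gain of one
-- per unit of `l` pays for the surplus `174 ν` when `l` is `174 ν`. The argument 0 of `Code.ν` is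
-- arbitrary, as `ν` does not depend on it, and the equation `l≡` keeps `l` opaque.
module FatPatch (l : ℕ) (l≡ : l ≡ 174 * Code.ν 0 2 2 26) where

  girth : ℕ
  -- Two points of the patch differ by at most `7 l` and 24 in the two coordinates, hence by less
  -- than `girth` in `hex`.
  girth = suc (7 * l + 24)

  open Code l 2 2 26 using (code; length-code; ∈-code; ν)

  private
    cover : ∀ {p e} → p ∈ box (7 * l) 25 → Small e → ∃ λ q → q ∈ code × ∃₂ λ e′ s →
            Small e′ × (s ≡ 𝟘 ⊎ s ≡ 𝟘 ⊎ s ≡ ⊝ 𝟘) × e′ ⊕ (e ⊕ p) ≡ q ⊕ s
    cover {p} {e} p∈ small-e with ∈-box⁻ (7 * l) 25 p∈ | perfect-code (e ⊕ p)
    ... | x , y , x< , y< , refl | e′ , k , small-e′ , eq = e′ ⊕ (e ⊕ p) ,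
      ∈-code (e′ ⊕ (e ⊕ p)) k
        (in-mono ≤-refl (≤-trans (s≤s (s≤s (<⇒≤ x<))) (≤-reflexive (+-comm 2 (7 * l))))
          (in-+ (proj₁ (in-small small-e′)) (in-+ (proj₁ (in-small small-e)) (in-nat ≤-refl))))
        (in-mono ≤-refl (s≤s (s≤s (≤-pred y<)))
          (in-+ (proj₂ (in-small small-e′)) (in-+ (proj₂ (in-small small-e)) (in-nat ≤-refl)))) eq ,
      e′ , 𝟘 , small-e′ , inj₁ refl , sym (⊕-identityʳ _)

    separated : ∀ {p q} → p ∈ box (7 * l) 25 → q ∈ box (7 * l) 25 → p ≢ q → hex (q ⊕ ⊝ p) < girth ⊎ det (q ⊕ ⊝ p) 𝟘 ≢ 0ℤ
    separated p∈ q∈ _ with ∈-box⁻ (7 * l) 25 p∈ | ∈-box⁻ (7 * l) 25 q∈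
    ... | x , y , x< , y< , refl | x′ , y′ , x′< , y′< , refl = inj₁ (s≤s (⊔-lub
        (⊔-lub (≤-trans dx (m≤m+n (7 * l) 24)) (≤-trans dy (m≤n+m 24 (7 * l))))
        (≤-trans (ℤₚ.∣i+j∣≤∣i∣+∣j∣ (+ x′ ℤ.- + x) (+ y′ ℤ.- + y)) (+-mono-≤ dx dy))))
      where
      dx : ∣ + x′ ℤ.- + x ∣ ≤ 7 * l
      dx = in-abs (in-difference (<⇒≤ x′<) (<⇒≤ x<))
      dy : ∣ + y′ ℤ.- + y ∣ ≤ 24
      dy = in-abs (in-difference (≤-pred y′<) (≤-pred y<))

    density : 6 * length code ≤ length (box (7 * l) 25)
    density = subst₂ (λ a b → 6 * a ≤ b) (sym length-code) (sym (length-box (7 * l) 25))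
      (≤-reflexive (trans (cong (λ k → 6 * (29 * (k + ν))) l≡) (trans (lemma ν) (cong (λ k → 7 * k * 25) (sym l≡)))))
      where
      lemma : ∀ ν → 6 * (29 * (174 * ν + ν)) ≡ 7 * (174 * ν) * 25
      lemma = solve-∀

  fat-patch : Patch 𝟘 girth
  fat-patch = record
    { A = box (7 * l) 25 ; Q = code ; unique = box-unique (7 * l) 25
    ; nonempty = ≤-trans (≤-trans 1≤l (≤-trans (m≤n*m l 7) (m≤m*n (7 * l) 25))) (≤-reflexive (sym (length-box (7 * l) 25)))
    ; density = density ; cover = cover ; separated = separated }
    where
    1≤l : 1 ≤ l
    1≤l = subst (1 ≤_) (sym l≡) (s≤s z≤n)

-- The tube is cut open along a strip of `b` rows. The code need not match up at the seam, so one
-- row is added on either side. A gain remains as soon as 6 (b + 2) is less than 7 b, that is from b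
-- = 13 on; there it is 91 - 90 = 1, and `l` = `90 ν` suffices for all larger `b` too.
module ThinPatch (a b′ c l : ℕ) (a<b : a < suc b′) (b′≡ : b′ ≡ 12 + c)
                 (l≡ : l ≡ 90 * Code.ν 0 (3 + b′) 1 (suc b′)) where
  private
    b : ℕ
    b = suc b′

    w : Λ
    w = ℤ.- + a , + b

    open Code l (2 + b) 1 b using (code; length-code; ∈-code; ν)

    -- Translating by ± w brings the points next to the strip 0 ≤ y < b back into it.
    Folded : Λ → Set
    Folded p = ∃₂ λ x y → ∃ λ s → y < b × In x (1 + b) (1 + 7 * l + b) × (s ≡ 𝟘 ⊎ s ≡ w ⊎ s ≡ ⊝ w) × p ≡ (x , + y) ⊕ s

    inside : ∀ x y → y < b → In x 1 (1 + 7 * l) → Folded (x , + y)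
    inside x y y<b x∈ = x , y , 𝟘 , y<b , in-mono (m≤m+n 1 b) (m≤m+n (1 + 7 * l) b) x∈ , inj₁ refl , sym (⊕-identityʳ _)

    above : ∀ x → In x 1 (1 + 7 * l) → Folded (x , + b)
    above x x∈ = x ℤ.+ + a , 0 , w , s≤s z≤n , in-mono (s≤s z≤n) (+-monoʳ-≤ (1 + 7 * l) (<⇒≤ a<b)) (in-+ x∈ (in-nat ≤-refl)) ,
      inj₂ (inj₁ refl) , cong₂ _,_ (e x (+ a)) refl
      where
      e : ∀ x a → x ≡ x ℤ.+ a ℤ.+ ℤ.- a
      e = ℤ-solve-∀

    below : ∀ x → In x 1 (1 + 7 * l) → Folded (x , -1ℤ)
    below x x∈ = x ℤ.+ ℤ.- + a , b′ , ⊝ w , ≤-refl , in-mono (+-monoʳ-≤ 1 (<⇒≤ a<b)) (+-monoʳ-≤ (1 + 7 * l) z≤n) (in-+ x∈ (in-neg (in-nat ≤-refl))) ,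
      inj₂ (inj₂ refl) , cong₂ _,_ (e x (+ a)) (e′ (+ b′))
      where
      e : ∀ x a → x ≡ x ℤ.+ ℤ.- a ℤ.+ ℤ.- ℤ.- a
      e = ℤ-solve-∀
      e′ : ∀ z → -1ℤ ≡ z ℤ.+ ℤ.- (1ℤ ℤ.+ z)
      e′ = ℤ-solve-∀

    fold : ∀ x e y → In x 1 (1 + 7 * l) → In e 1 1 → y < b → Folded (x , e ℤ.+ + y)
    fold x -[1+ 0 ] zero    x∈ _ y<b = below x x∈
    fold x -[1+ 0 ] (suc y) x∈ _ y<b = inside x y (<⇒≤ y<b) x∈
    fold x (+ 0)    y       x∈ _ y<b = inside x y y<b x∈
    fold x (+ 1)    y       x∈ _ y<b with m≤n⇒m<n∨m≡n y<b
    ... | inj₁ 1+y<b = inside x (suc y) 1+y<b x∈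
    ... | inj₂ 1+y≡b = subst (λ k → Folded (x , + k)) (sym 1+y≡b) (above x x∈)
    fold x (+ suc (suc e)) y x∈ (_ , +≤+ (s≤s ())) y<b
    fold x -[1+ suc e ] y x∈ (ℤ.-≤- () , _) y<b

    cover : ∀ {p e} → p ∈ box (7 * l) b → Small e → ∃ λ q → q ∈ code × ∃₂ λ e′ s →
            Small e′ × (s ≡ 𝟘 ⊎ s ≡ w ⊎ s ≡ ⊝ w) × e′ ⊕ (e ⊕ p) ≡ q ⊕ s
    cover {p} {e} p∈ small-e with ∈-box⁻ (7 * l) b p∈
    ... | x , y , x< , y< , refl with fold (proj₁ e ℤ.+ + x) (proj₂ e) y (in-+ (proj₁ (in-small small-e)) (in-nat (<⇒≤ x<))) (proj₂ (in-small small-e)) y<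
    ...   | x′ , y′ , s , y′<b , x′∈ , s∈ , eq with perfect-code (x′ , + y′)
    ...     | e′ , k , small-e′ , eq′ = e′ ⊕ (x′ , + y′) ,
      ∈-code (e′ ⊕ (x′ , + y′)) k
        (in-mono ≤-refl (≤-reflexive (lemma (7 * l) b)) (in-+ (proj₁ (in-small small-e′)) x′∈))
        (in-mono ≤-refl y′<b (in-+ (proj₂ (in-small small-e′)) (in-nat ≤-refl))) eq′ ,
      e′ , s , small-e′ , s∈ , trans (cong (e′ ⊕_) eq) (sym (⊕-assoc e′ (x′ , + y′) s))
      where
      lemma : ∀ l b → 1 + (1 + l + b) ≡ l + (2 + b)
      lemma = solve-∀

    -- On the line through `w` the second coordinate is the largest of the three in `hex`, because
    -- `w` has this property, and it is less than `b` by the height of the strip.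
    parallel-short : ∀ t₁ t₂ → ∣ t₂ ∣ < b → det (t₁ , t₂) w ≡ 0ℤ → hex (t₁ , t₂) < b
    parallel-short t₁ t₂ t₂<b det≡0 = ≤-<-trans (⊔-lub (⊔-lub first≤ ≤-refl) sum≤) t₂<b
      where
      open ≤-Reasoning
      e₁ : ∀ t₁ t₂ a b → t₁ ℤ.* b ≡ (t₁ ℤ.* b ℤ.- t₂ ℤ.* ℤ.- a) ℤ.- a ℤ.* t₂
      e₁ = ℤ-solve-∀
      e₂ : ∀ t₁ t₂ a b → (t₁ ℤ.+ t₂) ℤ.* b ≡ (t₁ ℤ.* b ℤ.- t₂ ℤ.* ℤ.- a) ℤ.+ (b ℤ.- a) ℤ.* t₂
      e₂ = ℤ-solve-∀
      first≤ : ∣ t₁ ∣ ≤ ∣ t₂ ∣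
      first≤ = *-cancelʳ-≤ (∣ t₁ ∣) (∣ t₂ ∣) b (begin
        ∣ t₁ ∣ * b ≡⟨ ℤₚ.abs-* t₁ (+ b) ⟨
        ∣ t₁ ℤ.* + b ∣ ≡⟨ cong ∣_∣ (trans (e₁ t₁ t₂ (+ a) (+ b)) (trans (cong (ℤ._- + a ℤ.* t₂) det≡0) (ℤₚ.+-identityˡ (ℤ.- (+ a ℤ.* t₂))))) ⟩
        ∣ ℤ.- (+ a ℤ.* t₂) ∣ ≡⟨ trans (ℤₚ.∣-i∣≡∣i∣ (+ a ℤ.* t₂)) (ℤₚ.abs-* (+ a) t₂) ⟩
        a * ∣ t₂ ∣ ≤⟨ *-monoˡ-≤ (∣ t₂ ∣) (<⇒≤ a<b) ⟩
        b * ∣ t₂ ∣ ≡⟨ *-comm b (∣ t₂ ∣) ⟩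
        ∣ t₂ ∣ * b ∎)
      sum≤ : ∣ t₁ ℤ.+ t₂ ∣ ≤ ∣ t₂ ∣
      sum≤ = *-cancelʳ-≤ (∣ t₁ ℤ.+ t₂ ∣) (∣ t₂ ∣) b (begin
        ∣ t₁ ℤ.+ t₂ ∣ * b ≡⟨ ℤₚ.abs-* (t₁ ℤ.+ t₂) (+ b) ⟨
        ∣ (t₁ ℤ.+ t₂) ℤ.* + b ∣ ≡⟨ cong ∣_∣ (trans (e₂ t₁ t₂ (+ a) (+ b)) (trans (cong (ℤ._+ (+ b ℤ.- + a) ℤ.* t₂) det≡0) (ℤₚ.+-identityˡ ((+ b ℤ.- + a) ℤ.* t₂)))) ⟩
        ∣ (+ b ℤ.- + a) ℤ.* t₂ ∣ ≡⟨ ℤₚ.abs-* (+ b ℤ.- + a) t₂ ⟩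
        ∣ + b ℤ.- + a ∣ * ∣ t₂ ∣ ≤⟨ *-monoˡ-≤ (∣ t₂ ∣) (in-abs (in-difference {b} {a} {b} ≤-refl (<⇒≤ a<b))) ⟩
        b * ∣ t₂ ∣ ≡⟨ *-comm b (∣ t₂ ∣) ⟩
        ∣ t₂ ∣ * b ∎)

    separated : ∀ {p q} → p ∈ box (7 * l) b → q ∈ box (7 * l) b → p ≢ q → hex (q ⊕ ⊝ p) < b ⊎ det (q ⊕ ⊝ p) w ≢ 0ℤ
    separated {p} {q} p∈ q∈ _ with det (q ⊕ ⊝ p) w ℤ.≟ 0ℤ
    ... | no  det≢0 = inj₂ det≢0
    ... | yes det≡0 with ∈-box⁻ (7 * l) b p∈ | ∈-box⁻ (7 * l) b q∈
    ...   | x , y , x< , y< , refl | x′ , y′ , x′< , y′< , refl = inj₁ (parallel-short (+ x′ ℤ.- + x) (+ y′ ℤ.- + y)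
      (s≤s (in-abs (in-difference (≤-pred y′<) (≤-pred y<)))) det≡0)

    density : 6 * length code ≤ length (box (7 * l) b)
    density = subst₂ (λ u v → 6 * u ≤ v) (sym length-code) (sym (length-box (7 * l) b))
      (subst₂ (λ k m → 6 * (suc (suc k) * (m + ν)) ≤ 7 * m * k) (sym (cong suc b′≡)) (sym l≡) scaled)
      where
      lemma : ∀ ν c → 6 * ((15 + c) * (90 * ν + ν)) + 84 * (c * ν) ≡ 7 * (90 * ν) * (13 + c)
      lemma = solve-∀
      scaled : 6 * ((15 + c) * (90 * ν + ν)) ≤ 7 * (90 * ν) * (13 + c)
      scaled = ≤-trans (m≤m+n _ (84 * (c * ν))) (≤-reflexive (lemma ν c))

  thin-patch : Patch (ℤ.- + a , + suc b′) (suc b′)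
  thin-patch = record
    { A = box (7 * l) b ; Q = code ; unique = box-unique (7 * l) b
    ; nonempty = ≤-trans (≤-trans 1≤l (≤-trans (m≤n*m l 7) (m≤m*n (7 * l) b))) (≤-reflexive (sym (length-box (7 * l) b)))
    ; density = density ; cover = cover ; separated = separated }
    where
    1≤l : 1 ≤ l
    1≤l = subst (1 ≤_) (sym l≡) (s≤s z≤n)

-- Tubes

-- The maximal runs of `H` inside `Y`. In the absence of cycles each run has a first element, so the
-- number of starts will bound the boundary error.
module Walks {X : Set} (_≟_ : (x y : X) → Dec (x ≡ y)) (H : Perm X) (Y : List X)
  (acyclic : ∀ y d → 1 ≤ d → iter d (to H) y ≡ y → (∀ j → j < d → iter j (to H) y ∈ Y) → ⊥) where

  private
    _∈Y? : ∀ x → Dec (x ∈ Y)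
    x ∈Y? = member? _≟_ x Y

    Stays : X → ℕ → Set
    Stays x m = ∀ j → j < m → iter j (to H) x ∈ Y

    start? = λ x → ¬? (from H x ∈Y?)

  starts : List X
  starts = filter start? Y

  ∈-starts⁻ : ∀ {e} → e ∈ starts → e ∈ Y × from H e ∉ Y
  ∈-starts⁻ = ∈-filter⁻ start? {xs = Y}

  private
    run : ℕ → X → ℕ
    run zero       x = 0
    run (suc fuel) x with x ∈Y?
    ... | yes _ = suc (run fuel (to H x))
    ... | no  _ = 0

  -- The length of `Y` is enough fuel: a run repeats no element, so it cannot be longer than `Y`.
  len : X → ℕ
  len = run (length Y)

  private
    run-stays : ∀ fuel x → Stays x (run fuel x)
    run-stays (suc fuel) x j j<len with x ∈Y?
    run-stays (suc fuel) x zero    j<len       | yes x∈Y = x∈Y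
    run-stays (suc fuel) x (suc j) (s≤s j<len) | yes x∈Y = subst (_∈ Y) (sym (iter-out j (to H) x)) (run-stays fuel (to H x) j j<len)

    run-long : ∀ fuel x j → j < fuel → Stays x (suc j) → j < run fuel x
    run-long (suc fuel) x j j<fuel stays with x ∈Y?
    run-long (suc fuel) x zero    _ stays | yes _ = s≤s z≤n
    run-long (suc fuel) x (suc j) (s≤s j<fuel) stays | yes _ =
      s≤s (run-long fuel (to H x) j j<fuel λ k k<1+j → subst (_∈ Y) (iter-out k (to H) x) (stays (suc k) (s≤s k<1+j)))
    run-long (suc fuel) x j _ stays | no x∉Y = ⊥-elim (x∉Y (stays 0 (s≤s z≤n)))

    stays-acyclic : ∀ {x m i j} → Stays x m → i < j → j < m → iter i (to H) x ≡ iter j (to H) x → ⊥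
    stays-acyclic {x} {i = i} stays i<j j<m eq with iter-return H x i<j eq
    ... | d , 1≤d , refl , cycle = acyclic x d 1≤d cycle λ k k<d → stays k (<-trans (<-≤-trans k<d (m≤n+m d i)) j<m)

    stays-injective : ∀ {x m i j} → Stays x m → i < m → j < m → iter i (to H) x ≡ iter j (to H) x → i ≡ j
    stays-injective {x} {m} {i} {j} stays i<m j<m eq with <-cmp i j
    ... | tri≈ _ i≡j _ = i≡j
    ... | tri< i<j _ _ = ⊥-elim (stays-acyclic stays i<j j<m eq)
    ... | tri> _ _ j<i = ⊥-elim (stays-acyclic stays j<i i<m (sym eq))

    stays-short : ∀ {x m} → Stays x m → m ≤ length Y
    stays-short {x} {m} stays = subst (_≤ length Y) (trans (Listₚ.length-map _ (upTo m)) (Listₚ.length-upTo m))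
      (length-⊆ (unique-map (λ j → iter j (to H) x) (Uniqueₚ.upTo⁺ m) λ i∈ j∈ → stays-injective stays (∈-upTo⁻ i∈) (∈-upTo⁻ j∈)) sub)
      where
      sub : map (λ j → iter j (to H) x) (upTo m) ⊆ Y
      sub y∈ with ∈-map⁻ (λ j → iter j (to H) x) y∈
      ... | j , j∈ , refl = stays j (∈-upTo⁻ j∈)

    -- Steps back until `Y` is left. Running out of fuel would mean a run longer than `Y`.
    rewind : ∀ fuel x k → fuel + k ≡ length Y → Stays x (suc k) → ∃₂ λ e j → e ∈ starts × Stays e (suc j) × iter j (to H) e ≡ iter k (to H) x
    rewind zero x k k≡ stays = ⊥-elim (<-irrefl k≡ (stays-short stays))
    rewind (suc fuel) x k k≡ stays with from H x ∈Y?
    ... | no  x⁻∉Y = x , k , ∈-filter⁺ start? (stays 0 (s≤s z≤n)) x⁻∉Y , stays , refl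
    ... | yes x⁻∈Y with rewind fuel (from H x) (suc k) (trans (+-suc fuel k) k≡) stays′
      where
      stays′ : Stays (from H x) (suc (suc k))
      stays′ zero    _ = x⁻∈Y
      stays′ (suc j) (s≤s j<) = subst (_∈ Y) (sym (trans (iter-out j (to H) (from H x)) (cong (iter j (to H)) (to-from H x)))) (stays j j<)
    ...   | e , j , e∈ , stays″ , eq = e , j , e∈ , stays″ , trans eq (trans (iter-out k (to H) (from H x)) (cong (iter k (to H)) (to-from H x)))

  walk : X → List X
  walk e = map (λ j → iter j (to H) e) (upTo (len e))

  walk-stays : ∀ e j → j < len e → iter j (to H) e ∈ Y
  walk-stays e = run-stays (length Y) e

  walks-cover : Y ⊆ concatMap walk starts
  walks-cover {y} y∈ with rewind (length Y) y 0 (+-identityʳ _) (λ where zero _ → y∈; (suc _) (s≤s ()))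
  ... | e , j , e∈ , stays , refl = ∈-concatMap⁺ walk (Any.map (λ where refl → ∈-map⁺ (λ j → iter j (to H) e) (∈-upTo⁺ (run-long (length Y) e j (stays-short stays) stays))) e∈)

  module _ (unique : Unique Y) where

    private
      -- Both walks are traced back in step from the common element. The one that arrives at its
      -- start first has no predecessor in `Y`, so the other must be at its start as well.
      meet : ∀ {e e′} i j → e ∈ starts → i ≤ j → j < len e′ → iter i (to H) e ≡ iter j (to H) e′ → e ≡ e′
      meet zero zero    _  _ _ eq = eq
      meet {e} {e′} zero (suc j) e∈ _ j<len eq = ⊥-elim (proj₂ (∈-starts⁻ e∈)
        (subst (_∈ Y) (trans (sym (from-to H (iter j (to H) e′))) (cong (from H) (sym eq))) (walk-stays e′ j (<-trans (n<1+n j) j<len))))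
      meet (suc i) (suc j) e∈ (s≤s i≤j) j<len eq = meet i j e∈ i≤j (<-trans (n<1+n j) j<len) (to-injective H eq)

    walks-unique : Unique (concatMap walk starts)
    walks-unique = unique-concatMap walk (Uniqueₚ.filter⁺ start? unique)
      (λ {e} _ → unique-map (λ j → iter j (to H) e) (Uniqueₚ.upTo⁺ (len e))
        (λ i∈ j∈ → stays-injective (walk-stays e) (∈-upTo⁻ i∈) (∈-upTo⁻ j∈)))
      disjoint
      where
      disjoint : ∀ {e e′ z} → e ∈ starts → e′ ∈ starts → z ∈ walk e → z ∈ walk e′ → e ≡ e′
      disjoint {e} {e′} e∈ e′∈ z∈ z∈′ with ∈-map⁻ (λ j → iter j (to H) e) z∈ | ∈-map⁻ (λ j → iter j (to H) e′) z∈′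
      ... | i , i∈ , refl | j , j∈ , eq with ≤-total i j
      ...   | inj₁ i≤j = meet i j e∈ i≤j (∈-upTo⁻ j∈) eq
      ...   | inj₂ j≤i = sym (meet j i e′∈ j≤i (∈-upTo⁻ i∈) (sym eq))

    total-len : total len starts ≤ length Y
    total-len = begin
      total len starts ≡⟨ total-cong starts ⟩
      total (total (λ _ → 1) ∘ walk) starts ≡⟨ total-concatMap (λ _ → 1) walk starts ⟨
      total (λ _ → 1) (concatMap walk starts) ≡⟨ length≡total (concatMap walk starts) ⟨
      length (concatMap walk starts) ≤⟨ length-⊆ walks-unique sub ⟩
      length Y ∎
      where
      open ≤-Reasoning
      total-cong : ∀ es → total len es ≡ total (total (λ _ → 1) ∘ walk) es
      total-cong []       = refl
      total-cong (e ∷ es) = cong₂ _+_ (trans (sym (trans (Listₚ.length-map _ (upTo (len e))) (Listₚ.length-upTo (len e)))) (length≡total (walk e))) (total-cong es)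
      sub : concatMap walk starts ⊆ Y
      sub z∈ with find (∈-concatMap⁻ walk {xs = starts} z∈)
      ... | e , e∈ , z∈walk with ∈-map⁻ (λ j → iter j (to H) e) z∈walk
      ...   | j , j∈ , refl = walk-stays e j (∈-upTo⁻ j∈)

-- Powers of a permutation at a periodic point

module _ {X : Set} (p : Perm X) where

  pow-period : ∀ d x → iter d (to p) x ≡ x → ∀ q → pow p (q ℤ.* + d) x ≡ x
  pow-period d x fix = ℤ-ind (λ q → pow p (q ℤ.* + d) x ≡ x) refl
    (λ q ih → trans (cong (λ k → pow p k x) (ℤₚ.suc-* q (+ d))) (trans (pow-+ p (+ d) (q ℤ.* + d) x) (trans (cong (pow p (+ d)) ih) fix)))
    (λ q ih → trans (cong (λ k → pow p k x) (pred-* q (+ d))) (trans (pow-+ p (ℤ.- + d) (q ℤ.* + d) x)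
      (trans (cong (pow p (ℤ.- + d)) (trans ih (sym fix))) (from-to (pow-perm p (+ d)) x))))
    where
    pred-* : ∀ q d → ℤ.pred q ℤ.* d ≡ ℤ.- d ℤ.+ q ℤ.* d
    pred-* = lemma
      where
      lemma : ∀ q d → (-1ℤ ℤ.+ q) ℤ.* d ≡ ℤ.- d ℤ.+ q ℤ.* d
      lemma = ℤ-solve-∀

  pow-shift : ∀ d x → iter d (to p) x ≡ x → ∀ i q → pow p (i ℤ.+ q ℤ.* + d) x ≡ pow p i x
  pow-shift d x fix i q = trans (pow-+ p i (q ℤ.* + d) x) (cong (pow p i) (pow-period d x fix q))

  pow-mod : ∀ d .{{_ : NonZero d}} x → iter d (to p) x ≡ x → ∀ k → pow p k x ≡ iter (k DM.%ℕ d) (to p) x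
  pow-mod d x fix k = trans (cong (λ k → pow p k x) (DM.a≡a%ℕn+[a/ℕn]*n k d)) (pow-shift d x fix (+ (k DM.%ℕ d)) (k DM./ℕ d))

·-⊕ : ∀ a b p → (a ℤ.+ b) · p ≡ a · p ⊕ b · p
·-⊕ a b (i , j) = cong₂ _,_ (ℤₚ.*-distribʳ-+ i a b) (ℤₚ.*-distribʳ-+ j a b)

·-⊝ : ∀ a p → (ℤ.- a) · p ≡ ⊝ (a · p)
·-⊝ a (i , j) = cong₂ _,_ (sym (ℤₚ.neg-distribˡ-* a i)) (sym (ℤₚ.neg-distribˡ-* a j))

-- A lattice tube Λ / w with w = g u and Λ = ℤ h ⊕ ℤ u, together with a dominating set of density at most 1/6
-- whose elements are the points j h + i u with (j mod N , i mod g) in the motif.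
record Tube (w : Λ) (b : ℕ) : Set where
  field
    h u : Λ
    g N : ℕ
    motif : List (ℕ × ℕ)
    .{{g≢0}} : NonZero g
    .{{N≢0}} : NonZero N
    w≡       : w ≡ + g · u
    basis    : det h u ≡ 1ℤ
    short    : ∀ i → 1 ≤ i → i < g → hex (+ i · u) < b × + i · u ≢ 𝟘
    twisted  : ∀ (m : Fin 6) → m ≢ 0F → m ≢ 3F → det w (iter (toℕ m) ω w) ≢ 0ℤ
    density  : 6 * length motif ≤ N * g
    inRange  : ∀ {j i} → (j , i) ∈ motif → j < N × i < g
    covered  : ∀ j i → j < N → i < g → ∃ λ e → Small e × ∃₂ λ j′ i′ → (j′ , i′) ∈ motif × ∃₂ λ k l →
               + j ℤ.+ det e u ≡ + j′ ℤ.+ k ℤ.* + N × + i ℤ.+ det h e ≡ + i′ ℤ.+ l ℤ.* + g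

module TubeWalk {w : Λ} {b : ℕ} (tube : Tube w b) (G : Triangulation) where
  open Tube tube
  open Darts G

  -- `H` moves along the tube and `U` around it. What the counting uses of the geometry enters as
  -- hypotheses: rings are closed and embedded, walks along the tube do not close up, and steps are
  -- read in the coordinates of the basis `h`, `u`.
  module Density (c : ℕ)
    (coord≤ : ∀ {e} → Small e → ∣ det e u ∣ ≤ c × ∣ det h e ∣ ≤ c)
    (det-⊕ˡ : ∀ e e′ → det (e ⊕ e′) u ≡ det e u ℤ.+ det e′ u)
    (det-⊕ʳ : ∀ e e′ → det h (e ⊕ e′) ≡ det h e ℤ.+ det h e′)
    (D : List V) (min : Minimum R D)
    (H U : Perm Dart) (Y : List Dart) (unique : Unique Y)
    (acyclic : ∀ y d → 1 ≤ d → iter d (to H) y ≡ y → (∀ j → j < d → iter j (to H) y ∈ Y) → ⊥)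
    (U∈Y : ∀ k {x} → x ∈ Y → pow U k x ∈ Y)
    (HU : ∀ k {z} → z ∈ Y → to H (pow U k z) ≡ pow U k (to H z))
    (meet : ∀ d y i i′ → (∀ j → j ≤ d → iter j (to H) y ∈ Y) → i < g →
            vert (iter i (to U) y) ≡ vert (iter i′ (to U) (iter d (to H) y)) → iter i (to U) y ≡ iter i′ (to U) (iter d (to H) y))
    (ring-injective : ∀ {y i i′} → y ∈ Y → i < g → i′ < g → iter i (to U) y ≡ iter i′ (to U) y → i ≡ i′)
    (reachable : ∀ {z i v} → z ∈ Y → i < g → Near R (vert (iter i (to U) z)) v → ∃ λ e₁ → Small e₁ ×
       (∀ e₂ i′ l → Small e₂ → + i ℤ.+ det h (e₂ ⊕ e₁) ≡ + i′ ℤ.+ l ℤ.* + g →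
          Near R (vert (iter i′ (to U) (pow H (det (e₂ ⊕ e₁) u) z))) v)) where

    open Walks _≟ᵈ_ H Y acyclic public
    open Exchange R D min
    open Indicator D

    -- The overshoot of the pattern at an end of a walk, in blocks of `N` rows: two steps of at most
    -- `c` rows each, and `N` for rounding.
    B : ℕ
    B = c + c + N

    ring-total : Dart → ℕ
    ring-total y = total (λ i → χᵥ (vert (iter i (to U) y))) (upTo g)

    module _ {e : Dart} (e∈ : e ∈ starts) where
      private
        L : ℕ
        L = len e / N

        stays : ∀ j → j < len e → iter j (to H) e ∈ Y
        stays = walk-stays e

        at : ℕ × ℕ → Dart
        at (j , i) = iter i (to U) (iter j (to H) e)

        cells : List (ℕ × ℕ)
        cells = cartesianProduct (upTo (len e)) (upTo g)

        ∈-cells⁻ : ∀ {j i} → (j , i) ∈ cells → j < len e × i < g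
        ∈-cells⁻ ji∈ with ∈-cartesianProduct⁻ (upTo (len e)) (upTo g) ji∈
        ... | j∈ , i∈ = ∈-upTo⁻ j∈ , ∈-upTo⁻ i∈

        -- A point of the motif in block `κ - B`, so blocks before the start occur too. They may lie
        -- outside `Y`, but `H` is a permutation of all darts.
        target : ℕ → ℕ × ℕ → V
        target κ (j , i) = vert (iter i (to U) (pow H (+ j ℤ.+ (+ κ ℤ.- + B) ℤ.* + N) e))

        targets : List V
        targets = cartesianProductWith target (upTo (suc (B + (L + B)))) motif

        pull-back : ∀ j d k → j < len e → iter d (to H) (iter j (to H) e) ≡ pow U k (iter j (to H) e) → iter d (to H) e ≡ pow U k e
        pull-back zero    d k _  eq = eq
        pull-back (suc j) d k j< eq = pull-back j d k j<′ (to-injective H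
          (trans (iter-out d (to H) x) (trans eq (sym (HU k (stays j j<′))))))
          where
          x = iter j (to H) e
          j<′ = <-trans (n<1+n j) j<

        -- If the walk met one of its earlier rings, some power of `H` would act on its start `e` as
        -- a power of `U`. The predecessor of `e` would then be a rotated copy of a dart of the
        -- walk, hence in `Y`, against the choice of `e`.
        apart : ∀ {j j′ i i′} → j < j′ → j′ < len e → i < g → vert (at (j , i)) ≡ vert (at (j′ , i′)) → ⊥
        apart {j} {j′} {i} {i′} j<j′ j′< i<g same = proj₂ (∈-starts⁻ e∈) (subst (_∈ Y) start⁻ (U∈Y (ℤ.- k) z∈))
          where
          open ≡-Reasoning
          y = iter j (to H) e
          d = j′ ℕ.∸ suc j
          split : suc d + j ≡ j′
          split = trans (cong suc (+-comm d j)) (m+[n∸m]≡n j<j′)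
          j′<′ : suc (d + j) < len e
          j′<′ = subst (_< len e) (sym split) j′<
          y′≡ : iter (suc d) (to H) y ≡ iter j′ (to H) e
          y′≡ = trans (sym (iter-+ (suc d) j (to H) e)) (cong (λ m → iter m (to H) e) split)
          k = ℤ.- + i′ ℤ.+ + i
          met : iter i (to U) y ≡ iter i′ (to U) (iter (suc d) (to H) y)
          met = meet (suc d) y i i′ (λ m m≤ → subst (_∈ Y) (iter-+ m j (to H) e) (stays (m + j) (≤-<-trans (+-monoˡ-≤ j m≤) j′<′))) i<g
            (trans same (cong (vert ∘ iter i′ (to U)) (sym y′≡)))
          turn : iter (suc d) (to H) y ≡ pow U k y
          turn = begin
            iter (suc d) (to H) y ≡⟨ from-to (pow-perm U (+ i′)) _ ⟨
            pow U (ℤ.- + i′) (iter i′ (to U) (iter (suc d) (to H) y)) ≡⟨ cong (pow U (ℤ.- + i′)) met ⟨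
            pow U (ℤ.- + i′) (pow U (+ i) y) ≡⟨ pow-+ U (ℤ.- + i′) (+ i) y ⟨
            pow U k y ∎
          z = iter d (to H) e
          z∈ : z ∈ Y
          z∈ = stays d (≤-<-trans (≤-trans (m≤m+n d j) (n≤1+n (d + j))) j′<′)
          start⁻ : pow U (ℤ.- k) z ≡ from H e
          start⁻ = to-injective H (begin
            to H (pow U (ℤ.- k) z) ≡⟨ HU (ℤ.- k) z∈ ⟩
            pow U (ℤ.- k) (to H z) ≡⟨ cong (pow U (ℤ.- k)) (pull-back j (suc d) k (<-trans j<j′ j′<) turn) ⟩
            pow U (ℤ.- k) (pow U k e) ≡⟨ from-to (pow-perm U k) e ⟩
            e ≡⟨ to-from H e ⟨
            to H (from H e) ∎)

        cells-injective : ∀ {p q} → p ∈ cells → q ∈ cells → vert (at p) ≡ vert (at q) → p ≡ q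
        cells-injective {j , i} {j′ , i′} p∈ q∈ same with ∈-cells⁻ p∈ | ∈-cells⁻ q∈ | <-cmp j j′
        ... | j< , i< | j′< , i′< | tri< j<j′ _ _ = ⊥-elim (apart {j} {j′} {i} {i′} j<j′ j′< i< same)
        ... | j< , i< | j′< , i′< | tri> _ _ j′<j = ⊥-elim (apart {j′} {j} {i′} {i} j′<j j< i′< (sym same))
        ... | j< , i< | j′< , i′< | tri≈ _ refl _ = cong (j ,_) (ring-injective (stays j j<) i< i′<
          (meet 0 (iter j (to H) e) i i′ (λ where zero _ → stays j j<) i< same))

        abs-in : ∀ {i m} → ∣ i ∣ ≤ m → In i m m
        abs-in {+ i}      i≤m = ℤₚ.≤-trans (ℤₚ.neg-mono-≤ (+≤+ z≤n)) (+≤+ z≤n) , +≤+ i≤m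
        abs-in { -[1+ i ]} {suc m} (s≤s i≤m) = ℤ.-≤- i≤m , -≤+

        lift : ∀ M .{{_ : NonZero M}} a e b k → + (a DM.%ℕ M) ℤ.+ e ≡ b ℤ.+ k ℤ.* + M → a ℤ.+ e ≡ b ℤ.+ (k ℤ.+ a DM./ℕ M) ℤ.* + M
        lift M a e b k eq = begin
          a ℤ.+ e ≡⟨ cong (ℤ._+ e) (DM.a≡a%ℕn+[a/ℕn]*n a M) ⟩
          + (a DM.%ℕ M) ℤ.+ (a DM./ℕ M) ℤ.* + M ℤ.+ e ≡⟨ e₁ (+ (a DM.%ℕ M)) (a DM./ℕ M) (+ M) e ⟩
          (+ (a DM.%ℕ M) ℤ.+ e) ℤ.+ (a DM./ℕ M) ℤ.* + M ≡⟨ cong (ℤ._+ (a DM./ℕ M) ℤ.* + M) eq ⟩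
          b ℤ.+ k ℤ.* + M ℤ.+ (a DM./ℕ M) ℤ.* + M ≡⟨ e₂ b k (a DM./ℕ M) (+ M) ⟩
          b ℤ.+ (k ℤ.+ a DM./ℕ M) ℤ.* + M ∎
          where
          open ≡-Reasoning
          e₁ : ∀ r q M e → r ℤ.+ q ℤ.* M ℤ.+ e ≡ (r ℤ.+ e) ℤ.+ q ℤ.* M
          e₁ = ℤ-solve-∀
          e₂ : ∀ b k q M → b ℤ.+ k ℤ.* M ℤ.+ q ℤ.* M ≡ b ℤ.+ (k ℤ.+ q) ℤ.* M
          e₂ = ℤ-solve-∀

        block-bound : ∀ {j j′} α k → j < len e → j′ < N → ∣ α ∣ ≤ c + c → α ℤ.+ + j ≡ + j′ ℤ.+ k ℤ.* + N → In k B (L + B)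
        block-bound {j} {j′} α k j< j′< α≤ eq = in-/ N {k} {B} {L} {B} (in-mono ≤-refl upper
          (subst (λ z → In z (c + c + N) (c + c + len e)) (trans (cong (ℤ._- + j′) eq) (e₁ (+ j′) k (+ N)))
            (in-mono (≤-reflexive (cong (λ z → z + N) (+-identityʳ (c + c)))) (≤-reflexive (+-identityʳ _))
              (in-+ (in-+ (abs-in {α} α≤) (in-nat (<⇒≤ j<))) (in-neg (in-nat (<⇒≤ j′<)))))))
          where
          e₁ : ∀ j k N → (j ℤ.+ k ℤ.* N) ℤ.- j ≡ N ℤ.* k
          e₁ = ℤ-solve-∀
          upper : c + c + len e ≤ N * L + B
          upper = begin
            c + c + len e ≡⟨ cong (λ z → c + c + z) (m≡m%n+[m/n]*n (len e) N) ⟩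
            c + c + (len e % N + L * N) ≤⟨ +-monoʳ-≤ (c + c) (+-monoˡ-≤ (L * N) (<⇒≤ (m%n<n (len e) N))) ⟩
            c + c + (N + L * N) ≡⟨ lemma c N L ⟩
            N * L + (c + c + N) ∎
            where
            open ≤-Reasoning
            lemma : ∀ c N L → c + c + (N + L * N) ≡ N * L + (c + c + N)
            lemma = solve-∀

        target-∈ : ∀ {j e₁ e₂ j′ i′} k → j < len e → Small e₁ → Small e₂ → (j′ , i′) ∈ motif →
                   + j ℤ.+ det e₁ u ℤ.+ det e₂ u ≡ + j′ ℤ.+ k ℤ.* + N →
                   vert (iter i′ (to U) (pow H (det (e₂ ⊕ e₁) u) (iter j (to H) e))) ∈ targets
        target-∈ {j} {e₁} {e₂} {j′} {i′} k j< small₁ small₂ p∈ eq with in-index (block-bound α k j< (proj₁ (inRange p∈)) α≤ J≡)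
          where
          α = det (e₂ ⊕ e₁) u
          α≤ : ∣ α ∣ ≤ c + c
          α≤ = ≤-trans (≤-reflexive (cong ∣_∣ (det-⊕ˡ e₂ e₁))) (≤-trans (ℤₚ.∣i+j∣≤∣i∣+∣j∣ (det e₂ u) (det e₁ u))
                 (+-mono-≤ (proj₁ (coord≤ small₂)) (proj₁ (coord≤ small₁))))
          rearrange : ∀ a b j → a ℤ.+ b ℤ.+ j ≡ j ℤ.+ b ℤ.+ a
          rearrange = ℤ-solve-∀
          J≡ : α ℤ.+ + j ≡ + j′ ℤ.+ k ℤ.* + N
          J≡ = trans (cong (ℤ._+ + j) (det-⊕ˡ e₂ e₁)) (trans (rearrange (det e₂ u) (det e₁ u) (+ j)) eq)
        ... | κ , κ< , k≡ = subst (λ x → vert (iter i′ (to U) x) ∈ targets) pow≡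
                (∈-cartesianProductWith⁺ target (∈-upTo⁺ κ<) p∈)
          where
          rearrange : ∀ a b j → a ℤ.+ b ℤ.+ j ≡ j ℤ.+ b ℤ.+ a
          rearrange = ℤ-solve-∀
          pow≡ : pow H (+ j′ ℤ.+ (+ κ ℤ.- + B) ℤ.* + N) e ≡ pow H (det (e₂ ⊕ e₁) u) (iter j (to H) e)
          pow≡ = trans (cong (λ z → pow H z e) (trans (cong (λ z → + j′ ℤ.+ z ℤ.* + N) (sym k≡))
            (sym (trans (cong (ℤ._+ + j) (det-⊕ˡ e₂ e₁)) (trans (rearrange (det e₂ u) (det e₁ u) (+ j)) eq)))))
            (pow-+ H (det (e₂ ⊕ e₁) u) (+ j) e)

        -- One step `e₁` leads from a cell to `v`, and a second step `e₂` from there to the periodic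
        -- pattern. The two are taken together, so that coordinates are computed only from a dart of
        -- `Y`.
        cover : ∀ {a v} → a ∈ map (vert ∘ at) cells → Near R a v → ∃ λ q → q ∈ targets × Near R q v
        cover {a} {v} a∈ near = cover-cell (∈-map⁻ (vert ∘ at) a∈)
          where
          cover-cell : (∃ λ p → p ∈ cells × a ≡ vert (at p)) → ∃ λ q → q ∈ targets × Near R q v
          cover-cell ((j , i) , ji∈ , refl) =
            let (j< , i<) = ∈-cells⁻ ji∈
                (e₁ , small₁ , near₂) = reachable (stays j j<) i< near
                J₁ = + j ℤ.+ det e₁ u
                K₁ = + i ℤ.+ det h e₁
                (e₂ , small₂ , j′ , i′ , p∈ , k , l , J≡ , K≡) = covered (J₁ DM.%ℕ N) (K₁ DM.%ℕ g) (DM.n%ℕd<d J₁ N) (DM.n%ℕd<d K₁ g)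
                K₂≡ = trans (cong (λ z → + i ℤ.+ z) (trans (det-⊕ʳ e₂ e₁) (ℤₚ.+-comm (det h e₂) (det h e₁))))
                        (trans (sym (ℤₚ.+-assoc (+ i) (det h e₁) (det h e₂))) (lift g K₁ (det h e₂) (+ i′) l K≡))
            in vert (iter i′ (to U) (pow H (det (e₂ ⊕ e₁) u) (iter j (to H) e))) ,
               target-∈ {j} {e₁} {e₂} {j′} {i′} (k ℤ.+ J₁ DM./ℕ N) j< small₁ small₂ p∈ (lift N J₁ (det e₂ u) (+ j′) k J≡) ,
               near₂ e₂ i′ (l ℤ.+ K₁ DM./ℕ g) small₂ K₂≡

      walk-exchange : total ring-total (walk e) ≤ suc (B + (L + B)) * length motif
      walk-exchange = begin
        total ring-total (walk e) ≡⟨ total-map ring-total (λ j → iter j (to H) e) (upTo (len e)) ⟩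
        total (λ j → total (λ i → χᵥ (vert (at (j , i)))) (upTo g)) (upTo (len e)) ≡⟨ total-product (χᵥ ∘ vert ∘ at) (upTo (len e)) (upTo g) ⟨
        total (χᵥ ∘ vert ∘ at) cells ≡⟨ total-map χᵥ (vert ∘ at) cells ⟨
        total χᵥ (map (vert ∘ at) cells) ≤⟨ exchange (map (vert ∘ at) cells) targets (unique-map (vert ∘ at) (Uniqueₚ.cartesianProduct⁺ (Uniqueₚ.upTo⁺ (len e)) (Uniqueₚ.upTo⁺ g)) cells-injective) cover ⟩
        length targets ≡⟨ length-product target (upTo (suc (B + (L + B)))) motif ⟩
        length (upTo (suc (B + (L + B)))) * length motif ≡⟨ cong (_* length motif) (Listₚ.length-upTo (suc (B + (L + B)))) ⟩
        suc (B + (L + B)) * length motif ∎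
        where
        open ≤-Reasoning
        total-product : ∀ {A B : Set} (F : A × B → ℕ) xs ys → total F (cartesianProduct xs ys) ≡ total (λ x → total (λ y → F (x , y)) ys) xs
        total-product F []       ys = refl
        total-product F (x ∷ xs) ys = trans (total-++ F (map (x ,_) ys) (cartesianProduct xs ys))
          (cong₂ _+_ (total-map F (x ,_) ys) (total-product F xs ys))

      walk-density : 6 * total ring-total (walk e) ≤ g * len e + g * (N * suc (B + B))
      walk-density = begin
        6 * total ring-total (walk e) ≤⟨ *-monoʳ-≤ 6 walk-exchange ⟩
        6 * (suc (B + (L + B)) * length motif) ≡⟨ e₁ (suc (B + (L + B))) (length motif) ⟩
        suc (B + (L + B)) * (6 * length motif) ≤⟨ *-monoʳ-≤ (suc (B + (L + B))) density ⟩
        suc (B + (L + B)) * (N * g) ≡⟨ e₂ B L N g ⟩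
        g * (L * N) + g * (N * suc (B + B)) ≤⟨ +-monoˡ-≤ (g * (N * suc (B + B))) (*-monoʳ-≤ g (m/n*n≤m (len e) N)) ⟩
        g * len e + g * (N * suc (B + B)) ∎
        where
        open ≤-Reasoning
        e₁ : ∀ a b → 6 * (a * b) ≡ a * (6 * b)
        e₁ = solve-∀
        e₂ : ∀ B L N g → suc (B + (L + B)) * (N * g) ≡ g * (L * N) + g * (N * suc (B + B))
        e₂ = solve-∀

    private
      rotate-ring : ∀ i → total (χᵥ ∘ vert) Y ≤ total (χᵥ ∘ vert ∘ iter i (to U)) Y
      rotate-ring i = ≤-trans (total-⊆ (χᵥ ∘ vert) unique sub) (≤-reflexive (total-map (χᵥ ∘ vert) (iter i (to U)) Y))
        where
        sub : Y ⊆ map (iter i (to U)) Y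
        sub {y} y∈ = subst (_∈ map (iter i (to U)) Y) (to-from (pow-perm U (+ i)) y) (∈-map⁺ (iter i (to U)) (U∈Y (ℤ.- + i) y∈))

    -- The `g` darts of a ring all lie in `Y`, so the same rings are met by several walks. Giving
    -- every dart the weight of its whole ring and dividing by `g` at the end avoids choosing
    -- representatives.
    tube-density : 6 * total (χᵥ ∘ vert) Y ≤ length Y + length starts * (N * suc (B + B))
    tube-density = *-cancelˡ-≤ g (begin
      g * (6 * d) ≡⟨ e₁ g d ⟩
      6 * (g * d) ≡⟨ cong (λ k → 6 * (k * d)) (Listₚ.length-upTo g) ⟨
      6 * (length (upTo g) * d) ≡⟨ cong (6 *_) (total-const d (upTo g)) ⟨
      6 * total (λ _ → d) (upTo g) ≤⟨ *-monoʳ-≤ 6 (total-mono (upTo g) (λ {i} _ → rotate-ring i)) ⟩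
      6 * total (λ i → total (χᵥ ∘ vert ∘ iter i (to U)) Y) (upTo g) ≡⟨ cong (6 *_) (total-swap (λ i y → χᵥ (vert (iter i (to U) y))) (upTo g) Y) ⟩
      6 * total ring-total Y ≤⟨ *-monoʳ-≤ 6 (total-⊆ ring-total unique walks-cover) ⟩
      6 * total ring-total (concatMap walk starts) ≡⟨ cong (6 *_) (total-concatMap ring-total walk starts) ⟩
      6 * total (total ring-total ∘ walk) starts ≡⟨ total-* 6 (total ring-total ∘ walk) starts ⟨
      total (λ e → 6 * total ring-total (walk e)) starts ≤⟨ total-mono starts walk-density ⟩
      total (λ e → g * len e + g * M) starts ≡⟨ trans (total-+ (λ e → g * len e) (λ _ → g * M) starts) (cong₂ _+_ (total-* g len starts) (total-const (g * M) starts)) ⟩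
      g * total len starts + length starts * (g * M) ≤⟨ +-monoˡ-≤ (length starts * (g * M)) (*-monoʳ-≤ g (total-len unique)) ⟩
      g * length Y + length starts * (g * M) ≡⟨ e₂ g (length Y) (length starts) M ⟩
      g * (length Y + length starts * M) ∎)
      where
      open ≤-Reasoning
      d = total (χᵥ ∘ vert) Y
      M = N * suc (B + B)
      e₁ : ∀ g d → g * (6 * d) ≡ 6 * (g * d)
      e₁ = solve-∀
      e₂ : ∀ g y s m → g * y + s * (g * m) ≡ g * (y + s * m)
      e₂ = solve-∀
      total-* : ∀ {A : Set} k (F : A → ℕ) xs → total (λ x → k * F x) xs ≡ k * total F xs
      total-* k F []       = sym (*-zeroʳ k)
      total-* k F (x ∷ xs) = trans (cong (λ z → k * F x + z) (total-* k F xs)) (sym (*-distribˡ-+ k (F x) (total F xs)))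

-- The geometry of darts on a tube

module _ {w : Λ} {b : ℕ} (tube : Tube w b) where
  open Tube tube

  private
    cramer : ∀ e → e ≡ det e u · h ⊕ det h e · u
    cramer e@(e₁ , e₂) = cong₂ _,_ (trans (sym (trans (cong (ℤ._* e₁) basis) (ℤₚ.*-identityˡ e₁))) (lemma₁ (proj₁ h) (proj₂ h) (proj₁ u) (proj₂ u) e₁ e₂))
                                   (trans (sym (trans (cong (ℤ._* e₂) basis) (ℤₚ.*-identityˡ e₂))) (lemma₂ (proj₁ h) (proj₂ h) (proj₁ u) (proj₂ u) e₁ e₂))
      where
      lemma₁ : ∀ h₁ h₂ u₁ u₂ e₁ e₂ → (h₁ ℤ.* u₂ ℤ.- h₂ ℤ.* u₁) ℤ.* e₁ ≡ (e₁ ℤ.* u₂ ℤ.- e₂ ℤ.* u₁) ℤ.* h₁ ℤ.+ (h₁ ℤ.* e₂ ℤ.- h₂ ℤ.* e₁) ℤ.* u₁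
      lemma₁ = ℤ-solve-∀
      lemma₂ : ∀ h₁ h₂ u₁ u₂ e₁ e₂ → (h₁ ℤ.* u₂ ℤ.- h₂ ℤ.* u₁) ℤ.* e₂ ≡ (e₁ ℤ.* u₂ ℤ.- e₂ ℤ.* u₁) ℤ.* h₂ ℤ.+ (h₁ ℤ.* e₂ ℤ.- h₂ ℤ.* e₁) ℤ.* u₂
      lemma₂ = ℤ-solve-∀

    det-⊕ˡ : ∀ e e′ → det (e ⊕ e′) u ≡ det e u ℤ.+ det e′ u
    det-⊕ˡ (a , b) (c , d) = lemma a b c d (proj₁ u) (proj₂ u)
      where
      lemma : ∀ a b c d x y → (a ℤ.+ c) ℤ.* y ℤ.- (b ℤ.+ d) ℤ.* x ≡ (a ℤ.* y ℤ.- b ℤ.* x) ℤ.+ (c ℤ.* y ℤ.- d ℤ.* x)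
      lemma = ℤ-solve-∀

    det-⊕ʳ : ∀ e e′ → det h (e ⊕ e′) ≡ det h e ℤ.+ det h e′
    det-⊕ʳ (a , b) (c , d) = lemma a b c d (proj₁ h) (proj₂ h)
      where
      lemma : ∀ a b c d x y → x ℤ.* (b ℤ.+ d) ℤ.- y ℤ.* (a ℤ.+ c) ≡ (x ℤ.* b ℤ.- y ℤ.* a) ℤ.+ (x ℤ.* d ℤ.- y ℤ.* c)
      lemma = ℤ-solve-∀

    c : ℕ
    c = total (λ m → ∣ det (unit m) u ∣ + ∣ det h (unit m) ∣) (allFin 6)

    coord≤ : ∀ {e} → Small e → ∣ det e u ∣ ≤ c × ∣ det h e ∣ ≤ c
    coord≤ (inj₁ refl) = ≤-trans (≤-reflexive (cong ∣_∣ (e (proj₁ u) (proj₂ u)))) z≤n , ≤-trans (≤-reflexive (cong ∣_∣ (e′ (proj₁ h) (proj₂ h)))) z≤n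
      where
      e : ∀ x y → 0ℤ ℤ.* y ℤ.- 0ℤ ℤ.* x ≡ 0ℤ
      e = ℤ-solve-∀
      e′ : ∀ x y → x ℤ.* 0ℤ ℤ.- y ℤ.* 0ℤ ≡ 0ℤ
      e′ = ℤ-solve-∀
    coord≤ (inj₂ (m , refl)) = m+n≤o⇒m≤o (∣ det (unit m) u ∣) le , m+n≤o⇒n≤o (∣ det (unit m) u ∣) le
      where
      le : ∣ det (unit m) u ∣ + ∣ det h (unit m) ∣ ≤ c
      le = member≤total (λ m → ∣ det (unit m) u ∣ + ∣ det h (unit m) ∣) (∈-allFin m)

    stepReach turnReach twistReach tubeReach : ℕ
    stepReach = 4 + ((g + (c + c)) * size u + (1 + (c + c)) * size h)
    turnReach = total (λ i → rotationReach (⊝ (+ i · u)) + rotationReach (h ⊕ ⊝ (+ i · u))) (upTo g)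
    twistReach = total (λ m → torusReach w (iter (toℕ m) ω w)) (allFin 6)
    tubeReach = stepReach + (turnReach + twistReach)

  module _ (ρ : ℕ) (reach≤ρ : tubeReach ≤ ρ) (G : Triangulation) (D : List (Darts.V G)) (min : Minimum (Triangulation.rotation G) D)
           (Y₀ : List (Darts.Dart G)) (region : Region G ρ Y₀) (P : ∀ {x} → x ∈ Y₀ → NoShort G b x × Fix G w x) where
    open InRegion G ρ D min

    private
      step≤ρ : stepReach ≤ ρ
      step≤ρ = m+n≤o⇒m≤o stepReach reach≤ρ

      hu≤ρ : ∀ {a k} → a ≤ g + (c + c) → k ≤ 1 + (c + c) → a * size u + k * size h ≤ ρ
      hu≤ρ a≤ k≤ = ≤-trans (+-mono-≤ (*-monoˡ-≤ (size u) a≤) (*-monoˡ-≤ (size h) k≤)) (m+n≤o⇒n≤o 4 step≤ρ)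

      u≤ρ : ∀ a → ∣ a ∣ ≤ g + (c + c) → size (a · u) ≤ ρ
      u≤ρ a a≤ = subst (_≤ ρ) (trans (+-identityʳ _) (sym (size-· a u))) (hu≤ρ a≤ z≤n)

      h≤ρ : ∀ a → ∣ a ∣ ≤ 1 + (c + c) → size (a · h) ≤ ρ
      h≤ρ a a≤ = subst (_≤ ρ) (sym (size-· a h)) (hu≤ρ z≤n a≤)

      h¹≤ρ : size h ≤ ρ
      h¹≤ρ = subst (_≤ ρ) (*-identityˡ (size h)) (hu≤ρ {0} {1} z≤n (s≤s z≤n))

      4≤ρ : 4 ≤ ρ
      4≤ρ = m+n≤o⇒m≤o 4 step≤ρ

      2≤ρ : 2 ≤ ρ
      2≤ρ = ≤-trans (s≤s (s≤s z≤n)) 4≤ρ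

      ring≤ρ : ∀ {i} → i ≤ g → size (+ i · u) ≤ ρ
      ring≤ρ {i} i≤g = u≤ρ (+ i) (≤-trans i≤g (m≤m+n g (c + c)))

      w≤ρ : size w ≤ ρ
      w≤ρ = subst (λ p → size p ≤ ρ) (sym w≡) (ring≤ρ ≤-refl)

      H U : Perm Dart
      H = translation h
      U = translation u

      F₁₀ : ∀ {m} x → m ≤ 10 → F 10 x → F m x
      F₁₀ = F-mono

      iter-T : ∀ p m x → size (+ m · p) ≤ ρ → F 2 x → iter m (T p) x ≡ T (+ m · p) x
      iter-T p zero    x m≤ρ fl = refl
      iter-T p (suc m) x m≤ρ fl = trans (cong (T p) (iter-T p m x mp≤ρ fl))
        (trans (T-add p (+ m · p) x (m+n≤o⇒m≤o (size p) split) mp≤ρ fl)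
               (cong (λ q → T q x) (sym (cong₂ _,_ (ℤₚ.suc-* (+ m) (proj₁ p)) (ℤₚ.suc-* (+ m) (proj₂ p))))))
        where
        split : size p + m * size p ≤ ρ
        split = subst (_≤ ρ) (size-· (+ suc m) p) m≤ρ
        mp≤ρ : size (+ m · p) ≤ ρ
        mp≤ρ = subst (_≤ ρ) (sym (size-· (+ m) p)) (m+n≤o⇒n≤o (size p) split)

      pow-T : ∀ p k x → size (k · p) ≤ ρ → F 3 x → pow (translation p) k x ≡ T (k · p) x
      pow-T p (+ m)    x k≤ρ fl = iter-T p m x k≤ρ (F-pred {2} x fl)
      pow-T p -[1+ m ] x k≤ρ fl = trans (cong (pow (translation p) -[1+ m ]) (sym back)) (from-to (pow-perm (translation p) (+ suc m)) y)
        where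
        y = T (-[1+ m ] · p) x
        m≤ρ : size (+ suc m · p) ≤ ρ
        m≤ρ = subst (_≤ ρ) (trans (size-· -[1+ m ] p) (sym (size-· (+ suc m) p))) k≤ρ
        back : iter (suc m) (T p) y ≡ x
        back = trans (iter-T p (suc m) y m≤ρ (F-T {2} { -[1+ m ] · p} x k≤ρ fl))
          (trans (T-add (+ suc m · p) (-[1+ m ] · p) x m≤ρ k≤ρ (F-pred {2} x fl))
                 (cong (λ q → T q x) (trans (cong (+ suc m · p ⊕_) (·-⊝ (+ suc m) p)) (⊕-inverseʳ (+ suc m · p)))))

      U-T : ∀ {i} x → i ≤ g → F 2 x → iter i (to U) x ≡ T (+ i · u) x
      U-T {i} x i≤g fl = iter-T u i x (ring≤ρ i≤g) fl

      Uᵍ : ∀ x → F 2 x → T w x ≡ x → iter g (to U) x ≡ x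
      Uᵍ x fl fix = trans (U-T x ≤-refl fl) (trans (cong (λ p → T p x) (sym w≡)) fix)

      -- A deep dart may have a ring that runs into the boundary. Asking for a deep ring makes `Y`
      -- exactly invariant under `U`, and it discards only boundedly many darts.
      Ring : Dart → Set
      Ring x = All (λ i → F 10 (iter i (to U) x)) (upTo g)

      ring? : ∀ x → Dec (Ring x)
      ring? x = All.all? (λ i → Deep? (iter i (to U) x)) (upTo g)

      Y : List Dart
      Y = filter ring? Y₀

      Y⊆Y₀ : Y ⊆ Y₀
      Y⊆Y₀ x∈ = proj₁ (∈-filter⁻ ring? {xs = Y₀} x∈)

      ring-deep : ∀ {x i} → x ∈ Y → i < g → F 10 (iter i (to U) x)
      ring-deep {x} {i} x∈ i<g = All.lookup (proj₂ (∈-filter⁻ ring? {xs = Y₀} x∈)) (∈-upTo⁺ i<g)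

      deepY : ∀ {x} → x ∈ Y → F 10 x
      deepY x∈ = Region.deep region (Y⊆Y₀ x∈)

      fixY : ∀ {x} → x ∈ Y → T w x ≡ x
      fixY x∈ = proj₂ (P (Y⊆Y₀ x∈))

      UᵍY : ∀ {x} → x ∈ Y → iter g (to U) x ≡ x
      UᵍY {x} x∈ = Uᵍ x (F₁₀ {2} x (s≤s (s≤s z≤n)) (deepY x∈)) (fixY x∈)

      ring∈Y₀ : ∀ {x i} → x ∈ Y → i ≤ g → iter i (to U) x ∈ Y₀
      ring∈Y₀ {x} {i} x∈ i≤g with m≤n⇒m<n∨m≡n i≤g
      ... | inj₂ refl = subst (_∈ Y₀) (sym (UᵍY x∈)) (Y⊆Y₀ x∈)
      ... | inj₁ i<g  = subst (_∈ Y₀) (sym eq) (Region.invariant region (+ i · u) (Y⊆Y₀ x∈) (ring≤ρ i≤g) (subst (F 10) eq (ring-deep x∈ i<g)))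
        where
        eq = U-T {i} x i≤g (F₁₀ {2} x (s≤s (s≤s z≤n)) (deepY x∈))

      U∈Y : ∀ {x} → x ∈ Y → to U x ∈ Y
      U∈Y {x} x∈ = ∈-filter⁺ ring? (ring∈Y₀ x∈ (ℕ.>-nonZero⁻¹ g))
        (All.tabulate λ {i} i∈ → subst (F 10) (iter-out i (to U) x) (Region.deep region (ring∈Y₀ x∈ (∈-upTo⁻ i∈))))

      Uⁱ∈Y : ∀ i {x} → x ∈ Y → iter i (to U) x ∈ Y
      Uⁱ∈Y zero    x∈ = x∈
      Uⁱ∈Y (suc i) x∈ = U∈Y (Uⁱ∈Y i x∈)

      Uᵏ∈Y : ∀ k {x} → x ∈ Y → pow U k x ∈ Y
      Uᵏ∈Y k {x} x∈ = subst (_∈ Y) (sym (pow-mod U g x (UᵍY x∈) k)) (Uⁱ∈Y (k DM.%ℕ g) x∈)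

      fix-T : ∀ p z → size p ≤ ρ → F 2 z → T w z ≡ z → T w (T p z) ≡ T p z
      fix-T p z p≤ρ fl fix = trans (T-comm w p z w≤ρ p≤ρ fl) (cong (T p) fix)

      -- The exponent `k` is arbitrary, far beyond the reach of `ρ` perhaps. Since `w` fixes `z`, it
      -- can first be reduced modulo `g`.
      HU : ∀ k z → F 3 z → T w z ≡ z → to H (pow U k z) ≡ pow U k (to H z)
      HU k z fl fix = begin
        T h (pow U k z) ≡⟨ cong (T h) (trans (pow-mod U g z (Uᵍ z fl₂ fix) k) (U-T z κ≤g fl₂)) ⟩
        T h (T (+ κ · u) z) ≡⟨ T-comm h (+ κ · u) z h¹≤ρ (ring≤ρ κ≤g) fl₂ ⟩
        T (+ κ · u) (T h z) ≡⟨ trans (pow-mod U g (T h z) (Uᵍ (T h z) flH (fix-T h z h¹≤ρ fl₂ fix)) k) (U-T (T h z) κ≤g flH) ⟨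
        pow U k (T h z) ∎
        where
        open ≡-Reasoning
        κ = k DM.%ℕ g
        κ≤g = <⇒≤ (DM.n%ℕd<d k g)
        fl₂ = F-pred {2} z fl
        flH = F-T {2} {h} z h¹≤ρ fl

      -- By `cramer`, a step `s` advances by `det s u` rings along the tube and by `det h s`
      -- positions around it.
      move : ∀ s i z → size s ≤ ρ → ∣ det s u ∣ ≤ c + c → ∣ det h s ∣ ≤ c + c → i ≤ g → F 4 z →
             T s (iter i (to U) z) ≡ pow U (+ i ℤ.+ det h s) (pow H (det s u) z)
      move s i z s≤ρ α≤ β≤ i≤g fl = begin
        T s (iter i (to U) z) ≡⟨ cong (T s) (U-T z i≤g fl₂) ⟩
        T s (T (+ i · u) z) ≡⟨ T-add s (+ i · u) z s≤ρ (ring≤ρ i≤g) fl₂ ⟩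
        T (s ⊕ + i · u) z ≡⟨ cong (λ p → T p z) lattice ⟩
        T ((+ i ℤ.+ β) · u ⊕ α · h) z ≡⟨ T-add ((+ i ℤ.+ β) · u) (α · h) z β′≤ρ α≤ρ fl₂ ⟨
        T ((+ i ℤ.+ β) · u) (T (α · h) z) ≡⟨ pow-T u (+ i ℤ.+ β) (T (α · h) z) β′≤ρ (F-T {3} {α · h} z α≤ρ fl) ⟨
        pow U (+ i ℤ.+ β) (T (α · h) z) ≡⟨ cong (pow U (+ i ℤ.+ β)) (pow-T h α z α≤ρ (F-pred {3} z fl)) ⟨
        pow U (+ i ℤ.+ β) (pow H α z) ∎
        where
        open ≡-Reasoning
        α = det s u
        β = det h s
        fl₂ = F-mono {2} {4} z (s≤s (s≤s z≤n)) fl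
        α≤ρ = h≤ρ α (≤-trans α≤ (n≤1+n _))
        β′≤ρ = u≤ρ (+ i ℤ.+ β) (≤-trans (ℤₚ.∣i+j∣≤∣i∣+∣j∣ (+ i) β) (+-mono-≤ i≤g β≤))
        lattice : s ⊕ + i · u ≡ (+ i ℤ.+ β) · u ⊕ α · h
        lattice = trans (cong (_⊕ + i · u) (cramer s)) (trans (⊕-assoc (α · h) (β · u) (+ i · u)) (trans (⊕-comm (α · h) _)
          (cong (_⊕ α · h) (trans (⊕-comm (β · u) (+ i · u)) (sym (·-⊕ (+ i) β u))))))

      small≤ : ∀ {e} → Small e → size e ≤ 2
      small≤ (inj₁ refl)       = z≤n
      small≤ (inj₂ (m , refl)) = ≤-reflexive (size-unit m)

      -- A closed walk would make the tube a torus. As `d` is not bounded in terms of `ρ`,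
      -- `torus-absurd` does not apply; instead the rings along the walk are shown directly to be
      -- closed under adjacency.
      acyclic : ∀ y d → 1 ≤ d → iter d (to H) y ≡ y → (∀ j → j < d → iter j (to H) y ∈ Y) → ⊥
      acyclic y d 1≤d cycle stays = closed-6-absurd Z deg6 step-Z (vert y) (0 , 0 , 1≤d , ℕ.>-nonZero⁻¹ g , refl)
        where
        open Closed G
        instance
          d≢0 : NonZero d
          d≢0 = ℕ.>-nonZero 1≤d
        Z : V → Set
        Z v = ∃₂ λ j i → j < d × i < g × v ≡ vert (iter i (to U) (iter j (to H) y))
        deg6 : ∀ v → Z v → deg R v ≡ 6
        deg6 v (j , i , j<d , i<g , refl) = flat-deg (iter i (to U) (iter j (to H) y)) (deepY (Uⁱ∈Y i (stays j j<d)))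
        step-Z : ∀ {u v} → Adj R u v → Z u → Z v
        step-Z adj (j , i , j<d , i<g , refl) with adj→unit (iter i (to U) (iter j (to H) y)) (deepY (Uⁱ∈Y i (stays j j<d))) adj
        ... | m , refl = j′ , i′ , DM.n%ℕd<d J d , DM.n%ℕd<d K g , cong vert (begin
            T (unit m) (iter i (to U) z) ≡⟨ move (unit m) i z (small≤ρ 2≤ρ small-m) (≤-trans (proj₁ (coord≤ small-m)) (m≤m+n c c)) (≤-trans (proj₂ (coord≤ small-m)) (m≤m+n c c)) (<⇒≤ i<g) (F₁₀ {4} z (s≤s (s≤s (s≤s (s≤s z≤n)))) (deepY (stays j j<d))) ⟩
            pow U K (pow H (det (unit m) u) z) ≡⟨ cong (pow U K) (pow-+ H (det (unit m) u) (+ j) y) ⟨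
            pow U K (pow H J y) ≡⟨ cong (pow U K) (pow-mod H d y cycle J) ⟩
            pow U K z′ ≡⟨ pow-mod U g z′ (UᵍY (stays j′ (DM.n%ℕd<d J d))) K ⟩
            iter i′ (to U) z′ ∎)
          where
          open ≡-Reasoning
          small-m : Small (unit m)
          small-m = inj₂ (m , refl)
          z = iter j (to H) y
          J = det (unit m) u ℤ.+ + j
          K = + i ℤ.+ det h (unit m)
          j′ = J DM.%ℕ d
          i′ = K DM.%ℕ g
          z′ = iter j′ (to H) y

      fl₂ : ∀ {x} → x ∈ Y → F 2 x
      fl₂ {x} x∈ = F₁₀ {2} x (s≤s (s≤s z≤n)) (deepY x∈)

      fl₄ : ∀ {x} → x ∈ Y → F 4 x
      fl₄ {x} x∈ = F₁₀ {4} x (s≤s (s≤s (s≤s (s≤s z≤n)))) (deepY x∈)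

      r³-T : ∀ p x → size p ≤ ρ → F 2 x → iter 3 r (T (⊝ p) x) ≡ T p (iter 3 r x)
      r³-T p x p≤ρ fl = trans (rᵐ-T 3 (⊝ p) x (subst (_≤ ρ) (sym (size-⊝ p)) p≤ρ) fl)
        (cong (λ q → T q (iter 3 r x)) (trans (ω³ (⊝ p)) (cong₂ _,_ (ℤₚ.neg-involutive (proj₁ p)) (ℤₚ.neg-involutive (proj₂ p)))))

      fix-r³ : ∀ {x} → x ∈ Y → T w (iter 3 r x) ≡ iter 3 r x
      fix-r³ {x} x∈ = trans (sym (r³-T w x w≤ρ (fl₂ x∈))) (cong (iter 3 r) (stab-⊝ x (fl₂ x∈) w w≤ρ (fixY x∈)))

      turn≤ρ : ∀ {i} → i < g → rotationReach (⊝ (+ i · u)) ≤ ρ × rotationReach (h ⊕ ⊝ (+ i · u)) ≤ ρ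
      turn≤ρ {i} i<g = m+n≤o⇒m≤o (rotationReach (⊝ (+ i · u))) le , m+n≤o⇒n≤o (rotationReach (⊝ (+ i · u))) le
        where
        le = ≤-trans (member≤total (λ i → rotationReach (⊝ (+ i · u)) + rotationReach (h ⊕ ⊝ (+ i · u))) (∈-upTo⁺ i<g))
               (m+n≤o⇒m≤o turnReach (m+n≤o⇒n≤o stepReach reach≤ρ))

      -- A walk that came back reversed would turn around a cone point in its middle.
      turn-absurd : ∀ d y k → (∀ j → j ≤ d → iter j (to H) y ∈ Y) → iter d (to H) y ≡ pow U k (iter 3 r y) → ⊥
      turn-absurd d y k stays eq = go d stays eq
        where
        y∈ = stays 0 z≤n
        κ = k DM.%ℕ g
        κ<g = DM.n%ℕd<d k g
        κ≤ρ = ring≤ρ (<⇒≤ κ<g)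
        κ⁻≤ρ = subst (_≤ ρ) (sym (size-⊝ (+ κ · u))) κ≤ρ
        r³y = iter 3 r y
        Uᵏ : pow U k r³y ≡ T (+ κ · u) r³y
        Uᵏ = trans (pow-mod U g r³y (Uᵍ r³y (fl₂ y∈) (fix-r³ y∈)) k) (U-T r³y (<⇒≤ κ<g) (fl₂ y∈))
        back : T (⊝ (+ κ · u)) (pow U k r³y) ≡ r³y
        back = trans (cong (T (⊝ (+ κ · u))) Uᵏ) (T-inverse (+ κ · u) r³y κ≤ρ (fl₂ y∈))
        go : ∀ d → (∀ j → j ≤ d → iter j (to H) y ∈ Y) → iter d (to H) y ≡ pow U k r³y → ⊥
        go zero stays eq = rotation-free 3F (λ ()) (⊝ (+ κ · u)) (proj₁ (turn≤ρ κ<g)) y (fl₄ y∈)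
          (trans (cong (T (⊝ (+ κ · u))) eq) back)
        go (suc zero) stays eq = rotation-free 3F (λ ()) (h ⊕ ⊝ (+ κ · u)) (proj₂ (turn≤ρ κ<g)) y (fl₄ y∈)
          (trans (sym (trans (T-comm (⊝ (+ κ · u)) h y κ⁻≤ρ h¹≤ρ (fl₂ y∈)) (T-add h (⊝ (+ κ · u)) y h¹≤ρ κ⁻≤ρ (fl₂ y∈))))
                 (trans (cong (T (⊝ (+ κ · u))) eq) back))
        go (suc (suc d)) stays eq = turn-absurd d y₁ k (λ j j≤d → subst (_∈ Y) (iter-out j (to H) y) (stays (suc j) (≤-trans (s≤s j≤d) (n≤1+n _))))
          (to-injective H (begin
            to H (iter d (to H) y₁) ≡⟨ cong (to H) (iter-out d (to H) y) ⟨
            iter (suc (suc d)) (to H) y ≡⟨ eq ⟩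
            pow U k r³y ≡⟨ cong (pow U k) turn ⟨
            pow U k (to H (iter 3 r y₁)) ≡⟨ HU k (iter 3 r y₁) (F₁₀ {3} y₁ (s≤s (s≤s (s≤s z≤n))) (deepY y₁∈)) (fix-r³ y₁∈) ⟨
            to H (pow U k (iter 3 r y₁)) ∎))
          where
          open ≡-Reasoning
          y₁ = to H y
          y₁∈ = stays 1 (s≤s z≤n)
          turn : to H (iter 3 r y₁) ≡ r³y
          turn = trans (sym (r³-T h y₁ h¹≤ρ (fl₂ y₁∈))) (cong (iter 3 r) (T-inverse h y h¹≤ρ (fl₂ y∈)))

      -- The dart after the turn would be fixed by `w` and by the turned vector `ωᵐ w`, which are
      -- independent.
      twist-absurd : ∀ m → m ≢ 0F → m ≢ 3F → ∀ {z} → z ∈ Y → iter (toℕ m) r z ∈ Y → ⊥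
      twist-absurd m m≢0 m≢3 {z} z∈ z′∈ = torus-absurd w (iter (toℕ m) ω w) reach (twisted m m≢0 m≢3) (iter (toℕ m) r z) (fl₄ z′∈) (fixY z′∈)
        (trans (sym (rᵐ-T (toℕ m) w z w≤ρ (fl₂ z∈))) (cong (iter (toℕ m) r) (fixY z∈)))
        where
        reach : torusReach w (iter (toℕ m) ω w) ≤ ρ
        reach = ≤-trans (member≤total (λ m → torusReach w (iter (toℕ m) ω w)) (∈-allFin m))
                  (m+n≤o⇒n≤o turnReach (m+n≤o⇒n≤o stepReach reach≤ρ))

      -- Two darts at the same vertex differ by a turn. The half turn is excluded by `turn-absurd`,
      -- the other four nontrivial turns by `twist-absurd`.
      meet : ∀ d y i i′ → (∀ j → j ≤ d → iter j (to H) y ∈ Y) → i < g →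
             vert (iter i (to U) y) ≡ vert (iter i′ (to U) (iter d (to H) y)) → iter i (to U) y ≡ iter i′ (to U) (iter d (to H) y)
      meet d y i i′ stays i<g same with r-orbit (iter i (to U) y) (iter i′ (to U) (iter d (to H) y)) same (flat-deg (iter i (to U) y) (deepY (Uⁱ∈Y i (stays 0 z≤n))))
      ... | m , eq = cases m eq
        where
        y∈ = stays 0 z≤n
        z∈ = Uⁱ∈Y i y∈
        z′∈ = Uⁱ∈Y i′ (stays d ≤-refl)
        twist : ∀ m → m ≢ 0F → m ≢ 3F → iter (toℕ m) r (iter i (to U) y) ≡ iter i′ (to U) (iter d (to H) y) → ⊥
        twist m m≢0 m≢3 eq = twist-absurd m m≢0 m≢3 z∈ (subst (_∈ Y) (sym eq) z′∈)
        cases : ∀ (m : Fin 6) → iter (toℕ m) r (iter i (to U) y) ≡ iter i′ (to U) (iter d (to H) y) →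
                iter i (to U) y ≡ iter i′ (to U) (iter d (to H) y)
        cases 0F eq = eq
        cases 1F eq = ⊥-elim (twist 1F (λ ()) (λ ()) eq)
        cases 2F eq = ⊥-elim (twist 2F (λ ()) (λ ()) eq)
        cases 3F eq = ⊥-elim (turn-absurd d y (ℤ.- + i′ ℤ.+ ℤ.- + i) stays (begin
          iter d (to H) y ≡⟨ from-to (pow-perm U (+ i′)) _ ⟨
          pow U (ℤ.- + i′) (iter i′ (to U) (iter d (to H) y)) ≡⟨ cong (pow U (ℤ.- + i′)) (trans (sym eq) unwind) ⟩
          pow U (ℤ.- + i′) (pow U (ℤ.- + i) (iter 3 r y)) ≡⟨ pow-+ U (ℤ.- + i′) (ℤ.- + i) (iter 3 r y) ⟨
          pow U (ℤ.- + i′ ℤ.+ ℤ.- + i) (iter 3 r y) ∎))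
          where
          open ≡-Reasoning
          i≤ρ = ring≤ρ (<⇒≤ i<g)
          unwind : iter 3 r (iter i (to U) y) ≡ pow U (ℤ.- + i) (iter 3 r y)
          unwind = begin
            iter 3 r (iter i (to U) y) ≡⟨ cong (iter 3 r) (U-T y (<⇒≤ i<g) (fl₂ y∈)) ⟩
            iter 3 r (T (+ i · u) y) ≡⟨ rᵐ-T 3 (+ i · u) y i≤ρ (fl₂ y∈) ⟩
            T (iter 3 ω (+ i · u)) (iter 3 r y) ≡⟨ cong (λ q → T q (iter 3 r y)) (trans (ω³ (+ i · u)) (sym (·-⊝ (+ i) u))) ⟩
            T (ℤ.- + i · u) (iter 3 r y) ≡⟨ pow-T u (ℤ.- + i) (iter 3 r y) (subst (_≤ ρ) (sym (trans (cong size (·-⊝ (+ i) u)) (size-⊝ (+ i · u)))) i≤ρ) (F-pred {3} y (fl₄ y∈)) ⟨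
            pow U (ℤ.- + i) (iter 3 r y) ∎
        cases 4F eq = ⊥-elim (twist 4F (λ ()) (λ ()) eq)
        cases 5F eq = ⊥-elim (twist 5F (λ ()) (λ ()) eq)

      ring-acyclic : ∀ {y i i′} → y ∈ Y → i < i′ → i′ < g → iter i (to U) y ≡ iter i′ (to U) y → ⊥
      ring-acyclic {y} {i} y∈ i<i′ i′<g eq with iter-return U y i<i′ eq
      ... | d , 1≤d , refl , fix = proj₁ (P (Y⊆Y₀ y∈)) (+ d · u) (proj₂ (short d 1≤d d<g)) (proj₁ (short d 1≤d d<g))
        (trans (sym (U-T y (<⇒≤ d<g) (fl₂ y∈))) fix)
        where
        d<g : d < g
        d<g = ≤-<-trans (m≤n+m d i) i′<g

      ring-injective : ∀ {y i i′} → y ∈ Y → i < g → i′ < g → iter i (to U) y ≡ iter i′ (to U) y → i ≡ i′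
      ring-injective {y} {i} {i′} y∈ i<g i′<g eq with <-cmp i i′
      ... | tri≈ _ i≡i′ _ = i≡i′
      ... | tri< i<i′ _ _ = ⊥-elim (ring-acyclic y∈ i<i′ i′<g eq)
      ... | tri> _ _ i′<i = ⊥-elim (ring-acyclic y∈ i′<i i<g (sym eq))

      two-steps : ∀ {z i} e₁ e₂ i′ l → z ∈ Y → i < g → Small e₁ → Small e₂ → + i ℤ.+ det h (e₂ ⊕ e₁) ≡ + i′ ℤ.+ l ℤ.* + g →
                  T e₂ (T e₁ (iter i (to U) z)) ≡ iter i′ (to U) (pow H (det (e₂ ⊕ e₁) u) z)
      two-steps {z} {i} e₁ e₂ i′ l z∈ i<g small₁ small₂ K≡ = begin
        T e₂ (T e₁ (iter i (to U) z)) ≡⟨ T-add e₂ e₁ (iter i (to U) z) (small≤ρ 2≤ρ small₂) (small≤ρ 2≤ρ small₁) (fl₂ (Uⁱ∈Y i z∈)) ⟩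
        T s (iter i (to U) z) ≡⟨ move s i z s≤ρ α≤ β≤ (<⇒≤ i<g) (fl₄ z∈) ⟩
        pow U (+ i ℤ.+ det h s) z″ ≡⟨ cong (λ k → pow U k z″) K≡ ⟩
        pow U (+ i′ ℤ.+ l ℤ.* + g) z″ ≡⟨ pow-shift U g z″ period (+ i′) l ⟩
        iter i′ (to U) z″ ∎
        where
        open ≡-Reasoning
        s = e₂ ⊕ e₁
        z″ = pow H (det s u) z
        s≤ρ : size s ≤ ρ
        s≤ρ = ≤-trans (size-⊕ e₂ e₁) (≤-trans (+-mono-≤ (small≤ small₂) (small≤ small₁)) 4≤ρ)
        α≤ : ∣ det s u ∣ ≤ c + c
        α≤ = ≤-trans (≤-reflexive (cong ∣_∣ (det-⊕ˡ e₂ e₁))) (≤-trans (ℤₚ.∣i+j∣≤∣i∣+∣j∣ (det e₂ u) (det e₁ u))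
               (+-mono-≤ (proj₁ (coord≤ small₂)) (proj₁ (coord≤ small₁))))
        β≤ : ∣ det h s ∣ ≤ c + c
        β≤ = ≤-trans (≤-reflexive (cong ∣_∣ (det-⊕ʳ e₂ e₁))) (≤-trans (ℤₚ.∣i+j∣≤∣i∣+∣j∣ (det h e₂) (det h e₁))
               (+-mono-≤ (proj₂ (coord≤ small₂)) (proj₂ (coord≤ small₁))))
        α≤ρ = h≤ρ (det s u) (≤-trans α≤ (n≤1+n _))
        z″≡ : z″ ≡ T (det s u · h) z
        z″≡ = pow-T h (det s u) z α≤ρ (F-pred {3} z (fl₄ z∈))
        period : iter g (to U) z″ ≡ z″
        period = subst (λ x → iter g (to U) x ≡ x) (sym z″≡)
          (Uᵍ (T (det s u · h) z) (F-pred {2} (T (det s u · h) z) (F-T {3} {det s u · h} z α≤ρ (fl₄ z∈))) (fix-T (det s u · h) z α≤ρ (fl₂ z∈) (fixY z∈)))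

      reachable : ∀ {z i v} → z ∈ Y → i < g → Near R (vert (iter i (to U) z)) v → ∃ λ e₁ → Small e₁ ×
        (∀ e₂ i′ l → Small e₂ → + i ℤ.+ det h (e₂ ⊕ e₁) ≡ + i′ ℤ.+ l ℤ.* + g →
          Near R (vert (iter i′ (to U) (pow H (det (e₂ ⊕ e₁) u) z))) v)
      reachable {z} {i} {v} z∈ i<g near =
        let x′ = iter i (to U) z
            x′∈ = Uⁱ∈Y i z∈
            (e₁ , small₁ , v≡) = near→small x′ (deepY x′∈) near
        in e₁ , small₁ , λ e₂ i′ l small₂ K≡ →
          subst₂ (Near R) (cong vert (two-steps {z} {i} e₁ e₂ i′ l z∈ i<g small₁ small₂ K≡)) (sym v≡)
            (small→near {e₂} (T e₁ x′) (F-T {9} {e₁} x′ (small≤ρ 2≤ρ small₁) (deepY x′∈)) small₂)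

      HU∈Y : ∀ k {z} → z ∈ Y → to H (pow U k z) ≡ pow U k (to H z)
      HU∈Y k {z} z∈ = HU k z (F-pred {3} z (fl₄ z∈)) (fixY z∈)

      Y-unique : Unique Y
      Y-unique = Uniqueₚ.filter⁺ ring? (Region.unique region)

      open TubeWalk.Density tube G c coord≤ det-⊕ˡ det-⊕ʳ D min H U Y Y-unique acyclic Uᵏ∈Y HU∈Y meet ring-injective reachable

      ¬ring⇒shallow : ∀ {x} → F 2 x → ¬ Ring x → ∃ λ i → i < g × ¬ F 10 (T (+ i · u) x)
      ¬ring⇒shallow {x} fl ¬ring with find (Allₚ.¬All⇒Any¬ (λ i → Deep? (iter i (to U) x)) (upTo g) ¬ring)
      ... | i , i∈ , ¬deep = i , ∈-upTo⁻ i∈ , λ deep → ¬deep (subst (F 10) (sym (U-T x (<⇒≤ (∈-upTo⁻ i∈)) fl)) deep)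

      -- Either the predecessor of a start or some dart on the ring of the predecessor is not deep,
      -- so every start is close to an end of the flat part.
      few-starts : length starts ≤ margin
      few-starts = few-shallow starts (Uniqueₚ.filter⁺ _ Y-unique) λ {e} e∈ → shallow (∈-starts⁻ e∈)
        where
        h⁻≤ρ : size (⊝ h) ≤ ρ
        h⁻≤ρ = subst (_≤ ρ) (sym (size-⊝ h)) h¹≤ρ
        shallow : ∀ {e} → e ∈ Y × from H e ∉ Y → ∃ λ p → size p ≤ ρ × ¬ F 10 (T p e)
        shallow {e} (e∈ , e⁻∉) with Deep? (T (⊝ h) e)
        ... | no  ¬deep = ⊝ h , h⁻≤ρ , ¬deep
        ... | yes deep with ring? (T (⊝ h) e)
        ...   | yes ring = ⊥-elim (e⁻∉ (subst (_∈ Y) (sym e⁻≡) (∈-filter⁺ ring? (Region.invariant region (⊝ h) (Y⊆Y₀ e∈) h⁻≤ρ deep) ring)))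
          where
          e⁻≡ : from H e ≡ T (⊝ h) e
          e⁻≡ = to-injective H (trans (to-from H e) (sym (trans (T-add h (⊝ h) e h¹≤ρ h⁻≤ρ (fl₂ e∈)) (cong (λ q → T q e) (⊕-inverseʳ h)))))
        ...   | no ¬ring with ¬ring⇒shallow (F₁₀ {2} (T (⊝ h) e) (s≤s (s≤s z≤n)) deep) ¬ring
        ...     | i , i<g , ¬deep = + i · u ⊕ ⊝ h , i-h≤ρ , λ deep′ → ¬deep (subst (F 10) (sym (T-add (+ i · u) (⊝ h) e (ring≤ρ (<⇒≤ i<g)) h⁻≤ρ (fl₂ e∈))) deep′)
          where
          i-h≤ρ : size (+ i · u ⊕ ⊝ h) ≤ ρ
          i-h≤ρ = ≤-trans (size-⊕ (+ i · u) (⊝ h)) (subst (_≤ ρ)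
            (sym (cong₂ _+_ (size-· (+ i) u) (trans (size-⊝ h) (sym (*-identityˡ (size h))))))
            (hu≤ρ {i} {1} (≤-trans (<⇒≤ i<g) (m≤m+n g (c + c))) (s≤s z≤n)))

      few-outside : total χ Y₀ ≤ total χ Y + margin
      few-outside = begin
        total χ Y₀ ≡⟨ total-filter ring? χ Y₀ ⟩
        total χ Y + total χ (filter (¬? ∘ ring?) Y₀) ≤⟨ +-monoʳ-≤ (total χ Y) (≤-trans (total-χ≤length (filter (¬? ∘ ring?) Y₀)) (few-shallow _ (Uniqueₚ.filter⁺ (¬? ∘ ring?) (Region.unique region)) shallow)) ⟩
        total χ Y + margin ∎
        where
        open ≤-Reasoning
        shallow : ∀ {x} → x ∈ filter (¬? ∘ ring?) Y₀ → ∃ λ p → size p ≤ ρ × ¬ F 10 (T p x)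
        shallow {x} x∈ with ∈-filter⁻ (¬? ∘ ring?) {xs = Y₀} x∈
        ... | x∈Y₀ , ¬ring with ¬ring⇒shallow (F₁₀ {2} x (s≤s (s≤s z≤n)) (Region.deep region x∈Y₀)) ¬ring
        ...   | i , i<g , ¬deep = + i · u , ring≤ρ (<⇒≤ i<g) , ¬deep

    tube-bound : 6 * total χ Y₀ ≤ length Y₀ + (margin * (N * suc (B + B)) + 6 * margin)
    tube-bound = begin
      6 * total χ Y₀ ≤⟨ *-monoʳ-≤ 6 few-outside ⟩
      6 * (total χ Y + margin) ≡⟨ *-distribˡ-+ 6 (total χ Y) margin ⟩
      6 * total χ Y + 6 * margin ≤⟨ +-monoˡ-≤ (6 * margin) tube-density ⟩
      length Y + length starts * M + 6 * margin ≤⟨ +-monoˡ-≤ (6 * margin) (+-mono-≤ (Listₚ.length-filter ring? Y₀) (*-monoˡ-≤ M few-starts)) ⟩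
      length Y₀ + margin * M + 6 * margin ≡⟨ +-assoc (length Y₀) (margin * M) (6 * margin) ⟩
      length Y₀ + (margin * M + 6 * margin) ∎
      where
      open ≤-Reasoning
      M = N * suc (B + B)

  tube-sparse : Sparse (λ G x → NoShort G b x × Fix G w x)
  tube-sparse = tubeReach , λ ρ reach≤ρ →
    nearBound (11 * ρ + 3) * (N * suc (c + c + N + (c + c + N))) + 6 * nearBound (11 * ρ + 3) ,
    λ G D min Y region P → tube-bound ρ reach≤ρ G D min Y region P

-- Dominating sets of narrow tubes

record Datum : Set where
  constructor datum
  field
    g     : ℕ
    h₁ h₂ : ℤ
    N     : ℕ
    cells : List (ℕ × ℕ)

entry : ∀ {A : Set} → A → List A → ℕ → A
entry d []       _       = d
entry d (x ∷ xs) zero    = x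
entry d (x ∷ xs) (suc i) = entry d xs i

-- The entry for w = (- a , b), where b = 3 , … , 12 and a = 0 , … , b - 1, lists g = gcd a b, a vector h
-- completing u = w / g to a basis of Λ, a period N and a dominating set of Λ modulo w and N h. The dominating sets
-- were found by simulated annealing.
table : List (List Datum)
table =
  (datum 3 (+ 1) (+ 0) 2 ((0 , 0) ∷ []) ∷
   datum 1 (+ 0) (+ 1) 6 ((1 , 0) ∷ []) ∷
   datum 1 (+ 1) -[1+ 0 ] 6 ((0 , 0) ∷ []) ∷ []) ∷
  (datum 4 (+ 1) (+ 0) 3 ((1 , 0) ∷ (1 , 2) ∷ []) ∷
   datum 1 (+ 0) (+ 1) 6 ((0 , 0) ∷ []) ∷
   datum 2 (+ 0) (+ 1) 12 ((1 , 1) ∷ (5 , 0) ∷ (7 , 0) ∷ (11 , 1) ∷ []) ∷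
   datum 1 (+ 1) -[1+ 0 ] 6 ((2 , 0) ∷ []) ∷ []) ∷
  (datum 5 (+ 1) (+ 0) 5 ((0 , 4) ∷ (1 , 1) ∷ (3 , 2) ∷ (3 , 4) ∷ []) ∷
   datum 1 (+ 0) (+ 1) 7 ((3 , 0) ∷ []) ∷
   datum 1 (+ 1) -[1+ 1 ] 6 ((3 , 0) ∷ []) ∷
   datum 1 -[1+ 0 ] (+ 2) 6 ((1 , 0) ∷ []) ∷
   datum 1 (+ 1) -[1+ 0 ] 7 ((6 , 0) ∷ []) ∷ []) ∷
  (datum 6 (+ 1) (+ 0) 2 ((1 , 0) ∷ (1 , 3) ∷ []) ∷
   datum 1 (+ 0) (+ 1) 12 ((4 , 0) ∷ (7 , 0) ∷ []) ∷
   datum 2 (+ 0) (+ 1) 3 ((2 , 0) ∷ []) ∷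
   datum 3 (+ 0) (+ 1) 2 ((0 , 0) ∷ []) ∷
   datum 2 (+ 1) -[1+ 0 ] 3 ((1 , 0) ∷ []) ∷
   datum 1 (+ 1) -[1+ 0 ] 12 ((0 , 0) ∷ (9 , 0) ∷ []) ∷ []) ∷
  (datum 7 (+ 1) (+ 0) 6 ((0 , 0) ∷ (1 , 4) ∷ (2 , 1) ∷ (3 , 5) ∷ (4 , 2) ∷ (5 , 3) ∷ (5 , 6) ∷ []) ∷
   datum 1 (+ 0) (+ 1) 12 ((4 , 0) ∷ (7 , 0) ∷ []) ∷
   datum 1 (+ 1) -[1+ 2 ] 19 ((1 , 0) ∷ (5 , 0) ∷ (16 , 0) ∷ []) ∷
   datum 1 (+ 1) -[1+ 1 ] 6 ((0 , 0) ∷ []) ∷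
   datum 1 -[1+ 0 ] (+ 2) 6 ((3 , 0) ∷ []) ∷
   datum 1 -[1+ 1 ] (+ 3) 19 ((0 , 0) ∷ (3 , 0) ∷ (11 , 0) ∷ []) ∷
   datum 1 (+ 1) -[1+ 0 ] 12 ((6 , 0) ∷ (9 , 0) ∷ []) ∷ []) ∷
  (datum 8 (+ 1) (+ 0) 3 ((0 , 5) ∷ (1 , 1) ∷ (1 , 7) ∷ (2 , 3) ∷ []) ∷
   datum 1 (+ 0) (+ 1) 12 ((1 , 0) ∷ (11 , 0) ∷ []) ∷
   datum 2 (+ 0) (+ 1) 3 ((2 , 0) ∷ []) ∷
   datum 1 -[1+ 0 ] (+ 3) 6 ((1 , 0) ∷ []) ∷
   datum 4 (+ 0) (+ 1) 3 ((0 , 3) ∷ (2 , 1) ∷ []) ∷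
   datum 1 (+ 2) -[1+ 2 ] 6 ((1 , 0) ∷ []) ∷
   datum 2 (+ 1) -[1+ 0 ] 3 ((0 , 1) ∷ []) ∷
   datum 1 (+ 1) -[1+ 0 ] 12 ((0 , 0) ∷ (10 , 0) ∷ []) ∷ []) ∷
  (datum 9 (+ 1) (+ 0) 2 ((0 , 0) ∷ (0 , 3) ∷ (0 , 6) ∷ []) ∷
   datum 1 (+ 0) (+ 1) 6 ((4 , 0) ∷ []) ∷
   datum 1 (+ 1) -[1+ 3 ] 6 ((0 , 0) ∷ []) ∷
   datum 3 (+ 0) (+ 1) 2 ((1 , 1) ∷ []) ∷
   datum 1 (+ 1) -[1+ 1 ] 6 ((2 , 0) ∷ []) ∷
   datum 1 -[1+ 0 ] (+ 2) 6 ((2 , 0) ∷ []) ∷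
   datum 3 (+ 1) -[1+ 0 ] 2 ((1 , 0) ∷ []) ∷
   datum 1 -[1+ 2 ] (+ 4) 6 ((2 , 0) ∷ []) ∷
   datum 1 (+ 1) -[1+ 0 ] 6 ((2 , 0) ∷ []) ∷ []) ∷
  (datum 10 (+ 1) (+ 0) 3 ((0 , 6) ∷ (1 , 0) ∷ (1 , 8) ∷ (2 , 2) ∷ (2 , 4) ∷ []) ∷
   datum 1 (+ 0) (+ 1) 6 ((4 , 0) ∷ []) ∷
   datum 2 (+ 0) (+ 1) 7 ((2 , 0) ∷ (2 , 1) ∷ []) ∷
   datum 1 (+ 1) -[1+ 2 ] 6 ((4 , 0) ∷ []) ∷
   datum 2 (+ 1) -[1+ 1 ] 3 ((0 , 0) ∷ []) ∷
   datum 5 (+ 0) (+ 1) 5 ((0 , 1) ∷ (3 , 1) ∷ (3 , 3) ∷ (4 , 4) ∷ []) ∷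
   datum 2 -[1+ 0 ] (+ 2) 3 ((0 , 0) ∷ []) ∷
   datum 1 -[1+ 1 ] (+ 3) 6 ((5 , 0) ∷ []) ∷
   datum 2 (+ 1) -[1+ 0 ] 7 ((2 , 0) ∷ (2 , 1) ∷ []) ∷
   datum 1 (+ 1) -[1+ 0 ] 6 ((0 , 0) ∷ []) ∷ []) ∷
  (datum 11 (+ 1) (+ 0) 5 ((0 , 3) ∷ (0 , 5) ∷ (1 , 0) ∷ (2 , 6) ∷ (2 , 8) ∷ (3 , 1) ∷ (3 , 3) ∷ (4 , 8) ∷ (4 , 10) ∷ []) ∷
   datum 1 (+ 0) (+ 1) 13 ((2 , 0) ∷ (8 , 0) ∷ []) ∷
   datum 1 (+ 1) -[1+ 4 ] 6 ((1 , 0) ∷ []) ∷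
   datum 1 -[1+ 0 ] (+ 4) 6 ((1 , 0) ∷ []) ∷
   datum 1 -[1+ 0 ] (+ 3) 12 ((4 , 0) ∷ (6 , 0) ∷ []) ∷
   datum 1 (+ 1) -[1+ 1 ] 7 ((1 , 0) ∷ []) ∷
   datum 1 -[1+ 0 ] (+ 2) 7 ((3 , 0) ∷ []) ∷
   datum 1 (+ 2) -[1+ 2 ] 12 ((2 , 0) ∷ (4 , 0) ∷ []) ∷
   datum 1 (+ 3) -[1+ 3 ] 6 ((1 , 0) ∷ []) ∷
   datum 1 -[1+ 3 ] (+ 5) 6 ((3 , 0) ∷ []) ∷
   datum 1 (+ 1) -[1+ 0 ] 13 ((3 , 0) ∷ (9 , 0) ∷ []) ∷ []) ∷
  (datum 12 (+ 1) (+ 0) 2 ((0 , 3) ∷ (1 , 0) ∷ (1 , 6) ∷ (1 , 9) ∷ []) ∷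
   datum 1 (+ 0) (+ 1) 7 ((6 , 0) ∷ []) ∷
   datum 2 (+ 0) (+ 1) 3 ((2 , 0) ∷ []) ∷
   datum 3 (+ 0) (+ 1) 2 ((1 , 2) ∷ []) ∷
   datum 4 (+ 0) (+ 1) 3 ((1 , 0) ∷ (1 , 2) ∷ []) ∷
   datum 1 -[1+ 1 ] (+ 5) 13 ((7 , 0) ∷ (10 , 0) ∷ []) ∷
   datum 6 (+ 0) (+ 1) 2 ((0 , 4) ∷ (1 , 1) ∷ []) ∷
   datum 1 (+ 3) -[1+ 4 ] 13 ((9 , 0) ∷ (12 , 0) ∷ []) ∷
   datum 4 (+ 1) -[1+ 0 ] 3 ((0 , 0) ∷ (0 , 2) ∷ []) ∷
   datum 3 (+ 1) -[1+ 0 ] 2 ((0 , 2) ∷ []) ∷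
   datum 2 (+ 1) -[1+ 0 ] 3 ((1 , 0) ∷ []) ∷
   datum 1 (+ 1) -[1+ 0 ] 7 ((5 , 0) ∷ []) ∷ []) ∷ []

-- The rows of the table begin at width 3. The default value has `g` = 0 and hence can never be
-- certified.
datumAt : ℕ → ℕ → Datum
datumAt b a = entry (datum 0 0ℤ 0ℤ 0 []) (entry [] table (b ℕ.∸ 3)) a

smalls : List Λ
smalls = 𝟘 ∷ map unit (allFin 6)

smalls-small : ∀ {e} → e ∈ smalls → Small e
smalls-small (here refl) = inj₁ refl
smalls-small (there e∈) with ∈-map⁻ unit {xs = allFin 6} e∈
... | m , _ , refl = inj₂ (m , refl)

-- The conditions of `Tube` in decidable form: the unknown integers in `covered` become quotients,
-- and their existence becomes a statement about remainders.
module Check (a b : ℕ) (d : Datum) (g≢0 : NonZero (Datum.g d)) (N≢0 : NonZero (Datum.N d)) where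
  open Datum d
  private
    instance
      _ = g≢0
      _ = N≢0

  h u w : Λ
  h = h₁ , h₂
  u = ℤ.- + (a / g) , + (b / g)
  w = ℤ.- + a , + b

  Dominated : ℕ → ℕ → Set
  Dominated j i = Any.Any (λ e → ((+ j ℤ.+ det e u) DM.%ℕ N , (+ i ℤ.+ det h e) DM.%ℕ g) ∈ cells) smalls

  Valid : Set
  Valid = w ≡ + g · u × det h u ≡ 1ℤ ×
          All (λ i → i ≡ 0 ⊎ (hex (+ i · u) < b × + i · u ≢ 𝟘)) (upTo (g)) ×
          (∀ (m : Fin 6) → m ≡ 0F ⊎ m ≡ 3F ⊎ det w (iter (toℕ m) ω w) ≢ 0ℤ) ×
          6 * length (cells) ≤ N * g ×
          All (λ (j , i) → j < N × i < g) (cells) ×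
          All (λ j → All (Dominated j) (upTo (g))) (upTo (N))

  valid? : Dec Valid
  valid? = (w ≟Λ (+ g · u)) ×-dec (det h u ℤ.≟ 1ℤ) ×-dec
    All.all? (λ i → (i ℕ.≟ 0) ⊎-dec ((hex (+ i · u) <? b) ×-dec ¬? ((+ i · u) ≟Λ 𝟘))) (upTo (g)) ×-dec
    Finₚ.all? (λ m → (m Fin.≟ 0F) ⊎-dec (m Fin.≟ 3F) ⊎-dec ¬? (det w (iter (toℕ m) ω w) ℤ.≟ 0ℤ)) ×-dec
    (6 * length (cells) ≤? N * g) ×-dec
    All.all? (λ (j , i) → (j <? N) ×-dec (i <? g)) (cells) ×-dec
    All.all? (λ j → All.all? (λ i → Any.any? (λ e → member? (Productₚ.≡-dec ℕ._≟_ ℕ._≟_) _ (cells)) smalls) (upTo (g))) (upTo (N))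

  tube : Valid → Tube w b
  tube (w≡ , basis , short , twisted , density , inRange , covered) = record
    { h = h ; u = u ; g = g ; N = N ; motif = cells ; w≡ = w≡ ; basis = basis
    ; short = λ i 1≤i i<g → case₁ 1≤i (All.lookup short (∈-upTo⁺ i<g))
    ; twisted = λ m m≢0 m≢3 → case₂ m≢0 m≢3 (twisted m)
    ; density = density
    ; inRange = λ ji∈ → All.lookup inRange ji∈
    ; covered = λ j i j<N i<g → case₃ (find (All.lookup (All.lookup covered (∈-upTo⁺ j<N)) (∈-upTo⁺ i<g)))
    }
    where
    case₁ : ∀ {i} {P : Set} → 1 ≤ i → i ≡ 0 ⊎ P → P
    case₁ () (inj₁ refl)
    case₁ _  (inj₂ p) = p
    case₂ : ∀ {m : Fin 6} {P : Set} → m ≢ 0F → m ≢ 3F → m ≡ 0F ⊎ m ≡ 3F ⊎ P → P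
    case₂ m≢0 m≢3 (inj₁ eq)        = ⊥-elim (m≢0 eq)
    case₂ m≢0 m≢3 (inj₂ (inj₁ eq)) = ⊥-elim (m≢3 eq)
    case₂ m≢0 m≢3 (inj₂ (inj₂ p))  = p
    case₃ : ∀ {j i} → (∃ λ e → e ∈ smalls × ((+ j ℤ.+ det e u) DM.%ℕ N , (+ i ℤ.+ det h e) DM.%ℕ g) ∈ cells) →
            ∃ λ e → Small e × ∃₂ λ j′ i′ → (j′ , i′) ∈ cells × ∃₂ λ k l →
            + j ℤ.+ det e u ≡ + j′ ℤ.+ k ℤ.* + N × + i ℤ.+ det h e ≡ + i′ ℤ.+ l ℤ.* + g
    case₃ {j} {i} (e , e∈ , ∈cells) = e , smalls-small e∈ , _ , _ , ∈cells , (+ j ℤ.+ det e u) DM./ℕ N , (+ i ℤ.+ det h e) DM./ℕ g ,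
      DM.a≡a%ℕn+[a/ℕn]*n (+ j ℤ.+ det e u) (N) , DM.a≡a%ℕn+[a/ℕn]*n (+ i ℤ.+ det h e) (g)

Certified : ℕ → ℕ → Set
Certified b a = Σ (NonZero (Datum.g (datumAt b a))) λ g≢0 → Σ (NonZero (Datum.N (datumAt b a))) λ N≢0 → Check.Valid a b (datumAt b a) g≢0 N≢0

certified? : ∀ b a → Dec (Certified b a)
certified? b a with ℕ.nonZero? (Datum.g (datumAt b a)) | ℕ.nonZero? (Datum.N (datumAt b a))
... | no ¬g | _ = no (¬g ∘ proj₁)
... | yes _ | no ¬N = no (¬N ∘ proj₁ ∘ proj₂)
... | yes g≢0 | yes N≢0 with Check.valid? a b (datumAt b a) g≢0 N≢0
...   | yes v = yes (g≢0 , N≢0 , v)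
...   | no ¬v = no λ where (_ , _ , v) → ¬v v

-- Established by evaluating the decision procedure on all entries, so nothing depends on how they
-- were found.
table-certified : ∀ (b : Fin 10) (a : Fin (3 + toℕ b)) → Certified (3 + toℕ b) (toℕ a)
table-certified = toWitness {a? = Finₚ.all? λ b → Finₚ.all? λ (a : Fin (3 + toℕ b)) → certified? (3 + toℕ b) (toℕ a)} _

table-tube : ∀ (b : Fin 10) (a : Fin (3 + toℕ b)) → Tube (ℤ.- + toℕ a , + (3 + toℕ b)) (3 + toℕ b)
table-tube b a = let (g≢0 , N≢0 , valid) = table-certified b a in
  Check.tube (toℕ a) (3 + toℕ b) (datumAt (3 + toℕ b) (toℕ a)) g≢0 N≢0 valid

-- The theorem

hex-ω : ∀ p → hex (ω p) ≡ hex p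
hex-ω (i , j) = begin
  ∣ ℤ.- j ∣ ⊔ ∣ i ℤ.+ j ∣ ⊔ ∣ ℤ.- j ℤ.+ (i ℤ.+ j) ∣ ≡⟨ cong₂ (λ a b → a ⊔ ∣ i ℤ.+ j ∣ ⊔ ∣ b ∣) (ℤₚ.∣-i∣≡∣i∣ j) (lemma i j) ⟩
  ∣ j ∣ ⊔ ∣ i ℤ.+ j ∣ ⊔ ∣ i ∣ ≡⟨ ⊔-comm (∣ j ∣ ⊔ ∣ i ℤ.+ j ∣) (∣ i ∣) ⟩
  ∣ i ∣ ⊔ (∣ j ∣ ⊔ ∣ i ℤ.+ j ∣) ≡⟨ ⊔-assoc (∣ i ∣) (∣ j ∣) (∣ i ℤ.+ j ∣) ⟨
  ∣ i ∣ ⊔ ∣ j ∣ ⊔ ∣ i ℤ.+ j ∣ ∎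
  where
  open ≡-Reasoning
  lemma : ∀ i j → ℤ.- j ℤ.+ (i ℤ.+ j) ≡ i
  lemma = ℤ-solve-∀

hex-ωᵐ : ∀ m p → hex (iter m ω p) ≡ hex p
hex-ωᵐ zero    p = refl
hex-ωᵐ (suc m) p = trans (hex-ω (iter m ω p)) (hex-ωᵐ m p)

hex-sector : ∀ a b → a < b → hex (ℤ.- + a , + b) ≡ b
hex-sector a b a<b = trans (m≥n⇒m⊔n≡m (≤-trans (in-abs (subst (λ z → In z b b) (ℤₚ.+-comm (+ b) (ℤ.- + a)) (in-difference ≤-refl (<⇒≤ a<b)))) (m≤n⊔m _ b)))
  (m≤n⇒m⊔n≡n (≤-trans (≤-reflexive (ℤₚ.∣-i∣≡∣i∣ (+ a))) (<⇒≤ a<b)))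

size≤3hex : ∀ p → size p ≤ 3 * hex p
size≤3hex p@(i , j) = ≤-trans (+-mono-≤ (+-mono-≤ fst≤hex snd≤hex) sum≤hex)
  (≤-reflexive (lemma (hex p)))
  where
  fst≤hex : ∣ i ∣ ≤ hex p
  fst≤hex = ≤-trans (m≤m⊔n (∣ i ∣) (∣ j ∣)) (m≤m⊔n (∣ i ∣ ⊔ ∣ j ∣) (∣ i ℤ.+ j ∣))
  snd≤hex : ∣ j ∣ ≤ hex p
  snd≤hex = ≤-trans (m≤n⊔m (∣ i ∣) (∣ j ∣)) (m≤m⊔n (∣ i ∣ ⊔ ∣ j ∣) (∣ i ℤ.+ j ∣))
  sum≤hex : ∣ i ℤ.+ j ∣ ≤ hex p
  sum≤hex = m≤n⊔m (∣ i ∣ ⊔ ∣ j ∣) (∣ i ℤ.+ j ∣)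
  lemma : ∀ k → k + k + k ≡ 3 * k
  lemma = solve-∀

ω-injective-𝟘 : ∀ p → ω p ≡ 𝟘 → p ≡ 𝟘
ω-injective-𝟘 p ωp≡𝟘 = trans (sym (trans (cong₂ _,_ (ℤₚ.neg-involutive (proj₁ p)) (ℤₚ.neg-involutive (proj₂ p))) refl)) (cong ⊝_ (trans (sym (ω³ p)) (cong (ω ∘ ω) ωp≡𝟘)))

-- The vectors `(- a , b)` with `a < b` form a fundamental domain for the powers of `ω` on the
-- nonzero vectors: a cone of 60 degrees with one of its two rays.
Sector : Λ → Set
Sector t = ∃₂ λ a b → a < b × ∃ λ (m : Fin 6) → t ≡ iter (toℕ m) ω (ℤ.- + a , + b)

private
  ω² : ∀ a b → (ℤ.- b , ℤ.- a) ≡ iter 2 ω (ℤ.- a , b ℤ.+ a)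
  ω² a b = cong₂ _,_ (e₁ a b) (e₂ a b)
    where
    e₁ : ∀ a b → ℤ.- b ≡ ℤ.- (ℤ.- a ℤ.+ (b ℤ.+ a))
    e₁ = ℤ-solve-∀
    e₂ : ∀ a b → ℤ.- a ≡ ℤ.- (b ℤ.+ a) ℤ.+ (ℤ.- a ℤ.+ (b ℤ.+ a))
    e₂ = ℤ-solve-∀

  ω⁴ : ∀ a b → (b ℤ.+ a , ℤ.- b) ≡ iter 4 ω (ℤ.- a , b ℤ.+ a)
  ω⁴ a b = sym (trans (cong ω (ω³ (ℤ.- a , b ℤ.+ a))) (cong₂ _,_ (ℤₚ.neg-involutive (b ℤ.+ a)) (e a b)))
    where
    e : ∀ a b → ℤ.- ℤ.- a ℤ.+ ℤ.- (b ℤ.+ a) ≡ ℤ.- b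
    e = ℤ-solve-∀

  ω⁵ : ∀ a b → (b , a) ≡ iter 5 ω (ℤ.- a , b ℤ.+ a)
  ω⁵ a b = sym (trans (cong (ω ∘ ω) (ω³ (ℤ.- a , b ℤ.+ a))) (cong₂ _,_ (e₁ a b) (e₂ a b)))
    where
    e₁ : ∀ a b → ℤ.- (ℤ.- ℤ.- a ℤ.+ ℤ.- (b ℤ.+ a)) ≡ b
    e₁ = ℤ-solve-∀
    e₂ : ∀ a b → ℤ.- ℤ.- (b ℤ.+ a) ℤ.+ (ℤ.- ℤ.- a ℤ.+ ℤ.- (b ℤ.+ a)) ≡ a
    e₂ = ℤ-solve-∀

sector : ∀ t → t ≢ 𝟘 → Sector t
sector (+ zero , + zero) t≢𝟘 = ⊥-elim (t≢𝟘 refl)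
sector (+ zero , + suc y) _ = 0 , suc y , s≤s z≤n , 0F , refl
sector (+ suc x , + y) _ = y , suc x + y , s≤s (m≤n+m y x) , 5F , ω⁵ (+ y) (+ suc x)
sector (+ x , -[1+ y ]) _ with ≤-total (suc y) x
... | inj₁ y<x = x ∸ suc y , x , subst (x ∸ suc y <_) (m+[n∸m]≡n y<x) (s≤s (m≤n+m (x ∸ suc y) y)) , 4F ,
  subst (λ z → (+ z , -[1+ y ]) ≡ iter 4 ω (ℤ.- + (x ∸ suc y) , + z)) (m+[n∸m]≡n y<x) (ω⁴ (+ (x ∸ suc y)) (+ suc y))
... | inj₂ x≤1+y with m≤n⇒m<n∨m≡n x≤1+y
...   | inj₁ x<1+y = x , suc y , x<1+y , 3F , sym (trans (ω³ (ℤ.- + x , + suc y)) (cong (_, -[1+ y ]) (ℤₚ.neg-involutive (+ x))))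
-- On the ray between two cones `a` would be equal to `b`, so the vector is counted with the next
-- cone, where `a` is 0.
...   | inj₂ refl  = 0 , suc y , s≤s z≤n , 4F , subst (λ z → (z , -[1+ y ]) ≡ iter 4 ω (0ℤ , z)) (ℤₚ.+-identityʳ (+ suc y)) (ω⁴ 0ℤ (+ suc y))
sector (-[1+ x ] , + y) _ with ≤-total y (suc x)
sector (-[1+ x ] , + zero) _ | inj₁ _ = 0 , suc x , s≤s z≤n , 2F , subst (λ z → (-[1+ x ] , 0ℤ) ≡ iter 2 ω (0ℤ , z)) (ℤₚ.+-identityʳ (+ suc x)) (ω² 0ℤ (+ suc x))
sector (-[1+ x ] , + suc y) _ | inj₁ y≤x = suc x ∸ suc y , suc x , subst (suc x ∸ suc y <_) (m+[n∸m]≡n y≤x) (s≤s (m≤n+m (suc x ∸ suc y) y)) , 1F ,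
  cong (-[1+ x ] ,_) (trans (e (+ (suc x ∸ suc y)) (+ suc y)) (cong (λ z → ℤ.- + (suc x ∸ suc y) ℤ.+ + z) (m+[n∸m]≡n y≤x)))
  where
  e : ∀ k y → y ≡ ℤ.- k ℤ.+ (y ℤ.+ k)
  e = ℤ-solve-∀
sector (-[1+ x ] , + y) _ | inj₂ x<y with m≤n⇒m<n∨m≡n x<y
... | inj₁ 1+x<y = suc x , y , 1+x<y , 0F , refl
... | inj₂ refl  = 0 , suc x , s≤s z≤n , 1F , refl
sector (-[1+ x ] , -[1+ y ]) _ = suc y , suc x + suc y , s≤s (m≤n+m (suc y) x) , 2F , ω² (+ suc y) (+ suc x)

-- Combining sparse classes

sparse-weaken : ∀ {P P′ : (G : Triangulation) → Darts.Dart G → Set} → (∀ {G x} → P′ G x → P G x) → Sparse P → Sparse P′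
sparse-weaken P′⇒P (ρ₀ , s) = ρ₀ , λ ρ ρ₀≤ρ → let (C , bound) = s ρ ρ₀≤ρ in
  C , λ G D min Y region P′Y → bound G D min Y region (λ x∈ → P′⇒P (P′Y x∈))

sparse-absurd : ∀ {P : (G : Triangulation) → Darts.Dart G → Set} ρ₀ → (∀ {G ρ x} → ρ₀ ≤ ρ → Local.F G ρ 10 x → P G x → ⊥) → Sparse P
sparse-absurd ρ₀ absurd = ρ₀ , λ ρ ρ₀≤ρ → 0 , λ where
  G D min []      region PY → z≤n
  G D min (x ∷ Y) region PY → ⊥-elim (absurd {G} {ρ} {x} ρ₀≤ρ (Region.deep region (here refl)) (PY (here refl)))

-- Translations commute with `T t`, so being fixed by `t` and not being fixed by it are both
-- preserved, and the two parts of a region are regions.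
sparse-split : ∀ t {P : (G : Triangulation) → Darts.Dart G → Set} →
  Sparse (λ G x → P G x × Fix G t x) → Sparse (λ G x → P G x × ¬ Fix G t x) → Sparse P
sparse-split t {P} (ρ₁ , s₁) (ρ₂ , s₂) = size t + (ρ₁ + ρ₂) , λ ρ reach≤ρ →
  let (C₁ , bound₁) = s₁ ρ (m+n≤o⇒m≤o ρ₁ (m+n≤o⇒n≤o (size t) reach≤ρ))
      (C₂ , bound₂) = s₂ ρ (m+n≤o⇒n≤o ρ₁ (m+n≤o⇒n≤o (size t) reach≤ρ))
  in C₁ + C₂ , λ G D min Y region PY →
    let open InRegion G ρ D min
        fix? = λ x → T t x ≟ᵈ x
        t≤ρ = m+n≤o⇒m≤o (size t) reach≤ρ
        b₁ = bound₁ G D min (filter fix? Y) (part G ρ t≤ρ Y region fix? (proj₁ (fixes-move G ρ t≤ρ)))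
               (λ x∈ → let (x∈Y , fix) = ∈-filter⁻ fix? {xs = Y} x∈ in PY x∈Y , fix)
        b₂ = bound₂ G D min (filter (¬? ∘ fix?) Y) (part G ρ t≤ρ Y region (¬? ∘ fix?) (proj₂ (fixes-move G ρ t≤ρ)))
               (λ x∈ → let (x∈Y , fix) = ∈-filter⁻ (¬? ∘ fix?) {xs = Y} x∈ in PY x∈Y , fix)
    in combine {total χ Y} {total χ (filter fix? Y)} {total χ (filter (¬? ∘ fix?) Y)} {length Y} {length (filter fix? Y)} (total-filter fix? χ Y) (length-filter-split fix? Y) b₁ b₂
  where
  fixes-move : ∀ G ρ → size t ≤ ρ →
    (∀ {x} p → size p ≤ ρ → Local.F G ρ 10 x → Fix G t x → Fix G t (Translations.T G p x)) ×
    (∀ {x} p → size p ≤ ρ → Local.F G ρ 10 x → ¬ Fix G t x → ¬ Fix G t (Translations.T G p x))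
  fixes-move G ρ t≤ρ =
    (λ {x} p p≤ρ fl fix → trans (T-comm t p x t≤ρ p≤ρ (F-mono {2} {10} x (s≤s (s≤s z≤n)) fl)) (cong (T p) fix)) ,
    (λ {x} p p≤ρ fl ¬fix fix → ¬fix (to-injective (translation p) (trans (sym (T-comm t p x t≤ρ p≤ρ (F-mono {2} {10} x (s≤s (s≤s z≤n)) fl))) fix)))
    where
    open Translations G
    open Local G ρ
  part : ∀ G ρ → size t ≤ ρ → ∀ Y → Region G ρ Y → {S : Darts.Dart G → Set} (S? : Decidable S) →
         (∀ {x} p → size p ≤ ρ → Local.F G ρ 10 x → S x → S (Translations.T G p x)) → Region G ρ (filter S? Y)
  part G ρ t≤ρ Y region S? S-move = record
    { unique = Uniqueₚ.filter⁺ S? (Region.unique region)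
    ; deep = λ x∈ → Region.deep region (proj₁ (∈-filter⁻ S? {xs = Y} x∈))
    ; invariant = λ p x∈ p≤ρ fl → let (x∈Y , Sx) = ∈-filter⁻ S? {xs = Y} x∈ in
        ∈-filter⁺ S? (Region.invariant region p x∈Y p≤ρ fl) (S-move p p≤ρ (Region.deep region x∈Y) Sx) }
  combine : ∀ {d d₁ d₂ y y₁ y₂ C₁ C₂} → d ≡ d₁ + d₂ → y ≡ y₁ + y₂ → 6 * d₁ ≤ y₁ + C₁ → 6 * d₂ ≤ y₂ + C₂ → 6 * d ≤ y + (C₁ + C₂)
  combine {d₁ = d₁} {d₂} {y₁ = y₁} {y₂} {C₁} {C₂} refl refl le₁ le₂ = ≤-trans (≤-reflexive (*-distribˡ-+ 6 d₁ d₂))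
    (≤-trans (+-mono-≤ le₁ le₂) (≤-reflexive (lemma y₁ C₁ y₂ C₂)))
    where
    lemma : ∀ a b c d → (a + b) + (c + d) ≡ (a + c) + (b + d)
    lemma = solve-∀

ShortestFix : ℕ → Λ → (G : Triangulation) → Darts.Dart G → Set
ShortestFix b w G x = NoShort G b x × Fix G w x

-- The region is turned by `r⁻`, which keeps every vertex and therefore the count of `D`. The
-- summand `3 * b` lets `ρ` reach every vector of `hex` less than `b`, so that `NoShort` is carried
-- over as well.
sparse-rotate : ∀ b w → Sparse (ShortestFix b w) → Sparse (ShortestFix b (ω w))
sparse-rotate b w (ρ₀ , s) = size w + 3 * b + ρ₀ , λ ρ reach≤ρ →
  let (C , bound) = s ρ (m+n≤o⇒n≤o (size w + 3 * b) reach≤ρ) in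
  C , λ G D min Y region PY →
    let open InRegion G ρ D min
    in subst₂ (λ d y → 6 * d ≤ y + C) (total-map χ r⁻ Y) (Listₚ.length-map r⁻ Y)
         (bound G D min (map r⁻ Y) (rotated G ρ Y region) (rotated-fix G ρ reach≤ρ Y region PY))
  where
  rotated : ∀ G ρ Y → Region G ρ Y → Region G ρ (map (Darts.r⁻ G) Y)
  rotated G ρ Y region = record
    { unique = Uniqueₚ.map⁺ (λ {x} {y} eq → trans (sym (to-from rot x)) (trans (cong r eq) (to-from rot y))) (Region.unique region)
    ; deep = deep
    ; invariant = invariant }
    where
    open Translations G
    open Local G ρ
    deep : ∀ {x} → x ∈ map r⁻ Y → F 10 x
    deep x∈ with ∈-map⁻ r⁻ x∈
    ... | y , y∈ , refl = Region.deep region y∈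
    invariant : ∀ {x} p → x ∈ map r⁻ Y → size p ≤ ρ → F 10 (T p x) → T p x ∈ map r⁻ Y
    invariant p x∈ p≤ρ fl with ∈-map⁻ r⁻ x∈
    ... | y , y∈ , refl = subst (_∈ map r⁻ Y) (trans (cong r⁻ (sym move)) (from-to rot (T p (r⁻ y))))
        (∈-map⁺ r⁻ (Region.invariant region (ω p) y∈ (subst (_≤ ρ) (sym (size-ω p)) p≤ρ) (subst (F 10) move fl)))
      where
      move : r (T p (r⁻ y)) ≡ T (ω p) y
      move = trans (r-T′ p (r⁻ y) p≤ρ (F-mono {2} {10} y (s≤s (s≤s z≤n)) (Region.deep region y∈))) (cong (T (ω p)) (to-from rot y))
  rotated-fix : ∀ G ρ → size w + 3 * b + ρ₀ ≤ ρ → ∀ Y → Region G ρ Y → (∀ {x} → x ∈ Y → ShortestFix b (ω w) G x) →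
                ∀ {x} → x ∈ map (Darts.r⁻ G) Y → ShortestFix b w G x
  rotated-fix G ρ reach≤ρ Y region PY x∈ with ∈-map⁻ (Darts.r⁻ G) x∈
  ... | y , y∈ , refl = noShort , to-injective rot (trans (move w w≤ρ) (trans (proj₂ (PY y∈)) (sym (to-from rot y))))
    where
    open Translations G
    open Local G ρ
    w≤ρ : size w ≤ ρ
    w≤ρ = m+n≤o⇒m≤o (size w) (m+n≤o⇒m≤o (size w + 3 * b) reach≤ρ)
    move : ∀ p → size p ≤ ρ → r (T p (r⁻ y)) ≡ T (ω p) y
    move p p≤ρ = trans (r-T′ p (r⁻ y) p≤ρ (F-mono {2} {10} y (s≤s (s≤s z≤n)) (Region.deep region y∈))) (cong (T (ω p)) (to-from rot y))
    noShort : NoShort G b (r⁻ y)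
    noShort t t≢𝟘 t<b fix = proj₁ (PY y∈) (ω t) (t≢𝟘 ∘ ω-injective-𝟘 t) (subst (_< b) (sym (hex-ω t)) t<b)
      (trans (sym (move t t≤ρ)) (trans (cong r fix) (to-from rot y)))
      where
      t≤ρ : size t ≤ ρ
      t≤ρ = ≤-trans (size≤3hex t) (≤-trans (*-monoʳ-≤ 3 (<⇒≤ t<b)) (m+n≤o⇒n≤o (size w) (m+n≤o⇒m≤o (size w + 3 * b) reach≤ρ)))

sparse-rotateᵐ : ∀ m b w → Sparse (ShortestFix b w) → Sparse (ShortestFix b (iter m ω w))
sparse-rotateᵐ zero    b w s = s
sparse-rotateᵐ (suc m) b w s = sparse-rotate b (iter m ω w) (sparse-rotateᵐ m b w s)

private
  2≤ρ⇒unit : ∀ {ρ} → 6 ≤ ρ → ∀ m → size (unit m) ≤ ρ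
  2≤ρ⇒unit 6≤ρ m = ≤-trans (≤-reflexive (size-unit m)) (≤-trans (s≤s (s≤s z≤n)) 6≤ρ)

  -- The period would identify two neighbours of `x`, but different darts at a vertex have different
  -- heads.
  two-units-absurd : ∀ {G ρ x} w m m′ (d : Fin 6) → d ≢ 0F → toℕ m′ ≡ toℕ d + toℕ m → unit m ⊕ w ≡ unit m′ → size w ≤ 6 → 6 ≤ ρ →
                     Local.F G ρ 10 x → Fix G w x → ⊥
  two-units-absurd {G} {ρ} {x} w m m′ d d≢0 m′≡ eq w≤6 6≤ρ fl fix = r-free d d≢0 (iter (toℕ m) r x)
    (subst (λ v → deg R v ≡ 6) (sym (vert-iter-r (toℕ m) x)) (flat-deg x fl))
    (trans (sym (iter-+ (toℕ d) (toℕ m) r x)) (trans (cong (λ k → iter k r x) (sym m′≡)) (sym same)))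
    where
    open Translations G
    open Local G ρ
    moved : T (unit m) x ≡ T (unit m′) x
    moved = trans (cong (T (unit m)) (sym fix)) (trans (T-add (unit m) w x (2≤ρ⇒unit 6≤ρ m) (≤-trans w≤6 6≤ρ) (F-mono {2} {10} x (s≤s (s≤s z≤n)) fl)) (cong (λ p → T p x) eq))
    same : iter (toℕ m) r x ≡ iter (toℕ m′) r x
    same = unit-injective {m} {m′} x fl (cong vert moved)

-- A period of length 1 would be a loop and one of length 2 a double edge. The table serves the
-- lengths `3 + β` up to 12, and the perfect code all longer ones.
sparse-sector : ∀ a b → a < b → Sparse (ShortestFix b (ℤ.- + a , + b))
sparse-sector 0 1 _ = sparse-absurd 0 λ {G} {ρ} {x} _ fl (_ , fix) → Translations.unit-no-loop G 5F x fl (cong (Darts.vert G) fix)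
sparse-sector 0 2 _ = sparse-absurd 6 λ {G} {ρ} {x} 6≤ρ fl (_ , fix) → two-units-absurd {G} {ρ} {x} (0ℤ , + 2) 2F 5F 3F (λ ()) refl refl (s≤s (s≤s (s≤s (s≤s z≤n)))) 6≤ρ fl fix
sparse-sector 1 2 _ = sparse-absurd 6 λ {G} {ρ} {x} 6≤ρ fl (_ , fix) → two-units-absurd {G} {ρ} {x} (-1ℤ , + 2) 2F 4F 2F (λ ()) refl refl (s≤s (s≤s (s≤s (s≤s z≤n)))) 6≤ρ fl fix
sparse-sector (suc a) 1 (s≤s ())
sparse-sector (suc (suc a)) 2 (s≤s (s≤s ()))
sparse-sector a (suc (suc (suc β))) a<b with β ℕ.<? 10
... | yes β<10 = tube-sparse (subst₂ (λ a β → Tube (ℤ.- + a , + (3 + β)) (3 + β)) a≡ β≡ (table-tube b′ a′))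
  where
  b′ = Fin.fromℕ< β<10
  β≡ : toℕ b′ ≡ β
  β≡ = Finₚ.toℕ-fromℕ< β<10
  a<′ : a < 3 + toℕ b′
  a<′ = subst (λ k → a < 3 + k) (sym β≡) a<b
  a′ = Fin.fromℕ< a<′
  a≡ : toℕ a′ ≡ a
  a≡ = Finₚ.toℕ-fromℕ< a<′
... | no  β≮10 = patch-sparse (ThinPatch.thin-patch a (2 + β) (β ∸ 10) _ a<b (cong (λ k → 2 + k) (sym (m+[n∸m]≡n (≮⇒≥ β≮10)))) refl)

sparse-fat : ∃ λ b → Sparse (λ G x → NoShort G b x)
-- For `w = 𝟘` every dart is fixed, by `refl`.
sparse-fat = FatPatch.girth _ refl , sparse-weaken (λ noShort → noShort , refl) (patch-sparse (FatPatch.fat-patch _ refl))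

private
  -- The sphere of radius `b` about the origin in the metric `hex`, as six sides of `b` vectors; for
  -- `b = 0` it is empty, so `𝟘` never occurs.
  hexagon : ℕ → List Λ
  hexagon b = cartesianProductWith (λ (m : Fin 6) a → iter (toℕ m) ω (ℤ.- + a , + b)) (allFin 6) (upTo b)

  Avoids : ℕ → List Λ → (G : Triangulation) → Darts.Dart G → Set
  Avoids b L G x = NoShort G b x × (∀ {t} → t ∈ L → ¬ Fix G t x)

  sparse-avoid : ∀ b L → (∀ {t} → t ∈ L → Sparse (ShortestFix b t)) → Sparse (Avoids b L) → Sparse (λ G x → NoShort G b x)
  sparse-avoid b []      _     s = sparse-weaken (λ noShort → noShort , λ ()) s
  sparse-avoid b (t ∷ L) fixes s = sparse-avoid b L (fixes ∘ there) (sparse-split t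
    (sparse-weaken (λ ((noShort , _) , fix) → noShort , fix) (fixes (here refl)))
    (sparse-weaken (λ ((noShort , avoid) , ¬fix) → noShort , λ where (here refl) → ¬fix; (there t∈) → avoid t∈) s))

  -- The darts lost in passing from `b` to `suc b` are fixed by one of the finitely many vectors of
  -- the hexagon, for which `b` is the shortest length. The induction descends, starting from the
  -- girth of the fat patch.
  sparse-level : ∀ b → Sparse (λ G x → NoShort G (suc b) x) → Sparse (λ G x → NoShort G b x)
  sparse-level b s = sparse-avoid b (hexagon b) fixes (sparse-weaken (λ {G} {x} → next {G} {x}) s)
    where
    fixes : ∀ {t} → t ∈ hexagon b → Sparse (ShortestFix b t)
    fixes t∈ with ∈-cartesianProductWith⁻ (λ (m : Fin 6) a → iter (toℕ m) ω (ℤ.- + a , + b)) (allFin 6) (upTo b) t∈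
    ... | m , a , _ , a∈ , refl = sparse-rotateᵐ (toℕ m) b (ℤ.- + a , + b) (sparse-sector a b (∈-upTo⁻ a∈))
    next : ∀ {G x} → Avoids b (hexagon b) G x → NoShort G (suc b) x
    next {G} {x} (noShort , avoid) t t≢𝟘 t<1+b fix with m≤n⇒m<n∨m≡n (≤-pred t<1+b) | sector t t≢𝟘
    ... | inj₁ t<b | _ = noShort t t≢𝟘 t<b fix
    ... | inj₂ t≡b | a , b′ , a<b′ , m , refl = avoid (∈-cartesianProductWith⁺ (λ (m : Fin 6) a → iter (toℕ m) ω (ℤ.- + a , + b)) (∈-allFin m) (∈-upTo⁺ (subst (a <_) b′≡b a<b′)))
        (subst (λ b → Fix G (iter (toℕ m) ω (ℤ.- + a , + b)) x) b′≡b fix)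
      where
      b′≡b : b′ ≡ b
      b′≡b = trans (sym (trans (hex-ωᵐ (toℕ m) (ℤ.- + a , + b′)) (hex-sector a b′ a<b′))) t≡b

  sparse-all : ∀ b → Sparse (λ G x → NoShort G b x) → Sparse (λ G x → NoShort G 0 x)
  sparse-all zero    s = s
  sparse-all (suc b) s = sparse-all b (sparse-level b s)

-- Existence of a minimum dominating set

module _ {n} (R : RotationSystem n) where

  adj? : ∀ u v → Dec (Adj R u v)
  adj? u v = Finₚ.any? λ t → nbr R u t Fin.≟ v

  dominating? : ∀ D → Dec (Dominating R D)
  dominating? D = Finₚ.all? λ v → member? Fin._≟_ v D ⊎-dec Finₚ.any? λ u → member? Fin._≟_ u D ×-dec adj? u v

  any-vec? : ∀ k {P : Vec (Fin n) k → Set} → Decidable P → Dec (∃ P)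
  any-vec? zero    P? = map′ (λ p → [] , p) (λ where ([] , p) → p) (P? [])
  any-vec? (suc k) P? = map′ (λ (v , vs , p) → v ∷ vs , p) (λ where (v ∷ vs , p) → v , vs , p)
    (Finₚ.any? λ v → any-vec? k λ vs → P? (v ∷ vs))

  private
    search : ∀ fuel k → fuel + k ≡ n → (∀ D → Dominating R D → k ≤ length D) → ∃ λ D → Minimum R D
    search zero k refl lower = allFin n , record { dominating = λ v → inj₁ (∈-allFin v) ; minimum = λ D dom → subst (_≤ length D) (sym (length-allFin n)) (lower D dom) }
    search (suc fuel) k k≡ lower with any-vec? k (λ vs → dominating? (toList vs))
    ... | yes (vs , dom) = toList vs , record { dominating = dom ; minimum = λ D dom → subst (_≤ length D) (sym (Vecₚ.length-toList vs)) (lower D dom) }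
    ... | no  ¬dom = search fuel (suc k) (trans (+-suc fuel k) k≡) λ D dom → ≤∧≢⇒< (lower D dom) λ where
      refl → ¬dom (fromList D , subst (Dominating R) (sym (Vecₚ.toList∘fromList D)) dom)

  minimum-exists : ∃ λ D → Minimum R D
  minimum-exists = search n 0 (+-identityʳ n) (λ _ _ → z≤n)

-- From darts back to vertices

module Final (G : Triangulation) (ρ C : ℕ) where
  open Counting G
  open Translations G
  open Local G ρ

  module _ (D : List V) (min : Minimum R D)
           (sparse : ∀ Y → Region G ρ Y → 6 * total (Indicator.χᵥ D ∘ vert) Y ≤ length Y + C) where
    open Indicator D
    open InRegion G ρ D min using (χ; Deep?; total-χ≤length)

    private
      Y : List Dart
      Y = filter Deep? darts

      region : Region G ρ Y
      region = record
        { unique = Uniqueₚ.filter⁺ Deep? darts-unique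
        ; deep = λ x∈ → proj₂ (∈-filter⁻ Deep? {xs = darts} x∈)
        ; invariant = λ p _ _ fl → ∈-filter⁺ Deep? (∈-darts (T p _)) fl }

      near = nearBound (10 * ρ + 3)

      length-darts : length darts ≡ degSum R
      length-darts = trans (length≡total darts) (trans (total-concatMap (λ _ → 1) dartsAt (allFin n)) (lemma (allFin n)))
        where
        lemma : ∀ vs → total (total (λ _ → 1) ∘ dartsAt) vs ≡ sum (map (deg R) vs)
        lemma []       = refl
        lemma (v ∷ vs) = cong₂ _+_ (trans (sym (length≡total (dartsAt v))) (length-dartsAt v)) (lemma vs)

      total-χ-darts : total χ darts ≡ total (λ v → deg R v * χᵥ v) (allFin n)
      total-χ-darts = trans (total-concatMap χ dartsAt (allFin n)) (lemma (allFin n))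
        where
        at : ∀ v → total χ (dartsAt v) ≡ deg R v * χᵥ v
        at v = trans (total-map χ (dart v) (allFin (deg R v))) (trans (total-const (χᵥ v) (allFin (deg R v))) (cong (_* χᵥ v) (length-allFin (deg R v))))
        lemma : ∀ vs → total (total χ ∘ dartsAt) vs ≡ total (λ v → deg R v * χᵥ v) vs
        lemma []       = refl
        lemma (v ∷ vs) = cong₂ _+_ (at v) (lemma vs)

      defect : total (λ v → 6 ∸ deg R v) (allFin n) ≡ 12
      defect = +-cancelˡ-≡ (degSum R) _ _ (trans (lemma (allFin n)) (trans (cong (6 *_) (length-allFin n)) (sym euler)))
        where
        lemma : ∀ vs → sum (map (deg R) vs) + total (λ v → 6 ∸ deg R v) vs ≡ 6 * length vs
        lemma []       = refl
        lemma (v ∷ vs) = trans (interchange (deg R v) (sum (map (deg R) vs)) (6 ∸ deg R v) _)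
          (trans (cong₂ _+_ (m+[n∸m]≡n (Δ≤6 v)) (lemma vs)) (sym (*-suc 6 (length vs))))

      few : total χ darts ≤ total χ Y + near
      few = begin
        total χ darts ≡⟨ total-filter Deep? χ darts ⟩
        total χ Y + total χ (filter (¬? ∘ Deep?) darts) ≤⟨ +-monoʳ-≤ (total χ Y) (≤-trans (total-χ≤length (filter (¬? ∘ Deep?) darts)) (few-not-flat (10 * ρ + 3) (filter (¬? ∘ Deep?) darts) (Uniqueₚ.filter⁺ (¬? ∘ Deep?) darts-unique) (λ x∈ → proj₂ (∈-filter⁻ (¬? ∘ Deep?) {xs = darts} x∈)))) ⟩
        total χ Y + near ∎
        where open ≤-Reasoning

      -- A vertex is counted once per dart, which is too seldom when its degree is less than 6. By
      -- Euler's formula the shortfalls add up to 12, see `defect`.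
      6χ≤ : ∀ v → 6 * χᵥ v ≤ deg R v * χᵥ v + (6 ∸ deg R v)
      6χ≤ v with χᵥ v | χᵥ≤1 v
      ... | 0 | _ = z≤n
      ... | 1 | _ = ≤-reflexive (sym (trans (cong (_+ (6 ∸ deg R v)) (*-identityʳ (deg R v))) (m+[n∸m]≡n (Δ≤6 v))))
      ... | suc (suc _) | s≤s ()

    -- `D` without repetitions, so that its length is the sum of `χᵥ`.
    dominators : List V
    dominators = filter (_∈ᵥ? D) (allFin n)

    dominators-dominate : Dominating R dominators
    dominators-dominate v with dominating min v
    ... | inj₁ v∈             = inj₁ (∈-filter⁺ (_∈ᵥ? D) (∈-allFin v) v∈)
    ... | inj₂ (u , u∈ , adj) = inj₂ (u , ∈-filter⁺ (_∈ᵥ? D) (∈-allFin u) u∈ , adj)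

    dominators-few : 6 * length dominators ≤ n + (C + 6 * (near + 12))
    dominators-few = *-cancelˡ-≤ 6 (begin
      6 * (6 * length dominators) ≡⟨ cong (λ k → 6 * (6 * k)) (total-χᵥ (allFin n)) ⟨
      6 * (6 * total χᵥ (allFin n)) ≡⟨ cong (6 *_) (total-* (allFin n)) ⟨
      6 * total (λ v → 6 * χᵥ v) (allFin n) ≤⟨ *-monoʳ-≤ 6 (total-mono (allFin n) (λ {v} _ → 6χ≤ v)) ⟩
      6 * total (λ v → deg R v * χᵥ v + (6 ∸ deg R v)) (allFin n) ≡⟨ cong (6 *_) (trans (total-+ (λ v → deg R v * χᵥ v) (λ v → 6 ∸ deg R v) (allFin n)) (cong₂ _+_ (sym total-χ-darts) defect)) ⟩
      6 * (total χ darts + 12) ≤⟨ *-monoʳ-≤ 6 (+-monoˡ-≤ 12 few) ⟩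
      6 * (total χ Y + near + 12) ≡⟨ e₁ (total χ Y) near ⟩
      6 * total χ Y + 6 * (near + 12) ≤⟨ +-monoˡ-≤ (6 * (near + 12)) (sparse Y region) ⟩
      length Y + C + 6 * (near + 12) ≤⟨ +-monoˡ-≤ (6 * (near + 12)) (+-monoˡ-≤ C (≤-trans (Listₚ.length-filter Deep? darts) (≤-trans (≤-reflexive length-darts) (≤-trans (m≤m+n _ 12) (≤-reflexive euler))))) ⟩
      6 * n + C + 6 * (near + 12) ≡⟨ +-assoc (6 * n) C _ ⟩
      6 * n + (C + 6 * (near + 12)) ≤⟨ +-monoʳ-≤ (6 * n) (m≤n*m (C + 6 * (near + 12)) 6) ⟩
      6 * n + 6 * (C + 6 * (near + 12)) ≡⟨ *-distribˡ-+ 6 n _ ⟨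
      6 * (n + (C + 6 * (near + 12))) ∎)
      where
      open ≤-Reasoning
      e₁ : ∀ d m → 6 * (d + m + 12) ≡ 6 * d + 6 * (m + 12)
      e₁ = solve-∀
      total-* : ∀ vs → total (λ v → 6 * χᵥ v) vs ≡ 6 * total χᵥ vs
      total-* []       = refl
      total-* (v ∷ vs) = trans (cong (λ k → 6 * χᵥ v + k) (total-* vs)) (sym (*-distribˡ-+ 6 (χᵥ v) (total χᵥ vs)))

private
  Bounded : Set
  Bounded = ∃ λ (c : ℕ) → ∀ (n : ℕ) (R : RotationSystem n) → IsPlaneTriangulation R → (∀ v → deg R v ≤ 6) →
            ∃ λ (D : List (Fin n)) → Dominating R D × (6 * length D ≤ n + 6 * c)

  bounded : Sparse (λ G x → NoShort G 0 x) → Bounded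
  bounded (ρ , s) = C + 6 * (nearBound (10 * ρ + 3) + 12) , λ n R pt Δ≤6 →
    let G = record { rotation = R ; planar = pt ; Δ≤6 = Δ≤6 }
        (D , min) = minimum-exists R
        -- No vector has `hex` less than 0, so `NoShort G 0` holds for every dart.
        sparse = λ Y region → proj₂ (s ρ ≤-refl) G D min Y region (λ _ t _ → λ ())
    in Final.dominators G ρ C D min sparse , Final.dominators-dominate G ρ C D min sparse ,
       ≤-trans (Final.dominators-few G ρ C D min sparse) (+-monoʳ-≤ n (m≤n*m _ 6))
    where
    C = proj₁ (s ρ ≤-refl)

  -- Taking the pair as an argument keeps `b` a variable; the descent is then never unfolded at the
  -- actual girth, which exceeds 100000.
  sparse-everywhere : (∃ λ b → Sparse (λ G x → NoShort G b x)) → Sparse (λ G x → NoShort G 0 x)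
  sparse-everywhere (b , s) = sparse-all b s

theorem2 : ∃ λ (c : ℕ) → ∀ (n : ℕ) (R : RotationSystem n) → IsPlaneTriangulation R → (∀ v → deg R v ≤ 6) → ∃ λ (D : List (Fin n)) → Dominating R D × (6 * length D ≤ n + 6 * c)
theorem2 = bounded (sparse-everywhere sparse-fat)
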